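{- For every finite multiset $S$ of integers and every $d\ge 0$, \[ \mathsf{DS}^{*}(S,d;\mathbf{x})=\sum_P s_{\lambda(P)}(\mathbf{x}), \] where $P$ ranges over all Dyck tableaux with entries the multiset $S$ and $\mathrm{di}(\mathrm{RR}(P))=d$.
   Context: Sequences are finite integer sequences indexed from $0$, possibly empty; $|F|$ is the length of $F$. For $x=(x_0,\ldots,x_{m-1})$, $\mathrm{di}(x)=\#\{(i,j):0\le i<j<m,\ x_i=x_j+1\}$. A sequence $x$ is dual Dyck if $x_{i+1}\ge x_i+2$ for all $0\le i<m-1$. A factorization of $S$ is an ordered sequence $\mathcal F=(F_0,F_1,F_2,\ldots)$ of finite sequences, all but finitely many empty, such that the concatenation $F_0F_1F_2\cdots$ is a permutation (rearrangement) of the multiset $S$; it is a dual Dyck factorization if each $F_i$ is a dual Dyck sequence, and $\mathrm{di}(\mathcal F)=\mathrm{di}(F_0F_1F_2\cdots)$. Variables are $\mathbf{x}=(x_0,x_1,x_2,\ldots)$. The dual Dyck symmetric function is \[ \mathsf{DS}^{*}(S,d;\mathbf{x})=\sum_{\mathcal F}\ \prod_{r\ge0}x_r^{|F_r|}, \] the sum over dual Dyck factorizations $\mathcal F$ of $S$ with $\mathrm{di}(\mathcal F)=d$. A Dyck tableau is a left-aligned tableau with rows $T_0,T_1,\ldots,T_{\ell-1}$ from top to bottom (nonempty rows; the tableau with no rows is allowed), with $|T_0|\ge|T_1|\ge\cdots\ge|T_{\ell-1}|$, such that each row read left to right is a dual Dyck sequence, and whenever adjacent rows $T_j$ and $T_{j+1}$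 both have an entry in column $p$, $T_j[p]\le T_{j+1}[p]+1$. Its row-reading word is $\mathrm{RR}(P)=T_{\ell-1}T_{\ell-2}\cdots T_0$ (rows read left to right, bottom row first). Its shape $\lambda(P)$ is the partition of row lengths. $s_\lambda(\mathbf x)$ is the Schur function in the variables $x_0,x_1,x_2,\ldots$. -}

module Defs where

open import Data.Integer as ℤ using (ℤ; 1ℤ; +_)
import Data.Integer.Properties as ℤ
open import Data.List.Base
  using (List; []; _∷_; _++_; [_]; map; concat; concatMap; filter; length; reverse; upTo;
         zip; deduplicate; cartesianProductWith)
open import Data.List.Membership.Propositional using (_∈_; lose)
open import Data.List.Membership.Propositional.Properties
  using (∈-∃++; ∈-cartesianProductWith⁺; ∈-filter⁺; ∈-filter⁻; ∈-deduplicate⁺;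
         ∈-deduplicate⁻; ∈-concatMap⁺; ∈-upTo⁺)
import Data.List.Membership.DecPropositional as DecMembership
open import Data.List.Properties using (≡-dec; length-++)
open import Data.List.Relation.Binary.Permutation.Propositional
  using (_↭_; ↭-refl; ↭-sym; ↭-trans)
open import Data.List.Relation.Binary.Permutation.Propositional.Properties
  using (shift; drop-∷; ∈-resp-↭; ↭-length)
open import Data.List.Relation.Unary.All as All using (All; []; _∷_)
import Data.List.Relation.Unary.All.Properties as All
open import Data.List.Relation.Unary.Any using (here; there)
open import Data.List.Relation.Unary.Linked as Linked using (Linked)
open import Data.List.Relation.Unary.Unique.Propositional using (Unique)
import Data.List.Relation.Unary.Unique.DecPropositional.Properties as Unique
open import Data.Nat.Base as ℕ using (ℕ; zero; suc; _<_; _≤_; _≥_; s≤s; z≤n)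
open import Data.Nat.ListAction using (sum)
import Data.Nat.Properties as ℕ
open import Data.Product.Base using (_×_; _,_; uncurry; proj₂)
open import Function.Bundles using (_⇔_; mk⇔)
open import Level using (Level; _⊔_)
open import Relation.Binary.Core using (Rel)
open import Relation.Binary.Definitions using (DecidableEquality)
import Relation.Binary.Definitions as B
open import Relation.Binary.PropositionalEquality using (_≡_; refl; sym; trans; cong)
open import Relation.Nullary.Decidable using (yes; no; _×-dec_; map′)
open import Relation.Unary using (Pred; Decidable)

private
  variable
    a p : Level
    A : Set a

-- A monomial x₀^α₀ x₁^α₁ ⋯ is given by a list α of exponents, those beyond
-- its end being zero; a power series is given by its coefficients.

Exponent : Set
Exponent = List ℕ

PowerSeries : Set
PowerSeries = Exponent → ℕ

infix 4 _≈_

_≈_ : PowerSeries → PowerSeries → Set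
f ≈ g = ∀ α → f α ≡ g α

∑ : List A → (A → PowerSeries) → PowerSeries
∑ xs f α = sum (map (λ x → f x α) xs)

-- Multisets are lists up to _↭_.

Multiset : Set
Multiset = List ℤ

di : List ℤ → ℕ
di []      = 0
di (x ∷ w) = length (filter (λ y → x ℤ.≟ y ℤ.+ 1ℤ) w) ℕ.+ di w

DualDyck : List ℤ → Set
DualDyck = Linked (λ x y → y ℤ.≥ x ℤ.+ + 2)

-- F₀ ∷ ⋯ ∷ Fₖ₋₁ ∷ [] stands for the sequence F₀, …, Fₖ₋₁ followed by empty
-- sequences.  Once the exponent α of its monomial is fixed, so is k = length α,
-- hence each factorization contributing to x^α is represented exactly once.

Factorization : Set
Factorization = List (List ℤ)

weight : Factorization → Exponent
weight = map length

IsDualDyckFactorization : Multiset → Factorization → Set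
IsDualDyckFactorization S F = concat F ↭ S × All DualDyck F

-- A tableau is its list of rows, from top to bottom.

Tableau : Set a → Set a
Tableau A = List (List A)

shape : Tableau A → List ℕ
shape = map length

IsPartition : List ℕ → Set
IsPartition sh = All (0 <_) sh × Linked _≥_ sh

-- zip truncates to the shorter row, so this relates exactly the pairs of
-- vertically adjacent entries.

Columns : {A : Set a} → Rel A p → Tableau A → Set (a ⊔ p)
Columns R = Linked (λ upper lower → All (uncurry R) (zip upper lower))

IsDyckTableau : Tableau ℤ → Set
IsDyckTableau T =
  IsPartition (shape T) × All DualDyck T × Columns (λ x y → x ℤ.≤ y ℤ.+ 1ℤ) T

RR : Tableau ℤ → List ℤ
RR T = concat (reverse T)

IsSemistandard : Tableau ℕ → Set
IsSemistandard T = IsPartition (shape T) × All (Linked _≤_) T × Columns _<_ T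

HasContent : Exponent → Tableau ℕ → Set
HasContent α T =
  All (_< length α) (concat T) ×
  map (λ i → length (filter (i ℕ.≟_) (concat T))) (upTo (length α)) ≡ α

FactorizationOf : Multiset → ℕ → Exponent → Pred Factorization _
FactorizationOf S d α F =
  IsDualDyckFactorization S F × di (concat F) ≡ d × weight F ≡ α

DyckTableauOf : Multiset → ℕ → Pred (Tableau ℤ) _
DyckTableauOf S d P = IsDyckTableau P × concat P ↭ S × di (RR P) ≡ d

SemistandardOf : List ℕ → Exponent → Pred (Tableau ℕ) _
SemistandardOf sh α T = IsSemistandard T × shape T ≡ sh × HasContent α T

_↭?_ : B.Decidable (_↭_ {A = ℤ})
[]      ↭? []      = yes ↭-refl
[]      ↭? (y ∷ v) = no λ σ → ℕ.0≢1+n (↭-length σ)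
(x ∷ u) ↭? v with DecMembership._∈?_ ℤ._≟_ x v
... | no x∉v = no λ σ → x∉v (∈-resp-↭ σ (here refl))
... | yes x∈v with ∈-∃++ x∈v
...   | v₁ , v₂ , refl =
  map′ (λ σ → ↭-trans (_↭_.prep x σ) (↭-sym (shift x v₁ v₂)))
       (λ σ → drop-∷ (↭-trans σ (shift x v₁ v₂)))
       (u ↭? (v₁ ++ v₂))

dualDyck? : Decidable DualDyck
dualDyck? = Linked.linked? (λ x y → x ℤ.+ + 2 ℤ.≤? y)

isPartition? : Decidable IsPartition
isPartition? sh = All.all? (0 ℕ.<?_) sh ×-dec Linked.linked? ℕ._≥?_ sh

columns? : {R : Rel A p} → B.Decidable R → Decidable (Columns R)
columns? R? = Linked.linked? (λ u l → All.all? (uncurry R?) (zip u l))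

factorizationOf? : ∀ S d α → Decidable (FactorizationOf S d α)
factorizationOf? S d α F =
  ((concat F ↭? S) ×-dec All.all? dualDyck? F)
  ×-dec (di (concat F) ℕ.≟ d) ×-dec ≡-dec ℕ._≟_ (weight F) α

dyckTableauOf? : ∀ S d → Decidable (DyckTableauOf S d)
dyckTableauOf? S d P =
  (isPartition? (shape P) ×-dec All.all? dualDyck? P
    ×-dec columns? (λ x y → x ℤ.≤? y ℤ.+ 1ℤ) P)
  ×-dec (concat P ↭? S) ×-dec (di (RR P) ℕ.≟ d)

semistandardOf? : ∀ sh α → Decidable (SemistandardOf sh α)
semistandardOf? sh α T =
  (isPartition? (shape T) ×-dec All.all? (Linked.linked? ℕ._≤?_) T
    ×-dec columns? ℕ._<?_ T)
  ×-dec ≡-dec ℕ._≟_ (shape T) sh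
  ×-dec All.all? (ℕ._<? length α) (concat T)
  ×-dec ≡-dec ℕ._≟_ _ α

-- The finite sets to be counted or summed over are given as duplicate-free lists
-- (select-!), selected from larger lists of candidates.  That a list has exactly
-- the intended elements is ∈-factorizations, ∈-dyckTableaux, ∈-semistandard.

words : List A → ℕ → List (List A)
words letters zero    = [ [] ]
words letters (suc n) = cartesianProductWith _∷_ letters (words letters n)

fillings : List A → List ℕ → List (Tableau A)
fillings letters []       = [ [] ]
fillings letters (n ∷ sh) =
  cartesianProductWith _∷_ (words letters n) (fillings letters sh)

extend : List ℕ → List (List ℕ)
extend []       = [ 1 ∷ [] ]
extend (k ∷ ks) = (1 ∷ k ∷ ks) ∷ (suc k ∷ ks) ∷ []

compositions : ℕ → List (List ℕ)
compositions zero    = [ [] ]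
compositions (suc n) = concatMap extend (compositions n)

select : {P : Pred (Tableau A) p} → DecidableEquality A → Decidable P →
         List (Tableau A) → List (Tableau A)
select _≟_ P? Ts = deduplicate (≡-dec (≡-dec _≟_)) (filter P? Ts)

factorizations : Multiset → ℕ → Exponent → List Factorization
factorizations S d α = select ℤ._≟_ (factorizationOf? S d α) (fillings S α)

dyckTableaux : Multiset → ℕ → List (Tableau ℤ)
dyckTableaux S d =
  select ℤ._≟_ (dyckTableauOf? S d) (concatMap (fillings S) (compositions (length S)))

semistandard : List ℕ → Exponent → List (Tableau ℕ)
semistandard sh α =
  select ℕ._≟_ (semistandardOf? sh α) (fillings (upTo (length α)) sh)

DS* : Multiset → ℕ → PowerSeries
DS* S d α = length (factorizations S d α)

schur : List ℕ → PowerSeries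
schur sh α = length (semistandard sh α)

module _ {P : Pred (Tableau A) p} (_≟_ : DecidableEquality A) (P? : Decidable P) where

  select-! : ∀ Ts → Unique (select _≟_ P? Ts)
  select-! Ts = Unique.deduplicate-! (≡-dec (≡-dec _≟_)) (filter P? Ts)

  ∈-select : ∀ Ts → (∀ {T} → P T → T ∈ Ts) → ∀ T → T ∈ select _≟_ P? Ts ⇔ P T
  ∈-select Ts complete T = mk⇔
    (λ T∈ → proj₂ (∈-filter⁻ P? {xs = Ts} (∈-deduplicate⁻ (≡-dec (≡-dec _≟_)) (filter P? Ts) T∈)))
    (λ PT → ∈-deduplicate⁺ (≡-dec (≡-dec _≟_)) (∈-filter⁺ P? (complete PT) PT))

∈-words : {letters : List A} → ∀ {w} → All (_∈ letters) w → w ∈ words letters (length w)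
∈-words []         = here refl
∈-words (x∈ ∷ w∈) = ∈-cartesianProductWith⁺ _∷_ x∈ (∈-words w∈)

∈-fillings : {letters : List A} → ∀ T → All (_∈ letters) (concat T) →
             T ∈ fillings letters (shape T)
∈-fillings []      _  = here refl
∈-fillings (w ∷ T) T∈ =
  ∈-cartesianProductWith⁺ _∷_ (∈-words (All.++⁻ˡ w T∈)) (∈-fillings T (All.++⁻ʳ w T∈))

∈-compositions : ∀ n sh → All (0 <_) sh → sum sh ≡ n → sh ∈ compositions n
∈-compositions zero    []           []        refl = here refl
∈-compositions zero    (suc k ∷ sh) (_ ∷ _)   ()
∈-compositions (suc n) []           _         ()
∈-compositions (suc n) (1 ∷ [])     (_ ∷ pos) refl =
  ∈-concatMap⁺ extend (lose (∈-compositions n [] [] refl) (here refl))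
∈-compositions (suc n) (1 ∷ k ∷ sh) (_ ∷ pos) eq =
  ∈-concatMap⁺ extend (lose (∈-compositions n (k ∷ sh) pos (ℕ.suc-injective eq)) (here refl))
∈-compositions (suc n) (suc (suc k) ∷ sh) (_ ∷ pos) eq =
  ∈-concatMap⁺ extend (lose (∈-compositions n (suc k ∷ sh) (s≤s z≤n ∷ pos) (ℕ.suc-injective eq))
                            (there (here refl)))

sum-shape : (T : Tableau A) → sum (shape T) ≡ length (concat T)
sum-shape []      = refl
sum-shape (w ∷ T) = trans (cong (length w ℕ.+_) (sum-shape T)) (sym (length-++ w))

↭⇒All∈ : {u v : List A} → u ↭ v → All (_∈ v) u
↭⇒All∈ σ = All.tabulate (∈-resp-↭ σ)

∈-factorizations : ∀ S d α F → F ∈ factorizations S d α ⇔ FactorizationOf S d α F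
∈-factorizations S d α = ∈-select ℤ._≟_ (factorizationOf? S d α) (fillings S α)
  λ { {F} ((σ , _) , _ , refl) → ∈-fillings F (↭⇒All∈ σ) }

∈-dyckTableaux : ∀ S d P → P ∈ dyckTableaux S d ⇔ DyckTableauOf S d P
∈-dyckTableaux S d = ∈-select ℤ._≟_ (dyckTableauOf? S d) _
  λ { {P} (((pos , _) , _) , σ , _) →
      ∈-concatMap⁺ (fillings S) (lose
        (∈-compositions (length S) (shape P) pos (trans (sum-shape P) (↭-length σ)))
        (∈-fillings P (↭⇒All∈ σ))) }

∈-semistandard : ∀ sh α T → T ∈ semistandard sh α ⇔ SemistandardOf sh α T
∈-semistandard sh α = ∈-select ℕ._≟_ (semistandardOf? sh α) (fillings (upTo (length α)) sh)
  λ { {T} (_ , refl , (bounded , _)) → ∈-fillings T (All.map ∈-upTo⁺ bounded) }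

{-# OPTIONS --safe #-}

module Submission where

-- This is Gasharov's proof, with the refinement of Shareshian and Wachs that keeps track
-- of inversions.  Let f(α) be the number of factorizations of S with d dual inversions and
-- row lengths α.  Between two adjacent rows, exchange the runs of consecutive integers of
-- odd length: this swaps the lengths of the rows and preserves di, so f is symmetric.
-- Applied only to the entries behind the first violation of the tableau conditions, the
-- same operation is a sign-reversing involution on the terms of the Jacobi-Trudi
-- determinant of λ, a signed sum of values of f; hence that determinant is the number of
-- Dyck tableaux of shape λ.  Finally, f symmetric implies Pieri's rule for these
-- determinants, so f(α) is the sum of the determinants of all λ, each as often as there
-- are chains of horizontal strips of sizes α₀, α₁, … from the empty partition to λ, i.e.
-- semistandard tableaux of shape λ and content α.

open import Defs
open import Data.Bool.Base using (Bool; true; false; if_then_else_)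
open import Data.Empty using (⊥; ⊥-elim)
open import Data.Integer.Base as ℤ using (ℤ; +_; -[1+_]; 0ℤ; 1ℤ; _⊖_)
import Data.Integer.Properties as ℤ
open import Data.Integer.Tactic.RingSolver using (solve-∀)
open import Data.List.Base
  using (List; []; _∷_; _++_; [_]; _∷ʳ_; map; length; filter; take; drop; concat; concatMap;
         reverse; replicate; zip; zipWith; upTo)
open import Data.List.Membership.Propositional using (_∈_; lose)
import Data.List.Membership.Propositional.Properties as ∈
import Data.List.Properties as List
open import Data.List.Relation.Binary.Permutation.Propositional
  using (_↭_; ↭-refl; ↭-sym; ↭-trans; ↭-reflexive; prep; swap)
import Data.List.Relation.Binary.Permutation.Propositional.Properties as ↭
open import Data.List.Relation.Unary.All as All using (All; []; _∷_)
import Data.List.Relation.Unary.All.Properties as All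
open import Data.List.Relation.Unary.AllPairs as AllPairs using ([]; _∷_)
open import Data.List.Relation.Unary.Any using (Any; here; there)
open import Data.List.Relation.Unary.Linked as Linked using (Linked; []; [-]; _∷_)
import Data.List.Relation.Unary.Linked.Properties as Linked
open import Data.List.Relation.Unary.Unique.Propositional using (Unique)
import Data.List.Relation.Unary.Unique.Propositional.Properties as Unique
open import Data.Nat using (ℕ)
open import Data.Nat.Base as ℕ using (zero; suc; _+_; _∸_; _≤_; _<_; _≥_; z≤n; s≤s)
open import Data.Nat.ListAction using (sum)
import Data.Nat.Properties as ℕ
import Data.Nat.Tactic.RingSolver as ℕ-Solver
open import Data.Product.Base using (∃; _×_; _,_; proj₁; proj₂; uncurry)
open import Data.Sum.Base using (_⊎_; inj₁; inj₂)
open import Data.Unit.Base using (⊤; tt)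
open import Function.Base using (_∘_; id)
open import Function.Bundles using (Equivalence)
open import Level using (0ℓ)
open import Relation.Binary.PropositionalEquality
  using (_≡_; _≢_; refl; sym; trans; cong; cong₂; subst; subst₂; module ≡-Reasoning)
open import Relation.Nullary.Decidable using (Dec; does; yes; no; _×-dec_; ¬?)
open import Relation.Nullary.Negation using (¬_)
open import Relation.Unary using (Pred; Decidable)

-- The value f(α) is the coefficient of x^α in a power series, that is, its pairing with the product
-- of complete homogeneous functions h_α. Symmetry of f makes h_α ↦ f(α) a well-defined linear
-- functional on symmetric functions, and the determinants below are its values at Schur functions.
-- No ring of symmetric functions is built. As f need not be a product of functions of the parts, a
-- determinant passes to it whole lists of integers; lists with a negative entry get the value 0,
-- just as h_n = 0 for n < 0. A factorization lists the rows in reading order, the bottom row first.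
-- Hence partitions are written in increasing order, and empty factors become zero parts at the
-- front. The cancellation needs more than symmetry of f: transposing two neighbouring columns of
-- the determinant turns row lengths (x, y) into (y + 1, x - 1), and the operation on the entries
-- behind a flaw has to produce exactly this shift.

private
  variable
    A B : Set

-- Sign-reversing involutions on the terms of a sum are used in this form: the sum equals its own
-- negative, and no explicit pairing of terms is set up.
≡-neg⇒≡0 : ∀ {i} → i ≡ ℤ.- i → i ≡ 0ℤ
≡-neg⇒≡0 {+ zero}   _ = refl
≡-neg⇒≡0 {+ suc n}  ()
≡-neg⇒≡0 { -[1+ n ]} ()

-- Determinants

-- Laplace expansion: `θ` receives the entry taken out and the list that remains, with the sign of
-- the position.
alt : (ℕ → List ℕ → ℤ) → List ℕ → ℤ
alt θ []      = 0ℤ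
alt θ (x ∷ l) = θ x l ℤ.- alt (λ y l′ → θ y (x ∷ l′)) l

alt-cong : ∀ {θ φ} → (∀ y l → θ y l ≡ φ y l) → ∀ l → alt θ l ≡ alt φ l
alt-cong eq []      = refl
alt-cong eq (x ∷ l) = cong₂ ℤ._-_ (eq x l) (alt-cong (λ y l′ → eq y (x ∷ l′)) l)

alt-zero : ∀ {θ} → (∀ y l → θ y l ≡ 0ℤ) → ∀ l → alt θ l ≡ 0ℤ
alt-zero eq []      = refl
alt-zero eq (x ∷ l) = cong₂ ℤ._-_ (eq x l) (alt-zero (λ y l′ → eq y (x ∷ l′)) l)

[a-b]-[c-d] : ∀ a b c d → (a ℤ.- b) ℤ.- (c ℤ.- d) ≡ (a ℤ.- c) ℤ.- (b ℤ.- d)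
[a-b]-[c-d] = solve-∀

alt-sub : ∀ θ φ l → alt (λ y l′ → θ y l′ ℤ.- φ y l′) l ≡ alt θ l ℤ.- alt φ l
alt-sub θ φ []      = refl
alt-sub θ φ (x ∷ l) =
  trans (cong (λ c → (θ x l ℤ.- φ x l) ℤ.- c) (alt-sub (λ y l′ → θ y (x ∷ l′)) (λ y l′ → φ y (x ∷ l′)) l))
        ([a-b]-[c-d] (θ x l) (φ x l) _ _)

alt-comm : ∀ (Θ : ℕ → List ℕ → ℕ → List ℕ → ℤ) l m →
           alt (λ x u → alt (Θ x u) m) l ≡ alt (λ y v → alt (λ x u → Θ x u y v) l) m
alt-comm Θ []      m = sym (alt-zero (λ _ _ → refl) m)
alt-comm Θ (x ∷ l) m =
  trans (cong (λ c → alt (Θ x l) m ℤ.- c) (alt-comm (λ y l′ → Θ y (x ∷ l′)) l m))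
        (sym (alt-sub (Θ x l) _ m))

-- If the earlier of two entries is taken out first, the later one moves up by one position; so the
-- two orders of removal have opposite signs.
alt-swap : ∀ (Θ : ℕ → ℕ → List ℕ → ℤ) l →
           alt (λ x → alt (Θ x)) l ≡ ℤ.- alt (λ x → alt (λ y → Θ y x)) l
alt-swap Θ []      = refl
alt-swap Θ (a ∷ l) = begin
  alt (Θ a) l ℤ.- alt (λ x u → Θ x a u ℤ.- alt (λ y v → Θ x y (a ∷ v)) u) l
    ≡⟨ cong (λ c → alt (Θ a) l ℤ.- c) (alt-sub (λ x → Θ x a) _ l) ⟩
  alt (Θ a) l ℤ.- (alt (λ x → Θ x a) l ℤ.- alt (λ x → alt (λ y v → Θ x y (a ∷ v))) l)
    ≡⟨ cong (λ c → alt (Θ a) l ℤ.- (alt (λ x → Θ x a) l ℤ.- c))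
            (alt-swap (λ x y v → Θ x y (a ∷ v)) l) ⟩
  alt (Θ a) l ℤ.- (alt (λ x → Θ x a) l ℤ.- ℤ.- alt (λ x → alt (λ y v → Θ y x (a ∷ v))) l)
    ≡⟨ rearrange (alt (Θ a) l) (alt (λ x → Θ x a) l) (alt (λ x → alt (λ y v → Θ y x (a ∷ v))) l) ⟩
  ℤ.- (alt (λ x → Θ x a) l ℤ.- (alt (Θ a) l ℤ.- alt (λ x → alt (λ y v → Θ y x (a ∷ v))) l))
    ≡⟨ cong (λ c → ℤ.- (alt (λ x → Θ x a) l ℤ.- c)) (alt-sub (Θ a) _ l) ⟨
  ℤ.- (alt (λ x → Θ x a) l ℤ.- alt (λ x u → Θ a x u ℤ.- alt (λ y v → Θ y x (a ∷ v)) u) l)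
    ∎
  where
  open ≡-Reasoning
  rearrange : ∀ a b c → a ℤ.- (b ℤ.- ℤ.- c) ≡ ℤ.- (b ℤ.- (a ℤ.- c))
  rearrange = solve-∀

alt-map : ∀ (g : ℕ → ℕ) θ l → alt θ (map g l) ≡ alt (λ y l′ → θ (g y) (map g l′)) l
alt-map g θ []      = refl
alt-map g θ (x ∷ l) = cong (λ c → θ (g x) (map g l) ℤ.- c) (alt-map g (λ y l′ → θ y (g x ∷ l′)) l)

Antisymmetric : (List ℕ → ℤ) → Set
Antisymmetric h = ∀ pre x y post → h (pre ++ x ∷ y ∷ post) ≡ ℤ.- h (pre ++ y ∷ x ∷ post)

alt-antisymmetric : ∀ {θ} → (∀ z → Antisymmetric (θ z)) → Antisymmetric (alt θ)
alt-antisymmetric {θ} anti [] x y post =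
  trans (cong (λ c → θ x (y ∷ post) ℤ.- (θ y (x ∷ post) ℤ.- c)) last)
        (rearrange (θ x (y ∷ post)) (θ y (x ∷ post)) (alt (λ z l′ → θ z (y ∷ x ∷ l′)) post))
  where
  rearrange : ∀ a b c → a ℤ.- (b ℤ.- ℤ.- c) ≡ ℤ.- (b ℤ.- (a ℤ.- c))
  rearrange = solve-∀
  neg : ∀ θ l → alt (λ z l′ → ℤ.- θ z l′) l ≡ ℤ.- alt θ l
  neg θ []      = refl
  neg θ (x ∷ l) = trans (cong (λ c → (ℤ.- θ x l) ℤ.- c) (neg (λ y l′ → θ y (x ∷ l′)) l))
                        (sym (ℤ.neg-distrib-+ (θ x l) _))
  last : alt (λ z l′ → θ z (x ∷ y ∷ l′)) post ≡ ℤ.- alt (λ z l′ → θ z (y ∷ x ∷ l′)) post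
  last = trans (alt-cong (λ z l′ → anti z [] x y l′) post) (neg _ post)
alt-antisymmetric {θ} anti (a ∷ pre) x y post =
  trans (cong₂ ℤ._-_ (anti a pre x y post)
          (alt-antisymmetric (λ z pre → anti z (a ∷ pre)) pre x y post))
        (sym (ℤ.neg-distrib-+ (θ a (pre ++ y ∷ x ∷ post)) _))

Symmetric : (List ℤ → ℤ) → Set
Symmetric f = ∀ pre x y post → f (pre ++ x ∷ y ∷ post) ≡ f (pre ++ y ∷ x ∷ post)

-- For f (z₀ ∷ z₁ ∷ ⋯) = h z₀ * h z₁ * ⋯ this is the determinant of the
-- matrix with entries h (lᵢ - vⱼ).
det : List ℕ → (List ℤ → ℤ) → List ℕ → ℤ
det []      f []      = f []
det []      f (_ ∷ _) = 0ℤ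
det (w ∷ v) f l       = alt (λ y → det v (λ zs → f (y ⊖ w ∷ zs))) l

det-cong : ∀ {f g} → (∀ zs → f zs ≡ g zs) → ∀ v l → det v f l ≡ det v g l
det-cong eq []      []      = eq []
det-cong eq []      (_ ∷ _) = refl
det-cong eq (w ∷ v) l       = alt-cong (λ y l′ → det-cong (λ zs → eq (y ⊖ w ∷ zs)) v l′) l

det-zero : ∀ {f} → (∀ zs → f zs ≡ 0ℤ) → ∀ v l → det v f l ≡ 0ℤ
det-zero eq []      []      = eq []
det-zero eq []      (_ ∷ _) = refl
det-zero eq (w ∷ v) l       = alt-zero (λ y l′ → det-zero (λ zs → eq (y ⊖ w ∷ zs)) v l′) l

det-sub : ∀ f g v l → det v (λ zs → f zs ℤ.- g zs) l ≡ det v f l ℤ.- det v g l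
det-sub f g []      []      = refl
det-sub f g []      (_ ∷ _) = refl
det-sub f g (w ∷ v) l       =
  trans (alt-cong (λ y l′ → det-sub (λ zs → f (y ⊖ w ∷ zs)) (λ zs → g (y ⊖ w ∷ zs)) v l′) l)
        (alt-sub _ _ l)

det-antisymmetric : ∀ v f → Antisymmetric (det v f)
det-antisymmetric []      f []      x y post = refl
det-antisymmetric []      f (_ ∷ _) x y post = refl
det-antisymmetric (w ∷ v) f = alt-antisymmetric (λ z → det-antisymmetric v _)

-- Exchanging the entries of `l` picked for the two equal columns changes the sign, while it only
-- permutes two arguments of `f`.
det-repeated : ∀ f → Symmetric f → ∀ v₁ w v₂ l → det (v₁ ++ w ∷ w ∷ v₂) f l ≡ 0ℤ
det-repeated f f-sym []       w v₂ l = ≡-neg⇒≡0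
  (trans (alt-swap (λ x y → det v₂ (λ zs → f (x ⊖ w ∷ y ⊖ w ∷ zs))) l)
         (cong ℤ.-_ (alt-cong (λ x → alt-cong (λ y → det-cong (λ zs → f-sym [] _ _ zs) v₂)) l)))
det-repeated f f-sym (u ∷ v₁) w v₂ l =
  alt-zero (λ y → det-repeated _ (λ pre → f-sym (y ⊖ u ∷ pre)) v₁ w v₂) l

-- Expansion along the other index: by definition `det` picks an entry of `l` for each entry of `v`,
-- here an entry of `v` is picked for `x`. Symmetry of `f` lets the argument made from `x` move to
-- the front.
det-column : ∀ f → Symmetric f → ∀ v x l →
             det v f (x ∷ l) ≡ alt (λ w v′ → det v′ (λ zs → f (x ⊖ w ∷ zs)) l) v
det-column f f-sym []      x l = refl
det-column f f-sym (w ∷ v) x l = cong (λ c → det v (λ zs → f (x ⊖ w ∷ zs)) l ℤ.- c) (begin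
  alt (λ y l′ → det v (λ zs → f (y ⊖ w ∷ zs)) (x ∷ l′)) l
    ≡⟨ alt-cong (λ y l′ → det-column (λ zs → f (y ⊖ w ∷ zs)) (λ pre → f-sym (y ⊖ w ∷ pre)) v x l′) l ⟩
  alt (λ y l′ → alt (λ w′ v′ → det v′ (λ zs → f (y ⊖ w ∷ x ⊖ w′ ∷ zs)) l′) v) l
    ≡⟨ alt-comm _ l v ⟩
  alt (λ w′ v′ → alt (λ y → det v′ (λ zs → f (y ⊖ w ∷ x ⊖ w′ ∷ zs))) l) v
    ≡⟨ alt-cong (λ w′ v′ → alt-cong (λ y → det-cong (λ zs → f-sym [] _ _ zs) v′) l) v ⟩
  alt (λ w′ v′ → alt (λ y → det v′ (λ zs → f (x ⊖ w′ ∷ y ⊖ w ∷ zs))) l) v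
    ∎)
  where open ≡-Reasoning

-- raise Φ 0 l is the sum of (-1)^|J| Φ |J| (l + 1_J) over all sets J of positions in l.
raise : (ℕ → List ℕ → ℤ) → ℕ → List ℕ → ℤ
raise Φ n []      = Φ n []
raise Φ n (y ∷ l) =
  raise (λ n l → Φ n (y ∷ l)) n l ℤ.- raise (λ n l → Φ n (suc y ∷ l)) (suc n) l

raise-zero : ∀ {Φ} m → (∀ n l → m ≤ n → Φ n l ≡ 0ℤ) → ∀ n l → m ≤ n → raise Φ n l ≡ 0ℤ
raise-zero m eq n []      m≤n = eq n [] m≤n
raise-zero m eq n (y ∷ l) m≤n =
  cong₂ ℤ._-_ (raise-zero m (λ n l → eq n (y ∷ l)) n l m≤n)
              (raise-zero m (λ n l → eq n (suc y ∷ l)) (suc n) l (ℕ.m≤n⇒m≤1+n m≤n))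

raise-sub : ∀ Φ Ψ n l → raise (λ n l → Φ n l ℤ.- Ψ n l) n l ≡ raise Φ n l ℤ.- raise Ψ n l
raise-sub Φ Ψ n []      = refl
raise-sub Φ Ψ n (y ∷ l) =
  trans (cong₂ ℤ._-_ (raise-sub (λ n l → Φ n (y ∷ l)) (λ n l → Ψ n (y ∷ l)) n l)
                     (raise-sub (λ n l → Φ n (suc y ∷ l)) (λ n l → Ψ n (suc y ∷ l)) (suc n) l))
        ([a-b]-[c-d] (raise (λ n l → Φ n (y ∷ l)) n l) (raise (λ n l → Ψ n (y ∷ l)) n l)
                     (raise (λ n l → Φ n (suc y ∷ l)) (suc n) l)
                     (raise (λ n l → Ψ n (suc y ∷ l)) (suc n) l))

-- The set J either misses the position of the entry taken out or contains it; this gives the two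
-- terms.
raise-alt : ∀ (Θ : ℕ → ℕ → List ℕ → ℤ) n l →
  raise (λ r → alt (Θ r)) n l ≡
  alt (λ y l′ → raise (λ r → Θ r y) n l′ ℤ.- raise (λ r → Θ r (suc y)) (suc n) l′) l
raise-alt Θ n []      = refl
raise-alt Θ n (x ∷ l) = begin
  raise (λ r l′ → Θ r x l′ ℤ.- alt (λ y l″ → Θ r y (x ∷ l″)) l′) n l ℤ.-
  raise (λ r l′ → Θ r (suc x) l′ ℤ.- alt (λ y l″ → Θ r y (suc x ∷ l″)) l′) (suc n) l
    ≡⟨ cong₂ ℤ._-_ (raise-sub (λ r → Θ r x) _ n l) (raise-sub (λ r → Θ r (suc x)) _ (suc n) l) ⟩
  (a ℤ.- raise (λ r → alt (λ y l″ → Θ r y (x ∷ l″))) n l) ℤ.-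
  (b ℤ.- raise (λ r → alt (λ y l″ → Θ r y (suc x ∷ l″))) (suc n) l)
    ≡⟨ cong₂ (λ c d → (a ℤ.- c) ℤ.- (b ℤ.- d))
         (raise-alt (λ r y l″ → Θ r y (x ∷ l″)) n l)
         (raise-alt (λ r y l″ → Θ r y (suc x ∷ l″)) (suc n) l) ⟩
  (a ℤ.- alt C l) ℤ.- (b ℤ.- alt D l)
    ≡⟨ [a-b]-[c-d] a (alt C l) b (alt D l) ⟩
  (a ℤ.- b) ℤ.- (alt C l ℤ.- alt D l)
    ≡⟨ cong (λ c → (a ℤ.- b) ℤ.- c) (alt-sub C D l) ⟨
  (a ℤ.- b) ℤ.- alt (λ y l′ → C y l′ ℤ.- D y l′) l
    ≡⟨ cong (λ c → (a ℤ.- b) ℤ.- c) (alt-cong (λ y l′ → [a-b]-[c-d]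
         (raise (λ r l″ → Θ r y (x ∷ l″)) n l′) _ _ _) l) ⟩
  (a ℤ.- b) ℤ.- alt (λ y l′ → raise (λ r → Θ r y) n (x ∷ l′) ℤ.-
                               raise (λ r → Θ r (suc y)) (suc n) (x ∷ l′)) l
    ∎
  where
  open ≡-Reasoning
  a = raise (λ r → Θ r x) n l
  b = raise (λ r → Θ r (suc x)) (suc n) l
  C D : ℕ → List ℕ → ℤ
  C y l′ = raise (λ r l″ → Θ r y (x ∷ l″)) n l′ ℤ.-
           raise (λ r l″ → Θ r (suc y) (x ∷ l″)) (suc n) l′
  D y l′ = raise (λ r l″ → Θ r y (suc x ∷ l″)) (suc n) l′ ℤ.-
           raise (λ r l″ → Θ r (suc y) (suc x ∷ l″)) (suc (suc n)) l′

-- The same for v + 1 - 1_J.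
sink : (ℕ → List ℕ → ℤ) → ℕ → List ℕ → ℤ
sink Ψ n []      = Ψ n []
sink Ψ n (w ∷ v) =
  sink (λ n v → Ψ n (suc w ∷ v)) n v ℤ.- sink (λ n v → Ψ n (w ∷ v)) (suc n) v

sink-cong : ∀ {Φ Ψ} → (∀ n l → Φ n l ≡ Ψ n l) → ∀ n l → sink Φ n l ≡ sink Ψ n l
sink-cong eq n []      = eq n []
sink-cong eq n (y ∷ l) = cong₂ ℤ._-_ (sink-cong (λ n l → eq n (suc y ∷ l)) n l)
                                     (sink-cong (λ n l → eq n (y ∷ l)) (suc n) l)

sink-zero : ∀ {Ψ} → (∀ n v → Ψ n v ≡ 0ℤ) → ∀ n v → sink Ψ n v ≡ 0ℤ
sink-zero eq n []      = eq n []
sink-zero eq n (w ∷ v) = cong₂ ℤ._-_ (sink-zero (λ n v → eq n (suc w ∷ v)) n v)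
                                     (sink-zero (λ n v → eq n (w ∷ v)) (suc n) v)

sink-alt : ∀ (Θ : ℕ → List ℕ → ℕ → List ℕ → ℤ) n v l →
           sink (λ r v′ → alt (Θ r v′) l) n v ≡
           alt (λ y l′ → sink (λ r v′ → Θ r v′ y l′) n v) l
sink-alt Θ n []      l = refl
sink-alt Θ n (w ∷ v) l =
  trans (cong₂ ℤ._-_ (sink-alt (λ r v′ → Θ r (suc w ∷ v′)) n v l)
                     (sink-alt (λ r v′ → Θ r (w ∷ v′)) (suc n) v l))
        (sym (alt-sub _ _ l))

-- Adding 1_J to l has the same effect on the differences lᵢ - vⱼ, summed over all
-- permutations, as adding 1 to all lᵢ and to those vⱼ with j outside a set of
-- size |J|: this is the multiplication of an alternant by elementary symmetric
-- polynomials.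
raise-det : ∀ v (F : ℕ → List ℤ → ℤ) n l →
            raise (λ r → det v (F r)) n l ≡ sink (λ r v′ → det v′ (F r) (map suc l)) n v
raise-det []      F n []      = refl
raise-det []      F n (y ∷ l) = cong₂ ℤ._-_ (raise-zero 0 (λ _ _ _ → refl) n l z≤n)
                                            (raise-zero 0 (λ _ _ _ → refl) (suc n) l z≤n)
raise-det (w ∷ v) F n l       = begin
  raise (λ r → alt (λ y → det v (λ zs → F r (y ⊖ w ∷ zs)))) n l
    ≡⟨ raise-alt (λ r y → det v (λ zs → F r (y ⊖ w ∷ zs))) n l ⟩
  alt (λ y l′ → raise (λ r → det v (λ zs → F r (y ⊖ w ∷ zs))) n l′ ℤ.-
                raise (λ r → det v (λ zs → F r (suc y ⊖ w ∷ zs))) (suc n) l′) l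
    ≡⟨ alt-cong (λ y l′ → cong₂ ℤ._-_ (raise-det v (λ r zs → F r (y ⊖ w ∷ zs)) n l′)
                                      (raise-det v (λ r zs → F r (suc y ⊖ w ∷ zs)) (suc n) l′)) l ⟩
  alt (λ y l′ → sink (λ r v′ → det v′ (λ zs → F r (y ⊖ w ∷ zs)) (map suc l′)) n v ℤ.-
                sink (λ r v′ → det v′ (λ zs → F r (suc y ⊖ w ∷ zs)) (map suc l′)) (suc n) v) l
    ≡⟨ alt-cong (λ y l′ → cong (ℤ._- sink (λ r v′ → det v′ (λ zs → F r (suc y ⊖ w ∷ zs)) (map suc l′)) (suc n) v)
         (sink-cong (λ r v′ → det-cong (λ zs → cong (λ z → F r (z ∷ zs))
           (sym (ℤ.[1+m]⊖[1+n]≡m⊖n y w))) v′ (map suc l′)) n v)) l ⟩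
  alt (λ y l′ → sink (λ r v′ → det v′ (λ zs → F r (suc y ⊖ suc w ∷ zs)) (map suc l′)) n v ℤ.-
                sink (λ r v′ → det v′ (λ zs → F r (suc y ⊖ w ∷ zs)) (map suc l′)) (suc n) v) l
    ≡⟨ alt-sub _ _ l ⟩
  alt (λ y l′ → sink (λ r v′ → det v′ (λ zs → F r (suc y ⊖ suc w ∷ zs)) (map suc l′)) n v) l ℤ.-
  alt (λ y l′ → sink (λ r v′ → det v′ (λ zs → F r (suc y ⊖ w ∷ zs)) (map suc l′)) (suc n) v) l
    ≡⟨ cong₂ ℤ._-_ (sink-alt _ n v l) (sink-alt _ (suc n) v l) ⟨
  sink (λ r v′ → alt (λ y l′ → det v′ (λ zs → F r (suc y ⊖ suc w ∷ zs)) (map suc l′)) l) n v ℤ.-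
  sink (λ r v′ → alt (λ y l′ → det v′ (λ zs → F r (suc y ⊖ w ∷ zs)) (map suc l′)) l) (suc n) v
    ≡⟨ cong₂ ℤ._-_ (sink-cong (λ r v′ → alt-map suc _ l) n v)
                   (sink-cong (λ r v′ → alt-map suc _ l) (suc n) v) ⟨
  sink (λ r v′ → det v′ (F r) (map suc l)) n (w ∷ v)
    ∎
  where open ≡-Reasoning

-- Determinants over a staircase

ramp : ℕ → ℕ → List ℕ
ramp j zero    = []
ramp j (suc m) = j ∷ ramp (suc j) m

VanishesOnRepeats : (ℕ → List ℕ → ℤ) → Set
VanishesOnRepeats Ψ = ∀ n v₁ w v₂ → Ψ n (v₁ ++ w ∷ w ∷ v₂) ≡ 0ℤ

-- Behind an entry `i` only the empty J survives: the head of `ramp i m` has to become `suc i`,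
-- since otherwise `i` is repeated, and then the same holds for the entry after it.
sink-ramp-∷ : ∀ Ψ → VanishesOnRepeats Ψ → ∀ i n m →
              sink (λ n v → Ψ n (i ∷ v)) n (ramp i m) ≡ Ψ n (i ∷ ramp (suc i) m)
sink-ramp-∷ Ψ vanish i n zero    = refl
sink-ramp-∷ Ψ vanish i n (suc m) =
  trans (cong₂ ℤ._-_ (sink-ramp-∷ (λ n v → Ψ n (i ∷ v)) (λ n v₁ → vanish n (i ∷ v₁)) (suc i) n m)
                     (sink-zero (λ n v → vanish n [] i v) (suc n) (ramp (suc i) m)))
        (ℤ.+-identityʳ _)

-- If some position is outside J and the next one inside, two neighbours coincide. So J is an
-- initial segment, and what results is the longer staircase without the single value j + |J|. The
-- counter starts at `j` in order to equal this missing value.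
sink-ramp : ∀ Ψ → VanishesOnRepeats Ψ → ∀ j m → sink Ψ j (ramp j m) ≡ alt Ψ (ramp j (suc m))
sink-ramp Ψ vanish j zero    = sym (ℤ.+-identityʳ _)
sink-ramp Ψ vanish j (suc m) =
  cong₂ ℤ._-_ (sink-ramp-∷ Ψ vanish (suc j) j m)
              (sink-ramp (λ n v → Ψ n (j ∷ v)) (λ n v₁ → vanish n (j ∷ v₁)) (suc j) m)

-- Expansion along `x` leaves the staircase without one value `r`. By `sink-ramp` these are the
-- surviving terms of a `sink`, which `raise-det` turns back into a complete staircase with `r`
-- entries of `l` raised.
det-ramp : ∀ f → Symmetric f → ∀ m x l →
           det (ramp 0 (suc m)) f (x ∷ map suc l) ≡
           raise (λ r → det (ramp 0 m) (λ zs → f (x ⊖ r ∷ zs))) 0 l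
det-ramp f f-sym m x l = begin
  det (ramp 0 (suc m)) f (x ∷ map suc l)
    ≡⟨ det-column f f-sym (ramp 0 (suc m)) x (map suc l) ⟩
  alt (λ w v → det v (λ zs → f (x ⊖ w ∷ zs)) (map suc l)) (ramp 0 (suc m))
    ≡⟨ sink-ramp (λ w v → det v (λ zs → f (x ⊖ w ∷ zs)) (map suc l))
         (λ n v₁ w v₂ → det-repeated _ (λ pre → f-sym (x ⊖ n ∷ pre)) v₁ w v₂ (map suc l)) 0 m ⟨
  sink (λ w v → det v (λ zs → f (x ⊖ w ∷ zs)) (map suc l)) 0 (ramp 0 m)
    ≡⟨ raise-det (ramp 0 m) (λ r zs → f (x ⊖ r ∷ zs)) 0 l ⟨
  raise (λ r → det (ramp 0 m) (λ zs → f (x ⊖ r ∷ zs))) 0 l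
    ∎
  where open ≡-Reasoning

-- Pieri's rule

split : ℕ → (ℕ → ℕ → ℤ) → ℤ
split zero    g = g 0 0
split (suc t) g = g 0 (suc t) ℤ.+ split t (λ p q → g (suc p) q)

split-cong : ∀ {g h} → (∀ p q → g p q ≡ h p q) → ∀ t → split t g ≡ split t h
split-cong eq zero    = eq 0 0
split-cong eq (suc t) = cong₂ ℤ._+_ (eq 0 (suc t)) (split-cong (λ p q → eq (suc p) q) t)

+-sub-comm : ∀ a b c d → (a ℤ.- b) ℤ.+ (c ℤ.- d) ≡ (a ℤ.+ c) ℤ.- (b ℤ.+ d)
+-sub-comm = solve-∀

split-sub : ∀ g h t → split t (λ p q → g p q ℤ.- h p q) ≡ split t g ℤ.- split t h
split-sub g h zero    = refl
split-sub g h (suc t) =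
  trans (cong (ℤ._+_ (g 0 (suc t) ℤ.- h 0 (suc t))) (split-sub _ _ t))
        (+-sub-comm (g 0 (suc t)) (h 0 (suc t)) _ _)

split-neg : ∀ g t → split t (λ p q → ℤ.- g p q) ≡ ℤ.- split t g
split-neg g zero    = refl
split-neg g (suc t) = trans (cong (ℤ._+_ (ℤ.- g 0 (suc t))) (split-neg _ t))
                            (sym (ℤ.neg-distrib-+ (g 0 (suc t)) _))

before : (ℕ → ℤ) → ℕ → ℤ
before g zero    = 0ℤ
before g (suc n) = g n

split-telescope : ∀ (u : ℕ → ℕ → ℤ) b → split b (λ p q → u p q ℤ.- before (u (suc p)) q) ≡ u 0 b
split-telescope u zero    = ℤ.+-identityʳ _
split-telescope u (suc b) =
  trans (cong (ℤ._+_ (u 0 (suc b) ℤ.- u 1 b)) (split-telescope (u ∘ suc) b))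
        (cancel (u 0 (suc b)) (u 1 b))
  where
  cancel : ∀ a b → (a ℤ.- b) ℤ.+ b ≡ a
  cancel = solve-∀

split-head : ∀ φ t → split t φ ≡ φ 0 t ℤ.+ before (λ s → split s (λ p q → φ (suc p) q)) t
split-head φ zero    = sym (ℤ.+-identityʳ _)
split-head φ (suc t) = refl

+-interchange : ∀ a b c d → (a ℤ.+ b) ℤ.+ (c ℤ.+ d) ≡ (a ℤ.+ c) ℤ.+ (b ℤ.+ d)
+-interchange = solve-∀

split-+ : ∀ g h t → split t (λ p q → g p q ℤ.+ h p q) ≡ split t g ℤ.+ split t h
split-+ g h zero    = refl
split-+ g h (suc t) =
  trans (cong (ℤ._+_ (g 0 (suc t) ℤ.+ h 0 (suc t))) (split-+ _ _ t))
        (+-interchange (g 0 (suc t)) (h 0 (suc t)) _ _)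

split-before : ∀ (g : ℕ → ℕ → ℤ) t → split t (λ p → before (g p)) ≡ before (λ s → split s g) t
split-before g zero          = refl
split-before g (suc zero)    = ℤ.+-identityʳ _
split-before g (suc (suc t)) = cong (ℤ._+_ (g 0 (suc t))) (split-before (g ∘ suc) (suc t))

split-before-left : ∀ (g : ℕ → ℕ → ℤ) t →
  split t (λ c r → before (λ c → g c r) c) ≡ before (λ s → split s g) t
split-before-left g zero    = refl
split-before-left g (suc t) = ℤ.+-identityˡ _

split-assoc : ∀ (u : ℕ → ℕ → ℕ → ℤ) b →
  split b (λ c q → split q (λ p r → u c p r)) ≡ split b (λ p s → split s (λ c r → u c p r))
split-assoc u zero    = refl
split-assoc u (suc b) = sym (begin
  split (suc b) (λ p s → split s (λ c r → u c p r))
    ≡⟨ split-cong (λ p s → split-head (λ c r → u c p r) s) (suc b) ⟩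
  split (suc b) (λ p s → u 0 p s ℤ.+ before (λ s → split s (λ c r → u (suc c) p r)) s)
    ≡⟨ split-+ (u 0) (λ p → before (λ s → split s (λ c r → u (suc c) p r))) (suc b) ⟩
  split (suc b) (u 0) ℤ.+ split (suc b) (λ p → before (λ s → split s (λ c r → u (suc c) p r)))
    ≡⟨ cong (ℤ._+_ (split (suc b) (u 0)))
            (trans (split-before (λ p s → split s (λ c r → u (suc c) p r)) (suc b))
                   (sym (split-assoc (u ∘ suc) b))) ⟩
  split (suc b) (u 0) ℤ.+ split b (λ c q → split q (u (suc c)))
    ∎)
  where open ≡-Reasoning

-- cone h l t is the sum of h (l + p) over all p of size t.
cone : (List ℕ → ℤ) → List ℕ → ℕ → ℤ
cone h []      zero    = h []
cone h []      (suc t) = 0ℤ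
cone h (y ∷ l) t       = split t (λ p → cone (λ l′ → h (p + y ∷ l′)) l)

cone-cong : ∀ {g h} → (∀ l → g l ≡ h l) → ∀ l t → cone g l t ≡ cone h l t
cone-cong eq []      zero    = eq []
cone-cong eq []      (suc t) = refl
cone-cong eq (y ∷ l) t       = split-cong (λ p → cone-cong (λ l′ → eq (p + y ∷ l′)) l) t

cone-zero : ∀ l t → cone (λ _ → 0ℤ) l t ≡ 0ℤ
cone-zero []      zero    = refl
cone-zero []      (suc t) = refl
cone-zero (y ∷ l) t       = trans (split-cong (λ p → cone-zero l) t) (zeros t)
  where
  zeros : ∀ t → split t (λ _ _ → 0ℤ) ≡ 0ℤ
  zeros zero    = refl
  zeros (suc t) = trans (ℤ.+-identityˡ _) (zeros t)

cone-sub : ∀ g h l t → cone (λ l → g l ℤ.- h l) l t ≡ cone g l t ℤ.- cone h l t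
cone-sub g h []      zero    = refl
cone-sub g h []      (suc t) = refl
cone-sub g h (y ∷ l) t       = trans (split-cong (λ p → cone-sub _ _ l) t) (split-sub _ _ t)

cone-neg : ∀ h l t → cone (λ l → ℤ.- h l) l t ≡ ℤ.- cone h l t
cone-neg h []      zero    = refl
cone-neg h []      (suc t) = refl
cone-neg h (y ∷ l) t       = trans (split-cong (λ p → cone-neg _ l) t) (split-neg _ t)

cone-before : ∀ (g : ℕ → List ℕ → ℤ) c l t →
  cone (λ l → before (λ c → g c l) c) l t ≡ before (λ c → cone (g c) l t) c
cone-before g zero    l t = cone-zero l t
cone-before g (suc c) l t = refl

cone-map-suc : ∀ h l t → cone h (map suc l) t ≡ cone (h ∘ map suc) l t
cone-map-suc h []      zero    = refl
cone-map-suc h []      (suc t) = refl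
cone-map-suc h (y ∷ l) t       = split-cong (λ p q →
  trans (cone-map-suc _ l q) (cone-cong (λ l′ → cong (λ x → h (x ∷ map suc l′)) (ℕ.+-suc p y)) l q)) t

-- raise, reparametrised by c = x - |J| with the terms where x < |J| left out.
lower : (ℕ → List ℕ → ℤ) → ℕ → List ℕ → ℤ
lower G c []      = G c []
lower G c (y ∷ l) =
  lower (λ c l → G c (y ∷ l)) c l ℤ.- before (λ c → lower (λ c l → G c (suc y ∷ l)) c l) c

-- Each raised entry moves one unit from `c` to `r`. Once `c` is used up, all further terms have r >
-- x and vanish; there `before` has its default value 0.
raise-lower : ∀ x Φ G → (∀ r c l → c + r ≡ x → Φ r l ≡ G c l) → (∀ r l → x < r → Φ r l ≡ 0ℤ) →
              ∀ c r l → c + r ≡ x → raise Φ r l ≡ lower G c l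
raise-lower x Φ G Φ≡G Φ≡0 c r []      eq = Φ≡G r c [] eq
raise-lower x Φ G Φ≡G Φ≡0 c r (y ∷ l) eq = cong₂ ℤ._-_
  (raise-lower x _ _ (λ r c l → Φ≡G r c (y ∷ l)) (λ r l → Φ≡0 r (y ∷ l)) c r l eq)
  (lemma c eq)
  where
  Φ′ : ℕ → List ℕ → ℤ
  Φ′ n l = Φ n (suc y ∷ l)
  lemma : ∀ c → c + r ≡ x →
    raise Φ′ (suc r) l ≡ before (λ c → lower (λ c l → G c (suc y ∷ l)) c l) c
  lemma zero    refl = raise-zero (suc x) (λ n l → Φ≡0 n (suc y ∷ l)) (suc r) l ℕ.≤-refl
  lemma (suc c) eq   =
    raise-lower x Φ′ _ (λ r c l → Φ≡G r c (suc y ∷ l)) (λ r l → Φ≡0 r (suc y ∷ l))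
                c (suc r) l (trans (ℕ.+-suc c r) eq)

cone-[] : ∀ (h : ℕ → List ℕ → ℤ) b → split b (λ c → cone (h c) []) ≡ h b []
cone-[] h zero    = refl
cone-[] h (suc b) = trans (ℤ.+-identityˡ _) (cone-[] (h ∘ suc) b)

-- With Rᵢ raising lᵢ and lowering c, this is ∑ₚ Rᵖ ∏ᵢ (1 - Rᵢ) = 1.
cone-lower : ∀ G l b → split b (λ c → cone (lower G c) l) ≡ G b l
cone-lower G []      b = cone-[] (lower G) b
cone-lower G (y ∷ l) b = begin
  split b (λ c q → split q (λ p r → cone (λ l′ → lower G c (p + y ∷ l′)) l r))
    ≡⟨ split-cong (λ c → split-cong λ p r →
         trans (cone-sub _ _ l r) (cong (ℤ._-_ (U p c r)) (cone-before _ c l r))) b ⟩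
  split b (λ c q → split q (λ p r → U p c r ℤ.- before (λ c → U (suc p) c r) c))
    ≡⟨ split-assoc _ b ⟩
  split b (λ p s → split s (λ c r → U p c r ℤ.- before (λ c → U (suc p) c r) c))
    ≡⟨ split-cong (λ p s → trans (split-sub (U p) _ s)
         (cong (ℤ._-_ (split s (U p))) (split-before-left (U (suc p)) s))) b ⟩
  split b (λ p s → split s (U p) ℤ.- before (λ s → split s (U (suc p))) s)
    ≡⟨ split-telescope (λ p s → split s (U p)) b ⟩
  split b (U 0)
    ≡⟨ cone-lower (λ c l → G c (y ∷ l)) l b ⟩
  G b (y ∷ l)
    ∎
  where
  open ≡-Reasoning
  U : ℕ → ℕ → ℕ → ℤ
  U p c r = cone (lower (λ c l → G c (p + y ∷ l)) c) l r

VanishesOnNegative : (List ℤ → ℤ) → Set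
VanishesOnNegative f = ∀ pre n post → f (pre ++ -[1+ n ] ∷ post) ≡ 0ℤ

c+r⊖r : ∀ c r → (c + r) ⊖ r ≡ + c
c+r⊖r c r = trans (ℤ.⊖-≥ (ℕ.m≤n+m r c)) (cong +_ (ℕ.m+n∸n≡m c r))

x<r⇒x⊖r : ∀ {x r} → x < r → ∃ λ k → x ⊖ r ≡ -[1+ k ]
x<r⇒x⊖r {zero}  {suc r} _         = r , refl
x<r⇒x⊖r {suc x} {suc r} (s≤s x<r) with x<r⇒x⊖r x<r
... | k , eq = k , trans (ℤ.[1+m]⊖[1+n]≡m⊖n x r) eq

-- Pieri's rule before cancellation: multiplication by h_b adds `b` to the parts in all ways,
-- whether or not a partition results. With each summand expanded by `det-ramp` this is
-- `cone-lower`. The prepended 0 is the new zero part, and `suc` moves the other parts one step up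
-- the staircase.
det-pieri : ∀ f → Symmetric f → VanishesOnNegative f → ∀ m b l →
  det (ramp 0 m) (λ zs → f (+ b ∷ zs)) l ≡ cone (det (ramp 0 (suc m)) f) (0 ∷ map suc l) b
det-pieri f f-sym f-neg m b l = sym (begin
  split b (λ c → cone (λ l′ → det (ramp 0 (suc m)) f (c + 0 ∷ l′)) (map suc l))
    ≡⟨ split-cong (λ c q → trans (cone-map-suc _ l q) (cone-cong (expand c) l q)) b ⟩
  split b (λ c → cone (lower G c) l)
    ≡⟨ cone-lower G l b ⟩
  G b l
    ∎)
  where
  open ≡-Reasoning
  G : ℕ → List ℕ → ℤ
  G c = det (ramp 0 m) (λ zs → f (+ c ∷ zs))
  expand : ∀ c l′ → det (ramp 0 (suc m)) f (c + 0 ∷ map suc l′) ≡ lower G c l′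
  expand c l′ = begin
    det (ramp 0 (suc m)) f (c + 0 ∷ map suc l′)
      ≡⟨ det-ramp f f-sym m (c + 0) l′ ⟩
    raise (λ r → det (ramp 0 m) (λ zs → f ((c + 0) ⊖ r ∷ zs))) 0 l′
      ≡⟨ raise-lower (c + 0) _ G
           (λ { r c′ l eq → det-cong (λ zs → cong (λ z → f (z ∷ zs))
                  (trans (cong (_⊖ r) (sym eq)) (c+r⊖r c′ r))) (ramp 0 m) l })
           (λ r l x<r → det-zero (λ zs → trans (cong (λ z → f (z ∷ zs)) (proj₂ (x<r⇒x⊖r x<r)))
                                              (f-neg [] _ zs)) (ramp 0 m) l)
           c 0 l′ refl ⟩
    lower G c l′
      ∎

-- Exchanging the amounts added to the two equal entries exchanges two neighbours in the argument of
-- `h`.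
cone-repeated : ∀ h → Antisymmetric h → ∀ a l t → cone h (a ∷ a ∷ l) t ≡ 0ℤ
cone-repeated h h-anti a l t = ≡-neg⇒≡0 (begin
  split t (λ p q → split q (λ p′ → cone (λ l′ → h (p + a ∷ p′ + a ∷ l′)) l))
    ≡⟨ split-assoc _ t ⟩
  split t (λ p′ s → split s (λ p → cone (λ l′ → h (p + a ∷ p′ + a ∷ l′)) l))
    ≡⟨ split-cong (λ p′ → split-cong λ p q →
         trans (cone-cong (λ l′ → h-anti [] (p + a) (p′ + a) l′) l q) (cone-neg _ l q)) t ⟩
  split t (λ p′ s → split s (λ p q → ℤ.- cone (λ l′ → h (p′ + a ∷ p + a ∷ l′)) l q))
    ≡⟨ split-cong (λ p′ → split-neg _) t ⟩
  split t (λ p′ s → ℤ.- split s (λ p → cone (λ l′ → h (p′ + a ∷ p + a ∷ l′)) l))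
    ≡⟨ split-neg _ t ⟩
  ℤ.- split t (λ p q → split q (λ p′ → cone (λ l′ → h (p + a ∷ p′ + a ∷ l′)) l))
    ∎)
  where open ≡-Reasoning

-- Cancellation outside the horizontal strips

low high : ℕ → ℕ → (ℕ → ℕ → ℤ) → ℤ
low zero    t       φ = 0ℤ
low (suc k) zero    φ = φ 0 0
low (suc k) (suc t) φ = φ 0 (suc t) ℤ.+ low k t (λ p → φ (suc p))
high zero    t       φ = split t φ
high (suc k) zero    φ = 0ℤ
high (suc k) (suc t) φ = high k t (λ p → φ (suc p))

split-low-high : ∀ k t φ → split t φ ≡ low k t φ ℤ.+ high k t φ
split-low-high zero    t       φ = sym (ℤ.+-identityˡ _)
split-low-high (suc k) zero    φ = sym (ℤ.+-identityʳ _)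
split-low-high (suc k) (suc t) φ =
  trans (cong (ℤ._+_ (φ 0 (suc t))) (split-low-high k t (λ p → φ (suc p))))
        (sym (ℤ.+-assoc (φ 0 (suc t)) _ _))

low-cong : ∀ {φ ψ} k t → (∀ p q → φ p q ≡ ψ p q) → low k t φ ≡ low k t ψ
low-cong zero    t       eq = refl
low-cong (suc k) zero    eq = eq 0 0
low-cong (suc k) (suc t) eq = cong₂ ℤ._+_ (eq 0 (suc t)) (low-cong k t (λ p → eq (suc p)))

-- The summands with p >= k raise the first entry at least to the second one, `k + a`. After the
-- shift of p by k they form a cone over two equal entries.
high-repeated : ∀ h → Antisymmetric h → ∀ l k t a φ →
  (∀ p q → φ p q ≡ cone (λ l′ → h (p + a ∷ l′)) (k + a ∷ l) q) → high k t φ ≡ 0ℤ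
high-repeated h h-anti l zero    t       a φ eq =
  trans (split-cong eq t) (cone-repeated h h-anti a l t)
high-repeated h h-anti l (suc k) zero    a φ eq = refl
high-repeated h h-anti l (suc k) (suc t) a φ eq =
  high-repeated h h-anti l k t (suc a) (λ p → φ (suc p)) λ p q →
    trans (eq (suc p) q)
      (cong₂ (λ x y → cone (λ l′ → h (x ∷ l′)) (y ∷ l) q) (sym (ℕ.+-suc p a)) (sym (ℕ.+-suc k a)))

-- The counterpart of `low` for lists, with concatenation in place of the sum.
steps : ℕ → ℕ → (ℕ → ℕ → List A) → List A
steps zero    t       φ = []
steps (suc k) zero    φ = φ 0 0
steps (suc k) (suc t) φ = φ 0 (suc t) ++ steps k t (λ p → φ (suc p))

-- For lo = 0, the partitions λ with one part more than μ such that λ/μ is a horizontal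
-- strip of size t.  Partitions are written in weakly increasing order, with zero parts.
strips : ℕ → List ℕ → ℕ → List (List ℕ)
strips lo []      t = [ t + lo ∷ [] ]
strips lo (m ∷ μ) t = steps (suc m ∸ lo) t (λ p q → map (p + lo ∷_) (strips m μ q))

-- Adding the staircase turns weakly into strictly increasing sequences.
hat : ℕ → List ℕ → List ℕ
hat j []      = []
hat j (x ∷ l) = x + j ∷ hat (suc j) l

IncreasingFrom : ℕ → List ℕ → Set
IncreasingFrom lo []      = ⊤
IncreasingFrom lo (x ∷ l) = lo ≤ x × IncreasingFrom x l

total : List A → (A → ℤ) → ℤ
total []       g = 0ℤ
total (x ∷ xs) g = g x ℤ.+ total xs g

total-cong : ∀ {g h : A → ℤ} {xs} → All (λ x → g x ≡ h x) xs → total xs g ≡ total xs h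
total-cong []         = refl
total-cong (eq ∷ eqs) = cong₂ ℤ._+_ eq (total-cong eqs)

total-++ : ∀ xs ys (g : A → ℤ) → total (xs ++ ys) g ≡ total xs g ℤ.+ total ys g
total-++ []       ys g = sym (ℤ.+-identityˡ _)
total-++ (x ∷ xs) ys g =
  trans (cong (ℤ._+_ (g x)) (total-++ xs ys g)) (sym (ℤ.+-assoc (g x) _ _))

total-map : ∀ (f : A → B) xs g → total (map f xs) g ≡ total xs (g ∘ f)
total-map f []       g = refl
total-map f (x ∷ xs) g = cong (ℤ._+_ (g (f x))) (total-map f xs g)

total-concatMap : ∀ (f : A → List B) xs g →
                  total (concatMap f xs) g ≡ total xs (λ x → total (f x) g)
total-concatMap f []       g = refl
total-concatMap f (x ∷ xs) g =
  trans (total-++ (f x) _ g) (cong (ℤ._+_ (total (f x) g)) (total-concatMap f xs g))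

total-steps : ∀ k t (φ : ℕ → ℕ → List A) g →
              total (steps k t φ) g ≡ low k t (λ p q → total (φ p q) g)
total-steps zero    t       φ g = refl
total-steps (suc k) zero    φ g = refl
total-steps (suc k) (suc t) φ g =
  trans (total-++ (φ 0 (suc t)) _ g) (cong (ℤ._+_ (total (φ 0 (suc t)) g)) (total-steps k t (λ p → φ (suc p)) g))

-- The terms of the cone sum outside of the strips cancel in pairs.
cone-strips : ∀ h → Antisymmetric h → ∀ j lo μ t → IncreasingFrom lo μ →
  cone h (lo + j ∷ map suc (hat j μ)) t ≡ total (strips lo μ t) (h ∘ hat j)
cone-strips h h-anti j lo [] t _ = begin
  split t (λ p → cone (λ l′ → h (p + (lo + j) ∷ l′)) []) ≡⟨ cone-[] (λ p l′ → h (p + (lo + j) ∷ l′)) t ⟩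
  h (t + (lo + j) ∷ [])                                   ≡⟨ cong (λ x → h (x ∷ [])) (ℕ.+-assoc t lo j) ⟨
  h (t + lo + j ∷ [])                                     ≡⟨ ℤ.+-identityʳ _ ⟨
  h (t + lo + j ∷ []) ℤ.+ 0ℤ                              ∎
  where open ≡-Reasoning
cone-strips h h-anti j lo (m ∷ μ) t (lo≤m , μ↑) = begin
  split t φ
    ≡⟨ split-low-high k t φ ⟩
  low k t φ ℤ.+ high k t φ
    ≡⟨ cong₂ ℤ._+_ (low-cong k t step)
         (high-repeated h h-anti (map suc (hat (suc j) μ)) k t (lo + j) φ λ p q →
           cong (λ x → cone (λ l′ → h (p + (lo + j) ∷ l′)) (x ∷ map suc (hat (suc j) μ)) q)
                (sym k+lo+j)) ⟩
  low k t (λ p q → total (map (p + lo ∷_) (strips m μ q)) (h ∘ hat j)) ℤ.+ 0ℤ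
    ≡⟨ ℤ.+-identityʳ _ ⟩
  low k t (λ p q → total (map (p + lo ∷_) (strips m μ q)) (h ∘ hat j))
    ≡⟨ total-steps k t _ (h ∘ hat j) ⟨
  total (strips lo (m ∷ μ) t) (h ∘ hat j)
    ∎
  where
  open ≡-Reasoning
  -- The strip condition p + lo <= m reads p < k. Since k + (lo + j) is the next entry of the cone,
  -- `high-repeated` removes all other p.
  k = suc m ∸ lo
  φ : ℕ → ℕ → ℤ
  φ p = cone (λ l′ → h (p + (lo + j) ∷ l′)) (suc (m + j) ∷ map suc (hat (suc j) μ))
  k+lo+j : k + (lo + j) ≡ suc (m + j)
  k+lo+j = trans (sym (ℕ.+-assoc k lo j)) (cong (_+ j) (ℕ.m∸n+n≡m (ℕ.m≤n⇒m≤1+n lo≤m)))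
  step : ∀ p q → φ p q ≡ total (map (p + lo ∷_) (strips m μ q)) (h ∘ hat j)
  step p q = begin
    φ p q
      ≡⟨ cong₂ (λ x y → cone (λ l′ → h (x ∷ l′)) (y ∷ map suc (hat (suc j) μ)) q)
               (ℕ.+-assoc p lo j) (ℕ.+-suc m j) ⟨
    cone (λ l′ → h (p + lo + j ∷ l′)) (m + suc j ∷ map suc (hat (suc j) μ)) q
      ≡⟨ cone-strips (λ l → h (p + lo + j ∷ l)) (λ pre → h-anti (p + lo + j ∷ pre)) (suc j) m μ q μ↑ ⟩
    total (strips m μ q) (λ l → h (p + lo + j ∷ hat (suc j) l))
      ≡⟨ total-map (p + lo ∷_) (strips m μ q) (h ∘ hat j) ⟨
    total (map (p + lo ∷_) (strips m μ q)) (h ∘ hat j)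
      ∎

all-steps : ∀ {P : A → Set} k t (φ : ℕ → ℕ → List A) →
            (∀ p q → p < k → p + q ≡ t → All P (φ p q)) → All P (steps k t φ)
all-steps zero    t       φ Pφ = []
all-steps (suc k) zero    φ Pφ = Pφ 0 0 (s≤s z≤n) refl
all-steps (suc k) (suc t) φ Pφ = All.++⁺ (Pφ 0 (suc t) (s≤s z≤n) refl)
  (all-steps k t _ (λ p q p<k eq → Pφ (suc p) q (s≤s p<k) (cong suc eq)))

-- Membership in `strips` as a relation, free of truncated subtraction; `strips-interlacing` and
-- `∈-strips` are the two directions.
data Interlacing : (lo : ℕ) (μ : List ℕ) (t : ℕ) (l : List ℕ) → Set where
  last : ∀ {lo t x} → t + lo ≡ x → Interlacing lo [] t [ x ]
  cons : ∀ {lo m μ t l} p q → p + q ≡ t → p + lo ≤ m → Interlacing m μ q l →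
         Interlacing lo (m ∷ μ) t (p + lo ∷ l)

strips-interlacing : ∀ lo μ t → All (Interlacing lo μ t) (strips lo μ t)
strips-interlacing lo []      t = last refl ∷ []
strips-interlacing lo (m ∷ μ) t = all-steps (suc m ∸ lo) t _ λ p q p<k eq →
  All.map⁺ (All.map (cons p q eq (ℕ.≤-pred (ℕ.≤-trans (ℕ.+-monoˡ-≤ lo p<k) (k+lo≤ p p<k))))
    (strips-interlacing m μ q))
  where
  k+lo≤ : ∀ p → p < suc m ∸ lo → suc m ∸ lo + lo ≤ suc m
  k+lo≤ p p<k = ℕ.≤-reflexive (ℕ.m∸n+n≡m (ℕ.<⇒≤ (ℕ.m∸n≢0⇒n<m {suc m} {lo}
    (λ eq → ℕ.n≮0 (subst (p <_) eq p<k)))))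

IncreasingFrom-≤ : ∀ {lo lo′} l → lo ≤ lo′ → IncreasingFrom lo′ l → IncreasingFrom lo l
IncreasingFrom-≤ []      _ _            = tt
IncreasingFrom-≤ (x ∷ l) p (lo′≤x , l↑) = ℕ.≤-trans p lo′≤x , l↑

interlacing-increasing : ∀ {lo μ t l} → Interlacing lo μ t l → IncreasingFrom lo l
interlacing-increasing {lo} {t = t} (last refl)            = ℕ.m≤n+m lo t , tt
interlacing-increasing {lo} (cons {l = l} p q _ le int) =
  ℕ.m≤n+m lo p , IncreasingFrom-≤ l le (interlacing-increasing int)

interlacing-length : ∀ {lo μ t l} → Interlacing lo μ t l → length l ≡ suc (length μ)
interlacing-length (last _)            = refl
interlacing-length (cons _ _ _ _ int) = cong suc (interlacing-length int)

-- The shapes, with multiplicity, of the semistandard tableaux with b entries length β for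
-- each tail b ∷ β of the list, i.e. whose content is the reverse of the list.
shapes : List ℕ → List (List ℕ)
shapes []      = [ [] ]
shapes (b ∷ β) = concatMap (λ μ → strips 0 μ b) (shapes β)

all-concatMap : ∀ {P : B → Set} (f : A → List B) {xs} → All (λ x → All P (f x)) xs →
                All P (concatMap f xs)
all-concatMap f []         = []
all-concatMap f (px ∷ pxs) = All.++⁺ px (all-concatMap f pxs)

shapes-increasing : ∀ β → All (IncreasingFrom 0) (shapes β)
shapes-increasing []      = tt ∷ []
shapes-increasing (b ∷ β) =
  all-concatMap _ (All.universal (λ μ → All.map interlacing-increasing (strips-interlacing 0 μ b)) (shapes β))

shapes-length : ∀ β → All (λ l → length l ≡ length β) (shapes β)
shapes-length []      = refl ∷ []
shapes-length (b ∷ β) =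
  all-concatMap _ (All.map (λ {μ} eq → All.map (λ int → trans (interlacing-length int) (cong suc eq))
                                                        (strips-interlacing 0 μ b))
                           (shapes-length β))

-- With its first argument fixed at `+ b`, `f` is again symmetric and zero on negative entries. The
-- induction hypothesis for it leaves one application of Pieri's rule, which adds the strip of size
-- `b`.
det-expansion : ∀ f → Symmetric f → VanishesOnNegative f → ∀ β →
                f (map +_ β) ≡ total (shapes β) (det (ramp 0 (length β)) f ∘ hat 0)
det-expansion f f-sym f-neg []      = sym (ℤ.+-identityʳ _)
det-expansion f f-sym f-neg (b ∷ β) = begin
  f (+ b ∷ map +_ β)
    ≡⟨ det-expansion (λ zs → f (+ b ∷ zs)) (λ pre → f-sym (+ b ∷ pre)) (λ pre → f-neg (+ b ∷ pre)) β ⟩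
  total (shapes β) (det (ramp 0 (length β)) (λ zs → f (+ b ∷ zs)) ∘ hat 0)
    ≡⟨ total-cong (All.map (λ {μ} μ↑ → trans (det-pieri f f-sym f-neg (length β) b (hat 0 μ))
         (cone-strips (det (ramp 0 (suc (length β))) f) (det-antisymmetric (ramp 0 (suc (length β))) f)
           0 0 μ b μ↑)) (shapes-increasing β)) ⟩
  total (shapes β) (λ μ → total (strips 0 μ b) (det (ramp 0 (suc (length β))) f ∘ hat 0))
    ≡⟨ total-concatMap (λ μ → strips 0 μ b) (shapes β) _ ⟨
  total (shapes (b ∷ β)) (det (ramp 0 (suc (length β))) f ∘ hat 0)
    ∎
  where open ≡-Reasoning

-- Gaps in dual Dyck words

infix 4 _≪_

-- Demanded of all entries and not just of the first, so that it passes to every redistribution of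
-- the entries between two rows, as in `Flip-All`.
_≪_ : ℤ → List ℤ → Set
a ≪ w = All (λ y → a ℤ.+ + 2 ℤ.≤ y) w

+-cancelˡ-≤ : ∀ a {x y} → a ℤ.+ x ℤ.≤ a ℤ.+ y → x ℤ.≤ y
+-cancelˡ-≤ a {x} {y} le =
  subst₂ ℤ._≤_ (cancel a x) (cancel a y) (ℤ.+-monoʳ-≤ (ℤ.- a) le)
  where
  cancel : ∀ a x → ℤ.- a ℤ.+ (a ℤ.+ x) ≡ x
  cancel = solve-∀

a+m≤a+n⁻ : ∀ a {m n} → a ℤ.+ + m ℤ.≤ a ℤ.+ + n → m ≤ n
a+m≤a+n⁻ a le = ℤ.drop‿+≤+ (+-cancelˡ-≤ a le)

[a+z]-a≡z : ∀ a z → (a ℤ.+ z) ℤ.- a ≡ z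
[a+z]-a≡z = solve-∀

y-a≡z⇒y≡a+z : ∀ {y a z} → y ℤ.- a ≡ z → y ≡ a ℤ.+ z
y-a≡z⇒y≡a+z {y} {a} refl = lemma y a
  where
  lemma : ∀ y a → y ≡ a ℤ.+ (y ℤ.- a)
  lemma = solve-∀

gap-offset : ∀ {a y} → a ℤ.+ + 2 ℤ.≤ y → ∃ λ n → y ≡ a ℤ.+ + suc (suc n)
gap-offset {a} {y} le with y ℤ.- a in eq
... | + zero          = ⊥-elim (bad (a+m≤a+n⁻ a (subst (a ℤ.+ + 2 ℤ.≤_) (y-a≡z⇒y≡a+z eq) le)))
  where
  bad : ¬ (2 ≤ 0)
  bad ()
... | + suc zero      = ⊥-elim (bad (a+m≤a+n⁻ a (subst (a ℤ.+ + 2 ℤ.≤_) (y-a≡z⇒y≡a+z eq) le)))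
  where
  bad : ¬ (2 ≤ 1)
  bad (s≤s ())
... | + (suc (suc n)) = n , y-a≡z⇒y≡a+z eq
... | -[1+ n ]        =
  ⊥-elim (bad (+-cancelˡ-≤ a (subst (a ℤ.+ + 2 ℤ.≤_) (y-a≡z⇒y≡a+z eq) le)))
  where
  bad : ¬ (+ 2 ℤ.≤ -[1+ n ])
  bad ()

a<a+suc : ∀ a n → a ℤ.< a ℤ.+ + suc n
a<a+suc a n = subst (ℤ._< a ℤ.+ + suc n) (ℤ.+-identityʳ a) (ℤ.+-monoʳ-< a (ℤ.+<+ (s≤s z≤n)))

gap⇒< : ∀ {a y} → a ℤ.+ + 2 ℤ.≤ y → a ℤ.< y
gap⇒< {a} le = ℤ.<-≤-trans (a<a+suc a 1) le

gap-trans : ∀ {x y z} → x ℤ.+ + 2 ℤ.≤ y → y ℤ.+ + 2 ℤ.≤ z → x ℤ.+ + 2 ℤ.≤ z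
gap-trans p q = ℤ.≤-trans p (ℤ.<⇒≤ (gap⇒< q))

≪-trans : ∀ x {y w} → x ℤ.+ + 2 ℤ.≤ y → y ≪ w → x ≪ w
≪-trans x p = All.map (gap-trans {x} p)

≪⇒All< : ∀ {a w} → a ≪ w → All (a ℤ.<_) w
≪⇒All< = All.map gap⇒<

a+1+2 : ∀ a → a ℤ.+ + 1 ℤ.+ + 2 ≡ + 1 ℤ.+ (a ℤ.+ + 2)
a+1+2 = solve-∀

a+2<⇒gap : ∀ a {y} → a ℤ.+ + 2 ℤ.< y → a ℤ.+ + 1 ℤ.+ + 2 ℤ.≤ y
a+2<⇒gap a lt = subst (ℤ._≤ _) (sym (a+1+2 a)) (ℤ.i<j⇒suc[i]≤j lt)

gap⇒a+2< : ∀ a {y} → a ℤ.+ + 1 ℤ.+ + 2 ℤ.≤ y → a ℤ.+ + 2 ℤ.< y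
gap⇒a+2< a le = ℤ.suc[i]≤j⇒i<j (subst (ℤ._≤ _) (a+1+2 a) le)

dualDyck-∷ : ∀ {a w} → a ≪ w → DualDyck w → DualDyck (a ∷ w)
dualDyck-∷ []       _  = [-]
dualDyck-∷ (p ∷ _) w↑ = p ∷ w↑

dualDyck⇒≪ : ∀ {a w} → DualDyck (a ∷ w) → a ≪ w
dualDyck⇒≪ [-]       = []
dualDyck⇒≪ {a} (p ∷ w↑) = p ∷ ≪-trans a p (dualDyck⇒≪ w↑)

dualDyck-tail : ∀ {a w} → DualDyck (a ∷ w) → DualDyck w
dualDyck-tail [-]       = []
dualDyck-tail (_ ∷ w↑) = w↑

-- The flip of two dual Dyck rows

startsWith : ℤ → List ℤ → Bool
startsWith c []      = false
startsWith c (y ∷ _) = does (c ℤ.≟ y)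

-- Consider the maximal runs of consecutive integers in A ∪ B (two equal entries
-- form a component of their own).  Along a run the entries alternate between the
-- two rows.  The runs of odd length change rows; those of even length must stay, as
-- otherwise the number of dual inversions would change.  Whether the run starting
-- with a, a + 1 is odd is seen from whether its entry a + 2 was moved.
flip : List ℤ → List ℤ → List ℤ × List ℤ
flip []      B       = B , []
flip (a ∷ A) []      = [] , a ∷ A
flip (a ∷ A) (b ∷ B) = step (b ℤ.- a) (flip A B) (flip A (b ∷ B)) (flip (a ∷ A) B)
  where
  step : ℤ → (both left right : List ℤ × List ℤ) → List ℤ × List ℤ
  step (+ 0)           (X , Y) _ _ = a ∷ X , b ∷ Y
  step (+ 1)           (X , Y) _ _ =
    if startsWith (a ℤ.+ + 2) Y then (b ∷ X , a ∷ Y) else (a ∷ X , b ∷ Y)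
  step (+ suc (suc _)) _ (X , Y) _ = X , a ∷ Y
  step -[1+ 0 ]        (X , Y) _ _ =
    if startsWith (b ℤ.+ + 2) X then (b ∷ X , a ∷ Y) else (a ∷ X , b ∷ Y)
  step -[1+ suc _ ]    _ _ (X , Y) = b ∷ X , Y

-- The graph of `flip`, visibly closed under exchanging input with output and the first row with the
-- second. In `next-move` the run a, a + 1 goes on with a moved entry c = a + 2 and therefore moves
-- as well; in `next-keep` the gap `b ≪ Y` says that no a + 2 has arrived in `Y`.
data Flip : (A B X Y : List ℤ) → Set where
  nil       : Flip [] [] [] []
  far₁      : ∀ {a A B X Y} → a ≪ A → a ≪ B → a ≪ X → a ≪ Y → Flip A B X Y →
              Flip (a ∷ A) B X (a ∷ Y)
  far₂      : ∀ {b A B X Y} → b ≪ A → b ≪ B → b ≪ X → b ≪ Y → Flip A B X Y →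
              Flip A (b ∷ B) (b ∷ X) Y
  same      : ∀ {a A B X Y} → a ≪ A → a ≪ B → a ≪ X → a ≪ Y → Flip A B X Y →
              Flip (a ∷ A) (a ∷ B) (a ∷ X) (a ∷ Y)
  next-keep : ∀ {a b A B X Y} → b ≡ a ℤ.+ + 1 → a ≪ A → b ≪ B → a ≪ X → b ≪ Y →
              Flip A B X Y → Flip (a ∷ A) (b ∷ B) (a ∷ X) (b ∷ Y)
  next-move : ∀ {a b c A B X Y} → b ≡ a ℤ.+ + 1 → c ≡ a ℤ.+ + 2 → c ≪ A → b ≪ B → b ≪ X → c ≪ Y →
              Flip (c ∷ A) B X (c ∷ Y) → Flip (a ∷ c ∷ A) (b ∷ B) (b ∷ X) (a ∷ c ∷ Y)
  prev-keep : ∀ {a b A B X Y} → a ≡ b ℤ.+ + 1 → a ≪ A → b ≪ B → a ≪ X → b ≪ Y →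
              Flip A B X Y → Flip (a ∷ A) (b ∷ B) (a ∷ X) (b ∷ Y)
  prev-move : ∀ {a b c A B X Y} → a ≡ b ℤ.+ + 1 → c ≡ b ℤ.+ + 2 → a ≪ A → c ≪ B → c ≪ X → a ≪ Y →
              Flip A (c ∷ B) (c ∷ X) Y → Flip (a ∷ A) (b ∷ c ∷ B) (b ∷ c ∷ X) (a ∷ Y)

Flip-sym : ∀ {A B X Y} → Flip A B X Y → Flip X Y A B
Flip-sym nil                              = nil
Flip-sym (far₁ p q r s φ)                 = far₂ r s p q (Flip-sym φ)
Flip-sym (far₂ p q r s φ)                 = far₁ r s p q (Flip-sym φ)
Flip-sym (same p q r s φ)                 = same r s p q (Flip-sym φ)
Flip-sym (next-keep e p q r s φ)          = next-keep e r s p q (Flip-sym φ)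
Flip-sym (next-move e e′ p q r s φ)       = prev-move e e′ r s p q (Flip-sym φ)
Flip-sym (prev-keep e p q r s φ)          = prev-keep e r s p q (Flip-sym φ)
Flip-sym (prev-move e e′ p q r s φ)       = next-move e e′ r s p q (Flip-sym φ)

Flip-mirror : ∀ {A B X Y} → Flip A B X Y → Flip B A Y X
Flip-mirror nil                           = nil
Flip-mirror (far₁ p q r s φ)              = far₂ q p s r (Flip-mirror φ)
Flip-mirror (far₂ p q r s φ)              = far₁ q p s r (Flip-mirror φ)
Flip-mirror (same p q r s φ)              = same q p s r (Flip-mirror φ)
Flip-mirror (next-keep e p q r s φ)       = prev-keep e q p s r (Flip-mirror φ)
Flip-mirror (next-move e e′ p q r s φ)    = prev-move e e′ q p s r (Flip-mirror φ)
Flip-mirror (prev-keep e p q r s φ)       = next-keep e q p s r (Flip-mirror φ)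
Flip-mirror (prev-move e e′ p q r s φ)    = next-move e e′ q p s r (Flip-mirror φ)

Flip-↭ : ∀ {A B X Y} → Flip A B X Y → A ++ B ↭ X ++ Y
Flip-↭ nil = ↭-refl
Flip-↭ (far₁ {a} {A} {B} {X} {Y} _ _ _ _ φ) =
  ↭-trans (prep a (Flip-↭ φ)) (↭-sym (↭.shift a X Y))
Flip-↭ (far₂ {b} {A} {B} {X} {Y} _ _ _ _ φ) =
  ↭-trans (↭.shift b A B) (prep b (Flip-↭ φ))
Flip-↭ (same {a} {A} {B} {X} {Y} _ _ _ _ φ) = prep a (both (Flip-↭ φ))
  where
  both : A ++ B ↭ X ++ Y → A ++ a ∷ B ↭ X ++ a ∷ Y
  both σ = ↭-trans (↭.shift a A B) (↭-trans (prep a σ) (↭-sym (↭.shift a X Y)))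
Flip-↭ (next-keep {a} {b} {A} {B} {X} {Y} _ _ _ _ _ φ) =
  prep a (↭-trans (↭.shift b A B) (↭-trans (prep b (Flip-↭ φ)) (↭-sym (↭.shift b X Y))))
Flip-↭ (next-move {a} {b} {c} {A} {B} {X} {Y} _ _ _ _ _ _ φ) =
  ↭-trans (prep a (↭.shift b (c ∷ A) B))
    (↭-trans (swap a b (Flip-↭ φ)) (prep b (↭-sym (↭.shift a X (c ∷ Y)))))
Flip-↭ (prev-keep {a} {b} {A} {B} {X} {Y} _ _ _ _ _ φ) =
  prep a (↭-trans (↭.shift b A B) (↭-trans (prep b (Flip-↭ φ)) (↭-sym (↭.shift b X Y))))
Flip-↭ (prev-move {a} {b} {c} {A} {B} {X} {Y} _ _ _ _ _ _ φ) =
  ↭-trans (prep a (↭.shift b A (c ∷ B)))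
    (↭-trans (swap a b (Flip-↭ φ)) (prep b (↭-sym (↭.shift a (c ∷ X) Y))))

-- The entries that stay are balanced between the rows, in runs of even length or in equal pairs;
-- all others change rows.
Flip-length : ∀ {A B X Y} → Flip A B X Y → length X ≡ length B
Flip-length nil                       = refl
Flip-length (far₁ _ _ _ _ φ)          = Flip-length φ
Flip-length (far₂ _ _ _ _ φ)          = cong suc (Flip-length φ)
Flip-length (same _ _ _ _ φ)          = cong suc (Flip-length φ)
Flip-length (next-keep _ _ _ _ _ φ)   = cong suc (Flip-length φ)
Flip-length (next-move _ _ _ _ _ _ φ) = cong suc (Flip-length φ)
Flip-length (prev-keep _ _ _ _ _ φ)   = cong suc (Flip-length φ)
Flip-length (prev-move _ _ _ _ _ _ φ) = cong suc (Flip-length φ)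

b+1≡a+2 : ∀ a → a ℤ.+ + 1 ℤ.+ + 1 ≡ a ℤ.+ + 2
b+1≡a+2 = solve-∀

Flip-dualDyck : ∀ {A B X Y} → Flip A B X Y → DualDyck X
Flip-dualDyck nil                       = []
Flip-dualDyck (far₁ _ _ _ _ φ)          = Flip-dualDyck φ
Flip-dualDyck (far₂ _ _ r _ φ)          = dualDyck-∷ r (Flip-dualDyck φ)
Flip-dualDyck (same _ _ r _ φ)          = dualDyck-∷ r (Flip-dualDyck φ)
Flip-dualDyck (next-keep _ _ _ r _ φ)   = dualDyck-∷ r (Flip-dualDyck φ)
Flip-dualDyck (next-move _ _ _ _ r _ φ) = dualDyck-∷ r (Flip-dualDyck φ)
Flip-dualDyck (prev-keep _ _ _ r _ φ)   = dualDyck-∷ r (Flip-dualDyck φ)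
Flip-dualDyck (prev-move {b = b} _ e′ _ _ r _ φ) =
  dualDyck-∷ (gap ∷ ≪-trans b gap r) (Flip-dualDyck φ)
  where gap = ℤ.≤-reflexive (sym e′)

<-refl-elim : ∀ {a} {P : Set} → a ℤ.< a → P
<-refl-elim lt = ⊥-elim (ℤ.<-irrefl refl lt)

-- An entry that heads the new second row and lies below all of the old one has come from the head
-- of the first row. This provides the premises of `next-move`.
Flip-head : ∀ {A B X c Y} → Flip A B X (c ∷ Y) → All (c ℤ.<_) B →
            ∃ λ A′ → A ≡ c ∷ A′ × c ≪ A′ × c ≪ Y × All (c ℤ.<_) X
Flip-head (far₁ p q r s φ)             _       = _ , refl , p , s , ≪⇒All< r
Flip-head (far₂ p q r (s ∷ _) φ)       (t ∷ _) = <-refl-elim (ℤ.<-trans t (gap⇒< s))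
Flip-head (same p q r s φ)             (t ∷ _) = <-refl-elim t
Flip-head (next-keep e p q r s φ)      (t ∷ _) = <-refl-elim t
Flip-head (next-move {a} refl refl p q r s φ) _ =
  _ , refl , gap ∷ ≪-trans a gap p , gap ∷ ≪-trans a gap s ,
  a<a+suc a 0 ∷ All.map (ℤ.<-trans (a<a+suc a 0)) (≪⇒All< r)
  where gap = ℤ.≤-refl {a ℤ.+ + 2}
Flip-head (prev-keep e p q r s φ)      (t ∷ _) = <-refl-elim t
Flip-head (prev-move {b = b} refl e′ p q r s φ) (t ∷ _) = <-refl-elim (ℤ.<-trans t (a<a+suc b 0))

startsWith-true : ∀ c Y → startsWith c Y ≡ true → ∃ λ Y′ → Y ≡ c ∷ Y′
startsWith-true c (y ∷ Y) eq with c ℤ.≟ y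
... | yes refl = Y , refl

startsWith-refl : ∀ c Y → startsWith c (c ∷ Y) ≡ true
startsWith-refl c Y with c ℤ.≟ c
... | yes _  = refl
... | no c≢c = ⊥-elim (c≢c refl)

startsWith-false : ∀ {c} Y → startsWith c Y ≡ false → All (c ℤ.≤_) Y → DualDyck Y → All (c ℤ.<_) Y
startsWith-false []      eq _         _  = []
startsWith-false {c} (y ∷ Y) eq (c≤y ∷ _) Y↑ with c ℤ.≟ y
... | no c≢y = c<y ∷ All.map (λ le → ℤ.<-trans c<y (gap⇒< le)) (dualDyck⇒≪ Y↑)
  where c<y = ℤ.≤∧≢⇒< c≤y c≢y

<⇒startsWith-false : ∀ {c} Y → All (c ℤ.<_) Y → startsWith c Y ≡ false
<⇒startsWith-false []          _         = refl
<⇒startsWith-false {c} (y ∷ Y) (c<y ∷ _) with c ℤ.≟ y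
... | yes refl = <-refl-elim c<y
... | no _     = refl

Flip-All : ∀ {P : ℤ → Set} {A B X Y} → Flip A B X Y → All P A → All P B → All P X × All P Y
Flip-All {X = X} φ PA PB = All.++⁻ X (↭.All-resp-↭ (Flip-↭ φ) (All.++⁺ PA PB))

flip-[] : ∀ A → DualDyck A → Flip A [] [] A
flip-[] []      _  = nil
flip-[] (a ∷ A) A↑ = far₁ (dualDyck⇒≪ A↑) [] [] (dualDyck⇒≪ A↑) (flip-[] A (dualDyck-tail A↑))

next-move-if : ∀ {a b A B X Y} → b ≡ a ℤ.+ + 1 → b ≪ B → Flip A B X Y →
             startsWith (a ℤ.+ + 2) Y ≡ true → Flip (a ∷ A) (b ∷ B) (b ∷ X) (a ∷ Y)
next-move-if {a} {Y = Y} refl b≪B φ eq with startsWith-true _ Y eq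
... | Y′ , refl with Flip-head φ (All.map (gap⇒a+2< a) b≪B)
... | A′ , refl , c≪A′ , c≪Y′ , c<X =
  next-move refl refl c≪A′ b≪B (All.map (a+2<⇒gap a) c<X) c≪Y′ φ

next-keep-if : ∀ {a b A B X Y} → b ≡ a ℤ.+ + 1 → a ≪ A → b ≪ B → Flip A B X Y →
             startsWith (a ℤ.+ + 2) Y ≡ false → Flip (a ∷ A) (b ∷ B) (a ∷ X) (b ∷ Y)
next-keep-if {a} {X = X} {Y = Y} refl a≪A b≪B φ eq = next-keep refl a≪A b≪B a≪X b≪Y φ
  where
  a≪XY = Flip-All φ a≪A (All.map (λ gap → ℤ.<⇒≤ (gap⇒a+2< a gap)) b≪B)
  a≪X = proj₁ a≪XY
  b≪Y = All.map (a+2<⇒gap a) (startsWith-false Y eq (proj₂ a≪XY) (Flip-dualDyck (Flip-mirror φ)))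

y-a≡-z⇒a≡y+z : ∀ y {a} z → y ℤ.- a ≡ ℤ.- z → a ≡ y ℤ.+ z
y-a≡-z⇒a≡y+z y {a} z eq =
  trans (lemma y a) (cong (ℤ._+_ y) (trans (cong ℤ.-_ eq) (ℤ.neg-involutive z)))
  where
  lemma : ∀ y a → a ≡ y ℤ.+ ℤ.- (y ℤ.- a)
  lemma = solve-∀

gap-suc-suc : ∀ a {b} n → b ≡ a ℤ.+ + suc (suc n) → a ℤ.+ + 2 ℤ.≤ b
gap-suc-suc a n refl = ℤ.+-monoʳ-≤ a (ℤ.+≤+ (s≤s (s≤s z≤n)))

Flip-step : ∀ a b A B → let X , Y = flip A B; X₁ , Y₁ = flip A (b ∷ B); X₂ , Y₂ = flip (a ∷ A) B in
  DualDyck (a ∷ A) → DualDyck (b ∷ B) →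
  Flip A B X Y → Flip A (b ∷ B) X₁ Y₁ → Flip (a ∷ A) B X₂ Y₂ →
  Flip (a ∷ A) (b ∷ B) (proj₁ (flip (a ∷ A) (b ∷ B))) (proj₂ (flip (a ∷ A) (b ∷ B)))
Flip-step a b A B A↑ B↑ φ φ₁ φ₂ with b ℤ.- a in eq
... | + 0 = subst (λ z → Flip (a ∷ A) (z ∷ B) (a ∷ X) (z ∷ Y)) (sym b≡a)
                  (same a≪A a≪B (proj₁ (Flip-All φ a≪A a≪B)) (proj₂ (Flip-All φ a≪A a≪B)) φ)
  where
  X = proj₁ (flip A B)
  Y = proj₂ (flip A B)
  b≡a : b ≡ a
  b≡a = trans (y-a≡z⇒y≡a+z eq) (ℤ.+-identityʳ a)
  a≪A = dualDyck⇒≪ A↑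
  a≪B = subst (_≪ B) b≡a (dualDyck⇒≪ B↑)
... | + suc (suc n) = far₁ a≪A a≪B (proj₁ (Flip-All φ₁ a≪A a≪B)) (proj₂ (Flip-All φ₁ a≪A a≪B)) φ₁
  where
  a≪A = dualDyck⇒≪ A↑
  gap = gap-suc-suc a n (y-a≡z⇒y≡a+z eq)
  a≪B = gap ∷ ≪-trans a gap (dualDyck⇒≪ B↑)
... | -[1+ suc n ] = far₂ b≪A b≪B (proj₁ (Flip-All φ₂ b≪A b≪B)) (proj₂ (Flip-All φ₂ b≪A b≪B)) φ₂
  where
  b≪B = dualDyck⇒≪ B↑
  gap = gap-suc-suc b n (y-a≡-z⇒a≡y+z b (+ suc (suc n)) eq)
  b≪A = gap ∷ ≪-trans b gap (dualDyck⇒≪ A↑)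
Flip-step a b A B A↑ B↑ φ φ₁ φ₂ | + 1 with startsWith (a ℤ.+ + 2) (proj₂ (flip A B)) in eq′
... | true  = next-move-if (y-a≡z⇒y≡a+z eq) (dualDyck⇒≪ B↑) φ eq′
... | false = next-keep-if (y-a≡z⇒y≡a+z eq) (dualDyck⇒≪ A↑) (dualDyck⇒≪ B↑) φ eq′
Flip-step a b A B A↑ B↑ φ φ₁ φ₂ | -[1+ 0 ] with startsWith (b ℤ.+ + 2) (proj₁ (flip A B)) in eq′
... | true  = Flip-mirror (next-move-if (y-a≡-z⇒a≡y+z b (+ 1) eq) (dualDyck⇒≪ A↑) (Flip-mirror φ) eq′)
... | false = Flip-mirror (next-keep-if (y-a≡-z⇒a≡y+z b (+ 1) eq) (dualDyck⇒≪ B↑) (dualDyck⇒≪ A↑)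
                                      (Flip-mirror φ) eq′)

Flip-flip : ∀ A B → DualDyck A → DualDyck B → Flip A B (proj₁ (flip A B)) (proj₂ (flip A B))
Flip-flip []      B       _  B↑ = Flip-mirror (flip-[] B B↑)
Flip-flip (a ∷ A) []      A↑ _  = flip-[] (a ∷ A) A↑
Flip-flip (a ∷ A) (b ∷ B) A↑ B↑ = Flip-step a b A B A↑ B↑
  (Flip-flip A B (dualDyck-tail A↑) (dualDyck-tail B↑))
  (Flip-flip A (b ∷ B) (dualDyck-tail A↑) B↑)
  (Flip-flip (a ∷ A) B A↑ (dualDyck-tail B↑))

[a-[a+z]]≡-z : ∀ a z → a ℤ.- (a ℤ.+ z) ≡ ℤ.- z
[a-[a+z]]≡-z = solve-∀

flip-[]≡ : ∀ A → flip A [] ≡ ([] , A)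
flip-[]≡ []      = refl
flip-[]≡ (_ ∷ _) = refl

-- Together with `Flip-flip` and `Flip-sym` this makes `flip` an involution on pairs of dual Dyck
-- rows.
Flip-unique : ∀ {A B X Y} → Flip A B X Y → flip A B ≡ (X , Y)
Flip-unique nil = refl
Flip-unique (far₁ {a} {A} {[]} _ _ _ _ φ)
  with refl ← trans (sym (flip-[]≡ A)) (Flip-unique φ) = refl
Flip-unique (far₁ {a} {A} {b ∷ B} _ (a≪b ∷ _) _ _ φ) with gap-offset {a} a≪b
... | n , refl rewrite [a+z]-a≡z a (+ suc (suc n)) | Flip-unique φ = refl
Flip-unique (far₂ {b} {[]} {B} _ _ _ _ φ) with refl ← Flip-unique φ = refl
Flip-unique (far₂ {b} {a ∷ A} {B} (b≪a ∷ _) _ _ _ φ) with gap-offset {b} b≪a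
... | n , refl rewrite [a-[a+z]]≡-z b (+ suc (suc n)) | Flip-unique φ = refl
Flip-unique (same {a} _ _ _ _ φ) rewrite ℤ.+-inverseʳ a | Flip-unique φ = refl
Flip-unique (next-keep {a} {Y = Y} refl _ _ _ b≪Y φ)
  rewrite [a+z]-a≡z a (+ 1) | Flip-unique φ
        | <⇒startsWith-false Y (All.map (gap⇒a+2< a) b≪Y) = refl
Flip-unique (next-move {a} {Y = Y} refl refl _ _ _ _ φ)
  rewrite [a+z]-a≡z a (+ 1) | Flip-unique φ | startsWith-refl (a ℤ.+ + 2) Y = refl
Flip-unique (prev-keep {b = b} {X = X} refl _ _ a≪X _ φ)
  rewrite [a-[a+z]]≡-z b (+ 1) | Flip-unique φ
        | <⇒startsWith-false X (All.map (gap⇒a+2< b) a≪X) = refl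
Flip-unique (prev-move {b = b} {X = X} refl refl _ _ _ _ φ)
  rewrite [a-[a+z]]≡-z b (+ 1) | Flip-unique φ | startsWith-refl (b ℤ.+ + 2) X = refl

-- Dual inversions between two words

hits : ℤ → List ℤ → ℕ
hits x w = length (filter (λ y → x ℤ.≟ y ℤ.+ 1ℤ) w)

cross : List ℤ → List ℤ → ℕ
cross []      w = 0
cross (x ∷ u) w = hits x w + cross u w

hits-++ : ∀ x u w → hits x (u ++ w) ≡ hits x u + hits x w
hits-++ x u w = trans (cong length (List.filter-++ _ u w)) (List.length-++ (filter _ u))

hits-↭ : ∀ x {u w} → u ↭ w → hits x u ≡ hits x w
hits-↭ x σ = ↭.↭-length (↭.filter-↭ _ σ)

di-++ : ∀ u w → di (u ++ w) ≡ di u + di w + cross u w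
di-++ []      w = sym (ℕ.+-identityʳ (di w))
di-++ (x ∷ u) w = trans (cong₂ _+_ (hits-++ x u w) (di-++ u w))
                          (rearrange (hits x u) (hits x w) (di u) (di w) (cross u w))
  where
  rearrange : ∀ a b c d e → (a + b) + ((c + d) + e) ≡ ((a + c) + d) + (b + e)
  rearrange = ℕ-Solver.solve-∀

+-interchangeℕ : ∀ a b c d → (a + b) + (c + d) ≡ (a + c) + (b + d)
+-interchangeℕ = ℕ-Solver.solve-∀

cross-++ˡ : ∀ u v w → cross (u ++ v) w ≡ cross u w + cross v w
cross-++ˡ []      v w = refl
cross-++ˡ (x ∷ u) v w =
  trans (cong (_+_ (hits x w)) (cross-++ˡ u v w)) (sym (ℕ.+-assoc (hits x w) _ _))

cross-++ʳ : ∀ u v w → cross u (v ++ w) ≡ cross u v + cross u w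
cross-++ʳ []      v w = refl
cross-++ʳ (x ∷ u) v w = trans (cong₂ _+_ (hits-++ x v w) (cross-++ʳ u v w))
                                (+-interchangeℕ (hits x v) (hits x w) _ _)

cross-↭ˡ : ∀ {u v} w → u ↭ v → cross u w ≡ cross v w
cross-↭ˡ w _↭_.refl         = refl
cross-↭ˡ w (prep x σ)   = cong (_+_ (hits x w)) (cross-↭ˡ w σ)
cross-↭ˡ w (swap x y σ) =
  trans (cong (λ n → hits x w + (hits y w + n)) (cross-↭ˡ w σ))
          (x+[y+z] (hits x w) (hits y w) _)
  where
  x+[y+z] : ∀ x y z → x + (y + z) ≡ y + (x + z)
  x+[y+z] = ℕ-Solver.solve-∀
cross-↭ˡ w (_↭_.trans σ τ)  = trans (cross-↭ˡ w σ) (cross-↭ˡ w τ)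

cross-↭ʳ : ∀ u {v w} → v ↭ w → cross u v ≡ cross u w
cross-↭ʳ []      σ = refl
cross-↭ʳ (x ∷ u) σ = cong₂ _+_ (hits-↭ x σ) (cross-↭ʳ u σ)

hits-none : ∀ {x w} → All (λ y → x ≢ y ℤ.+ 1ℤ) w → hits x w ≡ 0
hits-none none = cong length (List.filter-none _ none)

cross-none : ∀ {u w} → All (λ x → All (λ y → x ≢ y ℤ.+ 1ℤ) w) u → cross u w ≡ 0
cross-none []             = refl
cross-none (none ∷ nones) = cong₂ _+_ (hits-none none) (cross-none nones)

hitsʳ : ℤ → List ℤ → ℕ
hitsʳ y u = cross u [ y ]

cross-∷ʳ : ∀ u y w → cross u (y ∷ w) ≡ hitsʳ y u + cross u w
cross-∷ʳ u y w = cross-++ʳ u [ y ] w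

≤⇒≢+1 : ∀ {x y} → x ℤ.≤ y → x ≢ y ℤ.+ 1ℤ
≤⇒≢+1 {_} {y} le refl = ℤ.<-irrefl refl (ℤ.<-≤-trans (a<a+suc y 0) le)

gap⇒≢+1 : ∀ x {y} → x ℤ.+ + 2 ℤ.≤ y → x ≢ y ℤ.+ 1ℤ
gap⇒≢+1 x le = ≤⇒≢+1 (ℤ.<⇒≤ (gap⇒< {x} le))

gap⇒≢+1′ : ∀ x {y} → x ℤ.+ + 2 ℤ.≤ y → y ≢ x ℤ.+ 1ℤ
gap⇒≢+1′ x le refl = bad (a+m≤a+n⁻ x le)
  where
  bad : ¬ (2 ≤ 1)
  bad (s≤s ())

hits-≪ : ∀ x {w} → x ≪ w → hits x w ≡ 0
hits-≪ x x≪w = hits-none (All.map (gap⇒≢+1 x) x≪w)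

hitsʳ-≪ : ∀ y {u} → y ≪ u → hitsʳ y u ≡ 0
hitsʳ-≪ y y≪u = cross-none (All.map (λ gap → gap⇒≢+1′ y gap ∷ []) y≪u)

hits-suc : ∀ {x y w} → x ≡ y ℤ.+ 1ℤ → hits x (y ∷ w) ≡ suc (hits x w)
hits-suc {x} {y} eq with x ℤ.≟ y ℤ.+ 1ℤ
... | yes _ = refl
... | no ne = ⊥-elim (ne eq)

far-cross : ∀ a A B X Y → a ≪ B → a ≪ X → cross A B ≡ cross X Y →
            cross (a ∷ A) B ≡ cross X (a ∷ Y)
far-cross a A B X Y a≪B a≪X eq = begin
  hits a B + cross A B   ≡⟨ cong₂ _+_ (hits-≪ a a≪B) eq ⟩
  cross X Y              ≡⟨ cong (_+ cross X Y) (hitsʳ-≪ a a≪X) ⟨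
  hitsʳ a X + cross X Y  ≡⟨ cross-∷ʳ X a Y ⟨
  cross X (a ∷ Y)        ∎
  where open ≡-Reasoning

heads-cross : ∀ {a b A B} → cross (a ∷ A) (b ∷ B) ≡ (hits a [ b ] + hits a B) + (hitsʳ b A + cross A B)
heads-cross {a} {b} {A} {B} = cong₂ _+_ (hits-++ a [ b ] B) (cross-∷ʳ A b B)

a≤a+1 : ∀ a → a ℤ.≤ a ℤ.+ + 1
a≤a+1 a = ℤ.<⇒≤ (a<a+suc a 0)

≪-weaken : ∀ a b {w} → a ℤ.≤ b → b ≪ w → a ≪ w
≪-weaken a b a≤b = All.map (ℤ.≤-trans (ℤ.+-monoˡ-≤ (+ 2) a≤b))

keep-cross : ∀ a b A B X Y →
  hits a B ≡ hits a Y → hitsʳ b A ≡ hitsʳ b X → cross A B ≡ cross X Y →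
  cross (a ∷ A) (b ∷ B) ≡ cross (a ∷ X) (b ∷ Y)
keep-cross a b A B X Y eq₁ eq₂ eq₃ = begin
  cross (a ∷ A) (b ∷ B)
    ≡⟨ heads-cross {a} {b} {A} {B} ⟩
  (hits a [ b ] + hits a B) + (hitsʳ b A + cross A B)
    ≡⟨ cong₂ _+_ (cong (_+_ (hits a [ b ])) eq₁) (cong₂ _+_ eq₂ eq₃) ⟩
  (hits a [ b ] + hits a Y) + (hitsʳ b X + cross X Y)
    ≡⟨ heads-cross {a} {b} {X} {Y} ⟨
  cross (a ∷ X) (b ∷ Y)
    ∎
  where open ≡-Reasoning

-- The dual inversion of `c` in the first row with `b` in the second is lost; that of `b`, now in
-- the first row, with `a` is gained.
move-cross : ∀ {a b c A B X Y} → b ≡ a ℤ.+ + 1 → c ≡ a ℤ.+ + 2 → c ≪ A → b ≪ B → b ≪ X → c ≪ Y →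
             cross (c ∷ A) B ≡ cross X (c ∷ Y) →
             cross (a ∷ c ∷ A) (b ∷ B) ≡ cross (b ∷ X) (a ∷ c ∷ Y)
move-cross {a} {b} {c} {A} {B} {X} {Y} refl refl c≪A b≪B b≪X c≪Y eq = begin
  cross (a ∷ c ∷ A) (b ∷ B)
    ≡⟨ cong₂ _+_ (hits-none (≤⇒≢+1 a≤b ∷ All.map (gap⇒≢+1 a) a≪B)) (cross-∷ʳ (c ∷ A) b B) ⟩
  (hits c [ b ] + hitsʳ b A) + cross (c ∷ A) B
    ≡⟨ cong (_+ cross (c ∷ A) B) (cong₂ _+_ (hits-suc {w = []} (sym (b+1≡a+2 a)))
         (hitsʳ-≪ b (≪-weaken b c b≤c c≪A))) ⟩
  suc (cross (c ∷ A) B)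
    ≡⟨ cong suc eq ⟩
  suc (cross X (c ∷ Y))
    ≡⟨ cong₂ _+_ (trans (hits-suc {a ℤ.+ + 1} {a} {c ∷ Y} refl)
                          (cong suc (hits-none (≤⇒≢+1 b≤c ∷ All.map (gap⇒≢+1 b) (≪-weaken b c b≤c c≪Y)))))
                 (trans (cross-∷ʳ X a (c ∷ Y))
                          (cong (_+ cross X (c ∷ Y)) (hitsʳ-≪ a (≪-weaken a b (a≤a+1 a) b≪X)))) ⟨
  cross (b ∷ X) (a ∷ c ∷ Y)
    ∎
  where
  open ≡-Reasoning
  a≤b = a≤a+1 a
  a≪B = ≪-weaken a b (a≤a+1 a) b≪B
  b≤c : b ℤ.≤ c
  b≤c = subst (b ℤ.≤_) (b+1≡a+2 a) (a≤a+1 b)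

-- By the gaps an entry b + 1 can only be in the first row, before as well as after, and the number
-- of such entries in both rows together is unchanged.
Flip-hitsʳ : ∀ {A B X Y} b → Flip A B X Y → b ≪ B → b ≪ Y → hitsʳ b A ≡ hitsʳ b X
Flip-hitsʳ {A} {B} {X} {Y} b φ b≪B b≪Y = begin
  hitsʳ b A              ≡⟨ ℕ.+-identityʳ _ ⟨
  hitsʳ b A + 0          ≡⟨ cong (_+_ (hitsʳ b A)) (hitsʳ-≪ b b≪B) ⟨
  hitsʳ b A + hitsʳ b B  ≡⟨ cross-++ˡ A B [ b ] ⟨
  hitsʳ b (A ++ B)       ≡⟨ cross-↭ˡ [ b ] (Flip-↭ φ) ⟩
  hitsʳ b (X ++ Y)       ≡⟨ cross-++ˡ X Y [ b ] ⟩
  hitsʳ b X + hitsʳ b Y  ≡⟨ cong (_+_ (hitsʳ b X)) (hitsʳ-≪ b b≪Y) ⟩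
  hitsʳ b X + 0          ≡⟨ ℕ.+-identityʳ _ ⟩
  hitsʳ b X              ∎
  where open ≡-Reasoning

Flip-hits : ∀ {A B X Y} a → Flip A B X Y → a ≪ A → a ≪ X → hits a B ≡ hits a Y
Flip-hits {A} {B} {X} {Y} a φ a≪A a≪X = begin
  hits a B             ≡⟨ cong (_+ hits a B) (hits-≪ a a≪A) ⟨
  hits a A + hits a B  ≡⟨ hits-++ a A B ⟨
  hits a (A ++ B)      ≡⟨ hits-↭ a (Flip-↭ φ) ⟩
  hits a (X ++ Y)      ≡⟨ hits-++ a X Y ⟩
  hits a X + hits a Y  ≡⟨ cong (_+ hits a Y) (hits-≪ a a≪X) ⟩
  hits a Y             ∎
  where open ≡-Reasoning

-- A run of 2k + 1 entries has 2k pairs of neighbours. Whichever row it starts in, exactly k of them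
-- have the larger entry in the first row.
Flip-cross : ∀ {A B X Y} → Flip A B X Y → cross A B ≡ cross X Y
Flip-cross nil              = refl
Flip-cross (far₁ {a} {A} {B} {X} {Y} p q r s φ) = far-cross a A B X Y q r (Flip-cross φ)
Flip-cross (far₂ {b} {A} {B} {X} {Y} p q r s φ) =
  sym (far-cross b X Y A B s p (sym (Flip-cross φ)))
Flip-cross (same {a} {A} {B} {X} {Y} p q r s φ) = keep-cross a a A B X Y
  (trans (hits-≪ a q) (sym (hits-≪ a s))) (trans (hitsʳ-≪ a p) (sym (hitsʳ-≪ a r)))
  (Flip-cross φ)
Flip-cross (next-keep {a} {b} {A} {B} {X} {Y} refl p q r s φ) = keep-cross a b A B X Y
  (trans (hits-≪ a (≪-weaken a b (a≤a+1 a) q)) (sym (hits-≪ a (≪-weaken a b (a≤a+1 a) s))))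
  (Flip-hitsʳ b φ q s) (Flip-cross φ)
Flip-cross (next-move e e′ p q r s φ) = move-cross e e′ p q r s (Flip-cross φ)
Flip-cross (prev-keep {a} {b} {A} {B} {X} {Y} refl p q r s φ) = keep-cross a b A B X Y
  (Flip-hits a φ p r)
  (trans (hitsʳ-≪ b (≪-weaken b a (a≤a+1 b) p)) (sym (hitsʳ-≪ b (≪-weaken b a (a≤a+1 b) r))))
  (Flip-cross φ)
Flip-cross (prev-move e e′ p q r s φ) = sym (move-cross e e′ r s p q (sym (Flip-cross φ)))

di-dualDyck : ∀ {w} → DualDyck w → di w ≡ 0
di-dualDyck {[]}    _  = refl
di-dualDyck {x ∷ w} w↑ = cong₂ _+_ (hits-≪ x (dualDyck⇒≪ w↑)) (di-dualDyck (dualDyck-tail w↑))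

-- Replacing two adjacent rows

-- What suffices for `di` of the whole factorization: a dual Dyck row has no dual inversions of its
-- own, and those with the remaining rows depend only on the multiset of entries of the two rows
-- together.
record Exchange (A B A′ B′ : List ℤ) : Set where
  field
    ++-↭       : A ++ B ↭ A′ ++ B′
    cross-≡    : cross A B ≡ cross A′ B′
    dualDyck₁  : DualDyck A′
    dualDyck₂  : DualDyck B′

open Exchange

data Moved : Factorization → Factorization → Set where
  here  : ∀ {A B A′ B′ F} → Exchange A B A′ B′ → Moved (A ∷ B ∷ F) (A′ ∷ B′ ∷ F)
  there : ∀ {A F F′} → Moved F F′ → Moved (A ∷ F) (A ∷ F′)

Moved-dualDyck : ∀ {F F′} → Moved F F′ → All DualDyck F → All DualDyck F′
Moved-dualDyck (here e)  (_ ∷ _ ∷ F↑) = dualDyck₁ e ∷ dualDyck₂ e ∷ F↑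
Moved-dualDyck (there μ) (A↑ ∷ F↑)    = A↑ ∷ Moved-dualDyck μ F↑

Moved-↭ : ∀ {F F′} → Moved F F′ → concat F ↭ concat F′
Moved-↭ (here {A} {B} {A′} {B′} {F} e) =
  ↭-trans (↭-reflexive (sym (List.++-assoc A B (concat F))))
    (↭-trans (↭.++⁺ʳ (concat F) (++-↭ e)) (↭-reflexive (List.++-assoc A′ B′ (concat F))))
Moved-↭ (there {A} μ) = ↭.++⁺ˡ A (Moved-↭ μ)

di-++₂ : ∀ {A B} R → DualDyck A → DualDyck B →
         di (A ++ B ++ R) ≡ (di R + cross A B) + cross (A ++ B) R
di-++₂ {A} {B} R A↑ B↑ = begin
  di (A ++ B ++ R)
    ≡⟨ trans (di-++ A (B ++ R)) (cong₂ (λ x y → (di A + x) + y) (di-++ B R) (cross-++ʳ A B R)) ⟩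
  (di A + (di B + di R + cross B R)) + (cross A B + cross A R)
    ≡⟨ cong₂ (λ x y → (x + (y + di R + cross B R)) + (cross A B + cross A R))
             (di-dualDyck A↑) (di-dualDyck B↑) ⟩
  (di R + cross B R) + (cross A B + cross A R)
    ≡⟨ rearrange (di R) (cross B R) (cross A B) (cross A R) ⟩
  (di R + cross A B) + (cross A R + cross B R)
    ≡⟨ cong (_+_ (di R + cross A B)) (cross-++ˡ A B R) ⟨
  (di R + cross A B) + cross (A ++ B) R
    ∎
  where
  open ≡-Reasoning
  rearrange : ∀ r b c a → (r + b) + (c + a) ≡ (r + c) + (a + b)
  rearrange = ℕ-Solver.solve-∀

Moved-di : ∀ {F F′} → Moved F F′ → All DualDyck F → di (concat F) ≡ di (concat F′)
Moved-di (here {A} {B} {A′} {B′} {F} e) (A↑ ∷ B↑ ∷ _) = begin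
  di (A ++ B ++ concat F)
    ≡⟨ di-++₂ (concat F) A↑ B↑ ⟩
  (di (concat F) + cross A B) + cross (A ++ B) (concat F)
    ≡⟨ cong₂ (λ x y → (di (concat F) + x) + y) (cross-≡ e) (cross-↭ˡ (concat F) (++-↭ e)) ⟩
  (di (concat F) + cross A′ B′) + cross (A′ ++ B′) (concat F)
    ≡⟨ di-++₂ (concat F) (dualDyck₁ e) (dualDyck₂ e) ⟨
  di (A′ ++ B′ ++ concat F)
    ∎
  where open ≡-Reasoning
Moved-di (there {A} {F} {F′} μ) (_ ∷ F↑) = begin
  di (A ++ concat F)
    ≡⟨ di-++ A (concat F) ⟩
  (di A + di (concat F)) + cross A (concat F)
    ≡⟨ cong₂ (λ x y → (di A + x) + y) (Moved-di μ F↑) (cross-↭ʳ A (Moved-↭ μ)) ⟩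
  (di A + di (concat F′)) + cross A (concat F′)
    ≡⟨ di-++ A (concat F′) ⟨
  di (A ++ concat F′)
    ∎
  where open ≡-Reasoning

Flip-exchange : ∀ {A B X Y} → Flip A B X Y → Exchange A B X Y
Flip-exchange φ = record
  { ++-↭ = Flip-↭ φ ; cross-≡ = Flip-cross φ
  ; dualDyck₁ = Flip-dualDyck φ ; dualDyck₂ = Flip-dualDyck (Flip-mirror φ) }

-- Flaws

-- Ok c A B: as the lower and the upper of two adjacent rows, A and B satisfy the
-- conditions of a Dyck tableau in the first c columns.
data Ok : ℕ → List ℤ → List ℤ → Set where
  zero : ∀ {A B} → Ok 0 A B
  nil  : ∀ {c B} → Ok (suc c) [] B
  cons : ∀ {c a b A B} → b ℤ.≤ a ℤ.+ 1ℤ → Ok c A B → Ok (suc c) (a ∷ A) (b ∷ B)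

ok? : ∀ c A B → Dec (Ok c A B)
ok? zero    A       B       = yes zero
ok? (suc c) []      B       = yes nil
ok? (suc c) (a ∷ A) []      = no λ ()
ok? (suc c) (a ∷ A) (b ∷ B) with b ℤ.≤? a ℤ.+ 1ℤ | ok? c A B
... | yes p | yes q = yes (cons p q)
... | no ¬p | _     = no λ { (cons p _) → ¬p p }
... | yes _ | no ¬q = no λ { (cons _ q) → ¬q q }

Ok-suc⁻ : ∀ {c A B} → Ok (suc c) A B → Ok c A B
Ok-suc⁻ {zero}  _          = zero
Ok-suc⁻ {suc c} nil        = nil
Ok-suc⁻ {suc c} (cons p q) = cons p (Ok-suc⁻ q)

Ok-take : ∀ c A B A′ B′ → take c A ≡ take c A′ → take c B ≡ take c B′ → Ok c A B → Ok c A′ B′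
Ok-take zero    _       _       _       _       _   _   _    = zero
Ok-take (suc c) []      B       []      B′      _   _   nil  = nil
Ok-take (suc c) []      B       (_ ∷ _) B′      ()
Ok-take (suc c) (_ ∷ _) (_ ∷ _) []      B′      ()
Ok-take (suc c) (_ ∷ _) (_ ∷ _) (_ ∷ _) []      _   ()
Ok-take (suc c) (a ∷ A) (b ∷ B) (_ ∷ A′) (_ ∷ B′) eq₁ eq₂ (cons p q)
  with refl ← List.∷-injectiveˡ eq₁ | refl ← List.∷-injectiveˡ eq₂ =
  cons p (Ok-take c A B A′ B′ (List.∷-injectiveʳ eq₁) (List.∷-injectiveʳ eq₂) q)

-- The lower row keeps its entry in the flawed column `c`, the upper row does not. As `flip` swaps
-- the lengths of the tails, this off-by-one turns row lengths (x, y) into (y + 1, x - 1).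
tailFlip : ℕ → List ℤ → List ℤ → List ℤ × List ℤ
tailFlip c A B = let X , Y = flip (drop (suc c) A) (drop c B) in take (suc c) A ++ X , take c B ++ Y

-- U′ ++ V′ and U ++ V are the lower and the upper row, with their first flaw in column c.
-- The gaps allow any redistribution of the entries of V′ and V.
record Split (c : ℕ) (U′ U V′ V : List ℤ) : Set where
  field
    length₁ : length U′ ≡ suc c
    length₂ : length U ≡ c
    gap₁ : All (_≪ V′) U′
    gap₂ : All (_≪ V) U′
    gap₃ : All (_≪ V′) U
    gap₄ : All (_≪ V) U

open Split

≰+1⇒gap : ∀ {a b} → ¬ (b ℤ.≤ a ℤ.+ 1ℤ) → a ℤ.+ + 2 ℤ.≤ b
≰+1⇒gap {a} ¬le = subst (ℤ._≤ _) (1+[a+1] a) (ℤ.i<j⇒suc[i]≤j (ℤ.≰⇒> ¬le))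
  where
  1+[a+1] : ∀ a → + 1 ℤ.+ (a ℤ.+ + 1) ≡ a ℤ.+ + 2
  1+[a+1] = solve-∀

-- The flaw itself gives `gap₂`: the upper row has ended, or its entry in column `c` exceeds the
-- lower one by at least 2. For `gap₃`, an upper entry before column `c` is at most one more than
-- the entry under it, hence less than the next entry of the lower row.
flaw-split : ∀ c {A B} → DualDyck A → DualDyck B → Ok c A B → ¬ Ok (suc c) A B →
             Split c (take (suc c) A) (take c B) (drop (suc c) A) (drop c B)
flaw-split c       {[]}    {_}     _  _  _          ¬ok = ⊥-elim (¬ok nil)
flaw-split zero    {a ∷ A} {[]}    A↑ _  _          ¬ok = record
  { length₁ = refl ; length₂ = refl
  ; gap₁ = dualDyck⇒≪ A↑ ∷ [] ; gap₂ = [] ∷ [] ; gap₃ = [] ; gap₄ = [] }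
flaw-split zero    {a ∷ A} {b ∷ B} A↑ B↑ _          ¬ok = record
  { length₁ = refl ; length₂ = refl
  ; gap₁ = dualDyck⇒≪ A↑ ∷ [] ; gap₂ = (gap ∷ ≪-trans a gap (dualDyck⇒≪ B↑)) ∷ []
  ; gap₃ = [] ; gap₄ = [] }
  where gap = ≰+1⇒gap {a} (λ le → ¬ok (cons le zero))
flaw-split (suc c) {a ∷ A} {b ∷ B} A↑ B↑ (cons p q) ¬ok = record
  { length₁ = cong suc (length₁ sp) ; length₂ = cong suc (length₂ sp)
  ; gap₁ = All.drop⁺ (suc c) a≪A ∷ gap₁ sp
  ; gap₂ = a≪V ∷ gap₂ sp
  ; gap₃ = b≪V′ ∷ gap₃ sp
  ; gap₄ = All.drop⁺ c (dualDyck⇒≪ B↑) ∷ gap₄ sp }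
  where
  sp = flaw-split c (dualDyck-tail A↑) (dualDyck-tail B↑) q (λ ok → ¬ok (cons p ok))
  a≪A = dualDyck⇒≪ A↑
  first : ∀ {V} → All (_≪ V) (take (suc c) A) → length (take (suc c) A) ≡ suc c →
          ∃ λ u → a ℤ.+ + 2 ℤ.≤ u × u ≪ V
  first gaps len with take (suc c) A | All.take⁺ (suc c) a≪A
  first (g ∷ _) len | u ∷ _ | p ∷ _ = u , p , g
  a≪V : a ≪ drop c B
  a≪V = let u , p , g = first (gap₂ sp) (length₁ sp) in ≪-trans a p g
  b≪V′ : b ≪ drop (suc c) A
  b≪V′ = let u , r , g = first (gap₁ sp) (length₁ sp) in
         ≪-weaken b u (ℤ.≤-trans p (ℤ.≤-trans (ℤ.+-monoʳ-≤ a (ℤ.+≤+ (s≤s z≤n))) r)) g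

dualDyck-++ : ∀ {u w} → DualDyck u → DualDyck w → All (_≪ w) u → DualDyck (u ++ w)
dualDyck-++ {[]}    _  w↑ _         = w↑
dualDyck-++ {x ∷ u} u↑ w↑ (g ∷ gs) =
  dualDyck-∷ (All.++⁺ (dualDyck⇒≪ u↑) g) (dualDyck-++ (dualDyck-tail u↑) w↑ gs)

dualDyck-take : ∀ c {w} → DualDyck w → DualDyck (take c w)
dualDyck-take zero    _           = []
dualDyck-take (suc c) {[]}    _  = []
dualDyck-take (suc c) {x ∷ w} w↑ =
  dualDyck-∷ (All.take⁺ c (dualDyck⇒≪ w↑)) (dualDyck-take c (dualDyck-tail w↑))

dualDyck-drop : ∀ c {w} → DualDyck w → DualDyck (drop c w)
dualDyck-drop zero    w↑          = w↑
dualDyck-drop (suc c) {[]}    _  = []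
dualDyck-drop (suc c) {x ∷ w} w↑ = dualDyck-drop c (dualDyck-tail w↑)

cross-split : ∀ {c} U′ U V′ V → Split c U′ U V′ V →
              cross (U′ ++ V′) (U ++ V) ≡ cross U′ U + cross V′ V
cross-split U′ U V′ V sp = begin
  cross (U′ ++ V′) (U ++ V)
    ≡⟨ trans (cross-++ˡ U′ V′ (U ++ V)) (cong₂ _+_ (cross-++ʳ U′ U V) (cross-++ʳ V′ U V)) ⟩
  (cross U′ U + cross U′ V) + (cross V′ U + cross V′ V)
    ≡⟨ cong₂ (λ x y → (cross U′ U + x) + (y + cross V′ V))
             (cross-none (All.map (λ {u} → All.map (gap⇒≢+1 u)) (gap₂ sp)))
             (cross-none (All.All-swap (All.map (λ {u} → All.map (gap⇒≢+1′ u)) (gap₃ sp)))) ⟩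
  (cross U′ U + 0) + cross V′ V
    ≡⟨ cong (_+ cross V′ V) (ℕ.+-identityʳ (cross U′ U)) ⟩
  cross U′ U + cross V′ V
    ∎
  where open ≡-Reasoning

++-↭-interchange : ∀ (U′ V′ U V : List ℤ) → (U′ ++ V′) ++ (U ++ V) ↭ (U′ ++ U) ++ (V′ ++ V)
++-↭-interchange U′ V′ U V =
  ↭-trans (↭-reflexive (List.++-assoc U′ V′ (U ++ V)))
    (↭-trans (↭.++⁺ˡ U′ (↭.shifts V′ U)) (↭-reflexive (sym (List.++-assoc U′ U (V′ ++ V)))))

module _ {c U′ U V′ V X Y} (sp : Split c U′ U V′ V) (φ : Flip V′ V X Y) where

  Split-flip : Split c U′ U X Y
  Split-flip = record
    { length₁ = length₁ sp ; length₂ = length₂ sp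
    ; gap₁ = All.map proj₁ gaps₁ ; gap₂ = All.map proj₂ gaps₁
    ; gap₃ = All.map proj₁ gaps₂ ; gap₄ = All.map proj₂ gaps₂ }
    where
    gaps₁ = All.zipWith (λ (g , h) → Flip-All φ g h) (gap₁ sp , gap₂ sp)
    gaps₂ = All.zipWith (λ (g , h) → Flip-All φ g h) (gap₃ sp , gap₄ sp)

  split-exchange : DualDyck U′ → DualDyck U → Exchange (U′ ++ V′) (U ++ V) (U′ ++ X) (U ++ Y)
  split-exchange U′↑ U↑ = record
    { ++-↭ = ↭-trans (++-↭-interchange U′ V′ U V)
        (↭-trans (↭.++⁺ˡ (U′ ++ U) (Flip-↭ φ)) (↭-sym (++-↭-interchange U′ X U Y)))
    ; cross-≡ = trans (cross-split U′ U V′ V sp)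
        (trans (cong (_+_ (cross U′ U)) (Flip-cross φ)) (sym (cross-split U′ U X Y Split-flip)))
    ; dualDyck₁ = dualDyck-++ U′↑ (Flip-dualDyck φ) (gap₁ Split-flip)
    ; dualDyck₂ = dualDyck-++ U↑ (Flip-dualDyck (Flip-mirror φ)) (gap₄ Split-flip) }

-- The lower entry in column `c` is kept, and the upper row continues there with `Y`, whose entries
-- all exceed it by at least 2; an empty `Y` leaves the upper row too short.
flawed : ∀ c U′ U X Y → length U′ ≡ suc c → length U ≡ c → All (_≪ Y) U′ → ¬ Ok (suc c) (U′ ++ X) (U ++ Y)
flawed zero    (a ∷ [])  []      X (y ∷ Y) _   _    ((g ∷ _) ∷ []) (cons le _) =
  bad (a+m≤a+n⁻ a (ℤ.≤-trans g le))
  where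
  bad : ¬ (2 ≤ 1)
  bad (s≤s ())
flawed (suc c) (a ∷ U′) (b ∷ U) X Y       eq₁ eq₂ (_ ∷ gs)         (cons _ ok) =
  flawed c U′ U X Y (ℕ.suc-injective eq₁) (ℕ.suc-injective eq₂) gs ok

take-length-++ : ∀ (u : List ℤ) {n w} → length u ≡ n → take n (u ++ w) ≡ u
take-length-++ []      refl = refl
take-length-++ (x ∷ u) refl = cong (x ∷_) (take-length-++ u refl)

drop-length-++ : ∀ (u : List ℤ) {n w} → length u ≡ n → drop n (u ++ w) ≡ w
drop-length-++ []      refl = refl
drop-length-++ (x ∷ u) refl = drop-length-++ u refl

take-suc⁻ : ∀ c (u w : List ℤ) → take (suc c) u ≡ take (suc c) w → take c u ≡ take c w
take-suc⁻ zero    u       w       eq = refl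
take-suc⁻ (suc c) []      []      eq = refl
take-suc⁻ (suc c) (x ∷ u) (y ∷ w) eq =
  cong₂ _∷_ (List.∷-injectiveˡ eq) (take-suc⁻ c u w (List.∷-injectiveʳ eq))

module TailFlip (c : ℕ) (A B : List ℤ) (A↑ : DualDyck A) (B↑ : DualDyck B)
                (ok : Ok c A B) (¬ok : ¬ Ok (suc c) A B) where

  private
    V′ V X Y : List ℤ
    V′ = drop (suc c) A
    V  = drop c B
    X  = proj₁ (flip V′ V)
    Y  = proj₂ (flip V′ V)
    sp : Split c (take (suc c) A) (take c B) V′ V
    sp = flaw-split c A↑ B↑ ok ¬ok
    φ : Flip V′ V X Y
    φ = Flip-flip V′ V (dualDyck-drop (suc c) A↑) (dualDyck-drop c B↑)

  A⁺ B⁺ : List ℤ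
  A⁺ = proj₁ (tailFlip c A B)
  B⁺ = proj₂ (tailFlip c A B)

  exchange : Exchange A B A⁺ B⁺
  exchange = subst₂ (λ A₀ B₀ → Exchange A₀ B₀ A⁺ B⁺) (List.take++drop≡id (suc c) A) (List.take++drop≡id c B)
    (split-exchange sp φ (dualDyck-take (suc c) A↑) (dualDyck-take c B↑))

  take₁ : take (suc c) A⁺ ≡ take (suc c) A
  take₁ = take-length-++ (take (suc c) A) (length₁ sp)

  take₂ : take c B⁺ ≡ take c B
  take₂ = take-length-++ (take c B) (length₂ sp)

  ok⁺ : Ok c A⁺ B⁺
  ok⁺ = Ok-take c A B A⁺ B⁺ (take-suc⁻ c A A⁺ (sym take₁)) (sym take₂) ok

  ¬ok⁺ : ¬ Ok (suc c) A⁺ B⁺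
  ¬ok⁺ = flawed c (take (suc c) A) (take c B) X Y (length₁ sp) (length₂ sp) (gap₂ (Split-flip sp φ))

  involutive : tailFlip c A⁺ B⁺ ≡ (A , B)
  involutive = begin
    tailFlip c A⁺ B⁺
      ≡⟨ cong₂ (λ x y → let X′ , Y′ = flip x y in take (suc c) A⁺ ++ X′ , take c B⁺ ++ Y′)
               (drop-length-++ (take (suc c) A) (length₁ sp)) (drop-length-++ (take c B) (length₂ sp)) ⟩
    (let X′ , Y′ = flip X Y in take (suc c) A⁺ ++ X′ , take c B⁺ ++ Y′)
      ≡⟨ cong (λ (X′ , Y′) → take (suc c) A⁺ ++ X′ , take c B⁺ ++ Y′) (Flip-unique (Flip-sym φ)) ⟩
    (take (suc c) A⁺ ++ V′ , take c B⁺ ++ V)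
      ≡⟨ cong₂ _,_ (trans (cong (_++ V′) take₁) (List.take++drop≡id (suc c) A))
                   (trans (cong (_++ V) take₂) (List.take++drop≡id c B)) ⟩
    (A , B)
      ∎
    where open ≡-Reasoning

  private
    length-take-drop : ∀ n (w : List ℤ) → length w ≡ length (take n w) + length (drop n w)
    length-take-drop n w =
      trans (cong length (sym (List.take++drop≡id n w))) (List.length-++ (take n w))

  length-A⁺ : length A⁺ ≡ suc (length B)
  length-A⁺ = begin
    length A⁺                     ≡⟨ List.length-++ (take (suc c) A) ⟩
    length (take (suc c) A) + length X ≡⟨ cong₂ _+_ (length₁ sp) (Flip-length φ) ⟩
    suc c + length V              ≡⟨ cong (λ n → suc (n + length V)) (length₂ sp) ⟨
    suc (length (take c B) + length V) ≡⟨ cong suc (length-take-drop c B) ⟨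
    suc (length B)                ∎
    where open ≡-Reasoning

  length-B⁺ : suc (length B⁺) ≡ length A
  length-B⁺ = begin
    suc (length B⁺)               ≡⟨ cong suc (List.length-++ (take c B)) ⟩
    suc (length (take c B) + length Y) ≡⟨ cong₂ (λ x y → suc (x + y)) (length₂ sp) (Flip-length (Flip-mirror φ)) ⟩
    suc c + length V′             ≡⟨ cong (_+ length V′) (length₁ sp) ⟨
    length (take (suc c) A) + length V′ ≡⟨ length-take-drop (suc c) A ⟨
    length A                      ∎
    where open ≡-Reasoning

-- The search for the first flaw

at : ℕ → (List ℤ → List ℤ → List ℤ × List ℤ) → Factorization → Factorization
at zero    op (A ∷ B ∷ F) = let A′ , B′ = op A B in A′ ∷ B′ ∷ F
at zero    op F           = F
at (suc i) op (A ∷ F)     = A ∷ at i op F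
at (suc i) op []          = []

-- Clean i c F: in the order of Gasharov's search for a flaw, column by column and
-- from the bottom row upwards, there is no flaw before rows i and i + 1 in column c.
Clean : ℕ → ℕ → Factorization → Set
Clean i       c []          = ⊤
Clean i       c (A ∷ [])    = ⊤
Clean zero    c (A ∷ B ∷ F) = Ok c A B × Clean zero c (B ∷ F)
Clean (suc i) c (A ∷ B ∷ F) = Ok (suc c) A B × Clean i c (B ∷ F)

clean? : ∀ i c F → Dec (Clean i c F)
clean? i       c []          = yes tt
clean? i       c (A ∷ [])    = yes tt
clean? zero    c (A ∷ B ∷ F) = ok? c A B ×-dec clean? zero c (B ∷ F)
clean? (suc i) c (A ∷ B ∷ F) = ok? (suc c) A B ×-dec clean? i c (B ∷ F)

Clean-suc⁻ : ∀ i c F → Clean (suc i) c F → Clean i c F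
Clean-suc⁻ i       c []          _       = tt
Clean-suc⁻ i       c (A ∷ [])    _       = tt
Clean-suc⁻ zero    c (A ∷ B ∷ F) (p , q) = Ok-suc⁻ p , q
Clean-suc⁻ (suc i) c (A ∷ B ∷ F) (p , q) = p , Clean-suc⁻ i c (B ∷ F) q

-- When no pair of rows is left to test in column `c`, the search resumes at the bottom of the next
-- column.
Clean-next : ∀ i c F → length F ≤ suc i → Clean i c F → Clean 0 (suc c) F
Clean-next i       c []          _        _       = tt
Clean-next i       c (A ∷ [])    _        _       = tt
Clean-next (suc i) c (A ∷ B ∷ F) (s≤s le) (p , q) = p , Clean-next i c (B ∷ F) le q
Clean-next zero    c (A ∷ B ∷ F) (s≤s ())

Clean-next⁻ : ∀ i c F → length F ≤ suc i → Clean 0 (suc c) F → Clean i c F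
Clean-next⁻ i       c []          _        _       = tt
Clean-next⁻ i       c (A ∷ [])    _        _       = tt
Clean-next⁻ (suc i) c (A ∷ B ∷ F) (s≤s le) (p , q) = p , Clean-next⁻ i c (B ∷ F) le q
Clean-next⁻ zero    c (A ∷ B ∷ F) (s≤s ())

data FirstFlaw (c : ℕ) : ℕ → Factorization → Set where
  here  : ∀ {A B F} → Ok c A B → ¬ Ok (suc c) A B → Clean 0 c (B ∷ F) → FirstFlaw c 0 (A ∷ B ∷ F)
  there : ∀ {i A B F} → Ok (suc c) A B → FirstFlaw c i (B ∷ F) → FirstFlaw c (suc i) (A ∷ B ∷ F)

Clean⇒FirstFlaw : ∀ i c F → Clean i c F → ¬ Clean (suc i) c F → FirstFlaw c i F
Clean⇒FirstFlaw i       c []          _       ¬r = ⊥-elim (¬r tt)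
Clean⇒FirstFlaw i       c (A ∷ [])    _       ¬r = ⊥-elim (¬r tt)
Clean⇒FirstFlaw zero    c (A ∷ B ∷ F) (p , q) ¬r = here p (λ p′ → ¬r (p′ , q)) q
Clean⇒FirstFlaw (suc i) c (A ∷ B ∷ F) (p , q) ¬r =
  there p (Clean⇒FirstFlaw i c (B ∷ F) q (λ q′ → ¬r (p , q′)))

FirstFlaw⇒Clean : ∀ {i c F} → FirstFlaw c i F → Clean i c F × ¬ Clean (suc i) c F
FirstFlaw⇒Clean (here p ¬p q) = (p , q) , λ (p′ , _) → ¬p p′
FirstFlaw⇒Clean (there p ff)  = let q , ¬q = FirstFlaw⇒Clean ff in (p , q) , λ (_ , q′) → ¬q q′

Clean-take : ∀ c B B′ F → take c B ≡ take c B′ → Clean 0 c (B ∷ F) → Clean 0 c (B′ ∷ F)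
Clean-take c B B′ []      eq _       = tt
Clean-take c B B′ (D ∷ F) eq (p , q) = Ok-take c B D B′ D eq refl p , q

-- The order of the search is chosen for this. The pair below shares the row that is kept up to and
-- including column `c`, and it has been tested just so far; the pair above shares the row that is
-- kept before column `c`, and it has been tested only there.
FirstFlaw-at : ∀ {i c F} → All DualDyck F → FirstFlaw c i F → FirstFlaw c i (at i (tailFlip c) F)
FirstFlaw-at {c = c} (A↑ ∷ B↑ ∷ F↑) (here {A} {B} {F} p ¬p q) =
  here ok⁺ ¬ok⁺ (Clean-take c B B⁺ F (sym take₂) q)
  where open TailFlip c A B A↑ B↑ p ¬p
FirstFlaw-at {c = c} (A↑ ∷ B↑ ∷ D↑ ∷ F↑) (there {A = A} {B} p ff@(here {A = B} {D} p′ ¬p′ q)) =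
  there (Ok-take (suc c) A B A B⁺ refl (sym take₁) p) (FirstFlaw-at (B↑ ∷ D↑ ∷ F↑) ff)
  where open TailFlip c B D B↑ D↑ p′ ¬p′ renaming (A⁺ to B⁺; B⁺ to D⁺)
FirstFlaw-at (A↑ ∷ F↑) (there p ff@(there _ _)) = there p (FirstFlaw-at F↑ ff)

FirstFlaw-moved : ∀ {i c F} → All DualDyck F → FirstFlaw c i F → Moved F (at i (tailFlip c) F)
FirstFlaw-moved {c = c} (A↑ ∷ B↑ ∷ F↑) (here {A} {B} p ¬p q) = here (TailFlip.exchange c A B A↑ B↑ p ¬p)
FirstFlaw-moved (_ ∷ F↑) (there _ ff)                       = there (FirstFlaw-moved F↑ ff)

FirstFlaw-involutive : ∀ {i c F} → All DualDyck F → FirstFlaw c i F →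
                       at i (tailFlip c) (at i (tailFlip c) F) ≡ F
FirstFlaw-involutive {c = c} (A↑ ∷ B↑ ∷ F↑) (here {A} {B} {F} p ¬p q) =
  cong (λ (A′ , B′) → A′ ∷ B′ ∷ F) (TailFlip.involutive c A B A↑ B↑ p ¬p)
FirstFlaw-involutive (_ ∷ F↑) (there {A = A} _ ff) = cong (A ∷_) (FirstFlaw-involutive F↑ ff)

-- Counting by bijections

length-injection : (φ : A → B) (ψ : B → A) → ∀ {xs} ys → Unique xs →
                   (∀ {x} → x ∈ xs → φ x ∈ ys × ψ (φ x) ≡ x) → length xs ≤ length ys
length-injection φ ψ {[]}     ys _          _    = z≤n
length-injection φ ψ {x ∷ xs} ys (x∉ ∷ xs!) into with ∈.∈-∃++ (proj₁ (into (here refl)))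
... | ys₁ , ys₂ , refl = subst (suc (length xs) ≤_) (sym len)
  (s≤s (length-injection φ ψ (ys₁ ++ ys₂) xs! λ x′∈ → avoid x′∈ , proj₂ (into (there x′∈))))
  where
  len : length (ys₁ ++ φ x ∷ ys₂) ≡ suc (length (ys₁ ++ ys₂))
  len = ↭.↭-length (↭.shift (φ x) ys₁ ys₂)
  avoid : ∀ {x′} → x′ ∈ xs → φ x′ ∈ ys₁ ++ ys₂
  avoid {x′} x′∈ with ↭.∈-resp-↭ (↭.shift (φ x) ys₁ ys₂) (proj₁ (into (there x′∈)))
  ... | there ∈ys = ∈ys
  ... | here eq   = ⊥-elim (All.lookup x∉ x′∈
    (trans (sym (proj₂ (into (here refl)))) (trans (cong ψ (sym eq)) (proj₂ (into (there x′∈))))))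

length-bijection : (φ : A → B) (ψ : B → A) → ∀ {xs ys} → Unique xs → Unique ys →
                   (∀ {x} → x ∈ xs → φ x ∈ ys × ψ (φ x) ≡ x) →
                   (∀ {y} → y ∈ ys → ψ y ∈ xs × φ (ψ y) ≡ y) → length xs ≡ length ys
length-bijection φ ψ xs! ys! into onto =
  ℕ.≤-antisym (length-injection φ ψ _ xs! into) (length-injection ψ φ _ ys! onto)

length-filter-split : {P Q : Pred A 0ℓ} (P? : Decidable P) (Q? : Decidable Q) →
  (∀ x → Q x → P x) → ∀ xs →
  length (filter P? xs) ≡ length (filter Q? xs) + length (filter (λ x → P? x ×-dec ¬? (Q? x)) xs)
length-filter-split P? Q? Q⇒P []       = refl
length-filter-split P? Q? Q⇒P (x ∷ xs) with P? x | Q? x | length-filter-split P? Q? Q⇒P xs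
... | yes _ | yes _ | eq = cong suc eq
... | yes _ | no _  | eq = trans (cong suc eq) (sym (ℕ.+-suc _ _))
... | no ¬p | yes q | _  = ⊥-elim (¬p (Q⇒P x q))
... | no _  | no _  | eq = eq

-- Vanishing determinants and the diagonal term

lengths : Factorization → List ℤ
lengths = map (λ w → + length w)

-- Invariance under the dot action of an adjacent transposition. For staircase columns j and j + 1
-- it relates the arguments x - j, y - (j + 1) to y - j, x - (j + 1), so the terms of the
-- determinant cancel in pairs.
DotSymmetric : ℕ → (List ℤ → ℤ) → Set
DotSymmetric i f = ∀ pre x y post → length pre ≡ i →
                   f (pre ++ x ∷ y ∷ post) ≡ f (pre ++ ℤ.suc y ∷ ℤ.pred x ∷ post)

det-dotSymmetric : ∀ i j m f l → suc (suc i) ≤ m → DotSymmetric i f → det (ramp j m) f l ≡ 0ℤ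
det-dotSymmetric zero    j (suc zero)    f l (s≤s ()) f-dot
det-dotSymmetric zero    j (suc (suc m)) f l _        f-dot = ≡-neg⇒≡0
  (trans (alt-swap (λ x y → det (ramp (2 + j) m) (λ zs → f (x ⊖ j ∷ y ⊖ suc j ∷ zs))) l)
    (cong ℤ.-_ (alt-cong (λ x → alt-cong (λ y → det-cong (λ zs → sym (swapped x y zs)) (ramp (2 + j) m))) l)))
  where
  suc-⊖ : ∀ y → ℤ.suc (y ⊖ suc j) ≡ y ⊖ j
  suc-⊖ y = begin
    ℤ.suc (y ⊖ suc j)          ≡⟨ cong ℤ.suc (ℤ.m-n≡m⊖n y (suc j)) ⟨
    ℤ.suc (+ y ℤ.- + suc j)    ≡⟨ lemma (+ y) (+ j) ⟩
    + y ℤ.- + j                ≡⟨ ℤ.m-n≡m⊖n y j ⟩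
    y ⊖ j                      ∎
    where
    open ≡-Reasoning
    lemma : ∀ y j → + 1 ℤ.+ (y ℤ.- (+ 1 ℤ.+ j)) ≡ y ℤ.- j
    lemma = solve-∀
  swapped : ∀ x y zs → f (x ⊖ j ∷ y ⊖ suc j ∷ zs) ≡ f (y ⊖ j ∷ x ⊖ suc j ∷ zs)
  swapped x y zs = trans (f-dot [] (x ⊖ j) (y ⊖ suc j) zs refl)
    (cong₂ (λ u v → f (u ∷ v ∷ zs)) (suc-⊖ y)
      (trans (cong ℤ.pred (sym (suc-⊖ x))) (ℤ.pred-suc (x ⊖ suc j))))
det-dotSymmetric (suc i) j (suc m)       f l (s≤s le) f-dot =
  alt-zero (λ y l′ → det-dotSymmetric i (suc j) m _ l′ le
    (λ pre x z post len → f-dot (y ⊖ j ∷ pre) x z post (cong suc len))) l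

det-length : ∀ {f g} → ∀ v l → (∀ zs → length zs ≡ length v → f zs ≡ g zs) → det v f l ≡ det v g l
det-length []      []      eq = eq [] refl
det-length []      (_ ∷ _) eq = refl
det-length (w ∷ v) l       eq =
  alt-cong (λ y l′ → det-length v l′ (λ zs len → eq (y ⊖ w ∷ zs) (cong suc len))) l

length-ramp : ∀ j m → length (ramp j m) ≡ m
length-ramp j zero    = refl
length-ramp j (suc m) = cong suc (length-ramp (suc j) m)

alt-zero-All : ∀ {P : ℕ → Set} {θ} {l} → All P l → (∀ y l → P y → θ y l ≡ 0ℤ) → alt θ l ≡ 0ℤ
alt-zero-All         []        eq = refl
alt-zero-All {l = x ∷ l} (px ∷ pl) eq =
  cong₂ ℤ._-_ (eq x l px) (alt-zero-All pl (λ y l′ → eq y (x ∷ l′)))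

alt-zero-∈ : ∀ {x θ} l → x ∈ l → (∀ y l → y ≡ x ⊎ x ∈ l → θ y l ≡ 0ℤ) → alt θ l ≡ 0ℤ
alt-zero-∈ (y ∷ l) (here refl) eq = cong₂ ℤ._-_ (eq y l (inj₁ refl))
  (alt-zero (λ z l′ → eq z (y ∷ l′) (inj₂ (here refl))) l)
alt-zero-∈ {x} (y ∷ l) (there x∈) eq = cong₂ ℤ._-_ (eq y l (inj₂ x∈))
  (alt-zero-∈ l x∈ (λ z l′ → λ { (inj₁ e) → eq z (y ∷ l′) (inj₁ e)
                               ; (inj₂ m) → eq z (y ∷ l′) (inj₂ (there m)) }))

⊖-≤ : ∀ x j w → j ≤ w → (x + j) ⊖ w ℤ.≤ + x
⊖-≤ x j w j≤w = ℤ.≤-trans (ℤ.⊖-monoʳ-≥-≤ (x + j) j≤w) (ℤ.≤-reflexive (c+r⊖r x j))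

-- Whichever column w >= j the entry `x + j` is assigned to, the resulting argument is at most x.
det-small : ∀ x j v g l → All (j ≤_) v → x + j ∈ l → (∀ zs → Any (ℤ._≤ + x) zs → g zs ≡ 0ℤ) →
            det v g l ≡ 0ℤ
det-small x j []      g (_ ∷ _) _            _  _  = refl
det-small x j (w ∷ v) g l       (j≤w ∷ j≤v) x∈ g0 = alt-zero-∈ l x∈ λ
  { y l′ (inj₁ refl) → det-zero (λ zs → g0 _ (here (⊖-≤ x j w j≤w))) v l′
  ; y l′ (inj₂ x∈l′)   → det-small x j v _ l′ j≤v x∈l′ (λ zs z≤x → g0 _ (there z≤x)) }

ramp-≥ : ∀ i j m → i ≤ j → All (i ≤_) (ramp j m)
ramp-≥ i j zero    _   = []
ramp-≥ i j (suc m) i≤j = i≤j ∷ ramp-≥ i (suc j) m (ℕ.m≤n⇒m≤1+n i≤j)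

hat-≥ : ∀ x j l → IncreasingFrom x l → All (x + j ≤_) (hat j l)
hat-≥ x j []      _           = []
hat-≥ x j (y ∷ l) (x≤y , l↑) =
  ℕ.+-monoˡ-≤ j x≤y ∷ All.map (ℕ.≤-trans (ℕ.+-mono-≤ x≤y (ℕ.n≤1+n j))) (hat-≥ y (suc j) l l↑)

-- Only the identity permutation keeps the strictly increasing sequence hat j l
-- increasing.
det-hat : ∀ f → (∀ zs → ¬ Linked ℤ._≤_ zs → f zs ≡ 0ℤ) → ∀ lo j l → IncreasingFrom lo l →
          det (ramp j (length l)) f (hat j l) ≡ f (map +_ l)
det-hat f f0 lo j []      _          = refl
det-hat f f0 lo j (x ∷ l) (lo≤x , l↑) = begin
  det (ramp (suc j) (length l)) (λ zs → f ((x + j) ⊖ j ∷ zs)) (hat (suc j) l) ℤ.-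
  alt (λ y l′ → det (ramp (suc j) (length l)) (λ zs → f (y ⊖ j ∷ zs)) (x + j ∷ l′)) (hat (suc j) l)
    ≡⟨ cong₂ ℤ._-_ (det-cong (λ zs → cong (λ z → f (z ∷ zs)) (c+r⊖r x j))
                             (ramp (suc j) (length l)) (hat (suc j) l))
                   (alt-zero-All (hat-≥ x (suc j) l l↑) misplaced) ⟩
  det (ramp (suc j) (length l)) (λ zs → f (+ x ∷ zs)) (hat (suc j) l) ℤ.- 0ℤ
    ≡⟨ ℤ.+-identityʳ _ ⟩
  det (ramp (suc j) (length l)) (λ zs → f (+ x ∷ zs)) (hat (suc j) l)
    ≡⟨ det-hat (λ zs → f (+ x ∷ zs)) (λ zs ¬↑ → f0 _ (λ ↑ → ¬↑ (Linked.tail ↑))) x (suc j) l l↑ ⟩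
  f (+ x ∷ map +_ l)
    ∎
  where
  open ≡-Reasoning
  -- If the first column does not take `x + j`, its argument y - j exceeds x, whereas `x + j` yields
  -- a later argument at most x: a descent.
  misplaced : ∀ y l′ → x + suc j ≤ y →
    det (ramp (suc j) (length l)) (λ zs → f (y ⊖ j ∷ zs)) (x + j ∷ l′) ≡ 0ℤ
  misplaced y l′ le = det-small x j (ramp (suc j) (length l)) _ (x + j ∷ l′)
    (ramp-≥ j (suc j) (length l) (ℕ.n≤1+n j)) (here refl)
    (λ zs z≤x → f0 _ (λ ↑ → descent zs z≤x ↑))
    where
    x<y⊖j : + x ℤ.< y ⊖ j
    x<y⊖j = ℤ.<-≤-trans (ℤ.+<+ (ℕ.n<1+n x))
      (ℤ.≤-trans (ℤ.≤-reflexive (sym (c+r⊖r (suc x) j)))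
                 (ℤ.⊖-monoˡ-≤ j (ℕ.≤-trans (ℕ.≤-reflexive (sym (ℕ.+-suc x j))) le)))
    descent : ∀ zs → Any (ℤ._≤ + x) zs → Linked ℤ._≤_ (y ⊖ j ∷ zs) → ⊥
    descent (z ∷ zs) z≤x (le ∷ ↑) with All.lookupAny (Linked.Linked⇒All ℤ.≤-trans le ↑) z≤x
    ... | y≤z , z≤x′ = ℤ.<-irrefl refl (ℤ.<-≤-trans x<y⊖j (ℤ.≤-trans y≤z z≤x′))

symmetric-↭ : ∀ f → Symmetric f → ∀ {u w} → u ↭ w → ∀ pre → f (pre ++ u) ≡ f (pre ++ w)
symmetric-↭ f f-sym _↭_.refl _ = refl
symmetric-↭ f f-sym (prep {u} {w} x σ) pre =
  trans (cong f (sym (List.++-assoc pre [ x ] u)))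
    (trans (symmetric-↭ f f-sym σ (pre ++ [ x ])) (cong f (List.++-assoc pre [ x ] w)))
symmetric-↭ f f-sym (swap {u} {w} x y σ) pre =
  trans (f-sym pre x y u) (trans (cong f (sym (List.++-assoc pre (y ∷ x ∷ []) u)))
    (trans (symmetric-↭ f f-sym σ (pre ++ y ∷ x ∷ [])) (cong f (List.++-assoc pre (y ∷ x ∷ []) w))))
symmetric-↭ f f-sym (_↭_.trans σ τ) pre = trans (symmetric-↭ f f-sym σ pre) (symmetric-↭ f f-sym τ pre)

-- Tableau conditions between adjacent rows

-- Joins the condition on row lengths to the one on columns, without the column bound of `Ok`. It
-- serves Dyck tableaux and semistandard tableaux alike.
data Below {A : Set} (R : A → A → Set) : List A → List A → Set where
  []  : ∀ {v} → Below R [] v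
  _∷_ : ∀ {x y u v} → R x y → Below R u v → Below R (x ∷ u) (y ∷ v)

Below-length : ∀ {R : A → A → Set} {u v} → Below R u v → length u ≤ length v
Below-length []      = z≤n
Below-length (_ ∷ b) = s≤s (Below-length b)

AtMostOneAbove : ℤ → ℤ → Set
AtMostOneAbove x y = y ℤ.≤ x ℤ.+ 1ℤ

Ok⇒Below : ∀ {n u v} → length u ≤ n → Ok n u v → Below AtMostOneAbove u v
Ok⇒Below {u = []}    _        _          = []
Ok⇒Below {u = _ ∷ _} (s≤s le) (cons p q) = p ∷ Ok⇒Below le q

Below⇒Ok : ∀ {u v} n → Below AtMostOneAbove u v → Ok n u v
Below⇒Ok zero    _       = zero
Below⇒Ok (suc n) []      = nil
Below⇒Ok (suc n) (p ∷ b) = cons p (Below⇒Ok n b)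

Clean⇒Linked : ∀ {n F} → All (λ w → length w ≤ n) F → Clean 0 n F → Linked (Below AtMostOneAbove) F
Clean⇒Linked {F = []}        _        _       = []
Clean⇒Linked {F = A ∷ []}    _        _       = [-]
Clean⇒Linked {F = A ∷ B ∷ F} (p ∷ ps) (q , r) = Ok⇒Below p q ∷ Clean⇒Linked ps r

Linked⇒Clean : ∀ {F} n → Linked (Below AtMostOneAbove) F → Clean 0 n F
Linked⇒Clean n []      = tt
Linked⇒Clean n [-]     = tt
Linked⇒Clean n (b ∷ l) = Below⇒Ok n b , Linked⇒Clean n l

lengths-linked : ∀ {F} → Linked (Below AtMostOneAbove) F → Linked ℤ._≤_ (lengths F)
lengths-linked []      = []
lengths-linked [-]     = [-]
lengths-linked (b ∷ l) = ℤ.+≤+ (Below-length b) ∷ lengths-linked l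

length-concat : (F : List (List A)) → All (λ w → length w ≤ length (concat F)) F
length-concat []      = []
length-concat (w ∷ F) = subst (length w ≤_) (sym (List.length-++ w)) (ℕ.m≤m+n _ _) ∷
  All.map (λ le → ℕ.≤-trans le (subst (length (concat F) ≤_) (sym (List.length-++ w)) (ℕ.m≤n+m _ _)))
          (length-concat F)

-- Factorizations with prescribed row lengths

module Count (S : Multiset) (d : ℕ) where

  IsFactorization : Factorization → Set
  IsFactorization F = IsDualDyckFactorization S F × di (concat F) ≡ d

  -- Determinants ask for integers as row lengths. Absolute values supply the candidates, and the
  -- filter leaves none of them if some entry is negative.
  factorizationsℤ : List ℤ → List Factorization
  factorizationsℤ zs =
    filter (λ F → List.≡-dec ℤ._≟_ (lengths F) zs) (factorizations S d (map ℤ.∣_∣ zs))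

  factorizationsℤ-! : ∀ zs → Unique (factorizationsℤ zs)
  factorizationsℤ-! zs = Unique.filter⁺ _
    (select-! ℤ._≟_ (factorizationOf? S d (map ℤ.∣_∣ zs)) (fillings S (map ℤ.∣_∣ zs)))

  ∈-factorizationsℤ⁻ : ∀ {zs F} → F ∈ factorizationsℤ zs → IsFactorization F × lengths F ≡ zs
  ∈-factorizationsℤ⁻ {zs} {F} F∈ with ∈.∈-filter⁻ _ {xs = factorizations S d (map ℤ.∣_∣ zs)} F∈
  ... | F∈′ , eq with Equivalence.to (∈-factorizations S d (map ℤ.∣_∣ zs) F) F∈′
  ... | F-fact , di≡ , _ = (F-fact , di≡) , eq

  ∈-factorizationsℤ⁺ : ∀ {zs F} → IsFactorization F → lengths F ≡ zs → F ∈ factorizationsℤ zs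
  ∈-factorizationsℤ⁺ {F = F} (F-fact , di≡) refl = ∈.∈-filter⁺ _
    (Equivalence.from (∈-factorizations S d _ F)
      (F-fact , di≡ , List.map-∘ {g = ℤ.∣_∣} {f = λ w → + length w} F)) refl

  count : {P : Pred Factorization 0ℓ} → Decidable P → List ℤ → ℤ
  count P? zs = + length (filter P? (factorizationsℤ zs))

  count-bijection : {P Q : Pred Factorization 0ℓ} (P? : Decidable P) (Q? : Decidable Q) →
    ∀ zs zs′ (φ ψ : Factorization → Factorization) →
    (∀ {F} → IsFactorization F → lengths F ≡ zs → P F →
      IsFactorization (φ F) × lengths (φ F) ≡ zs′ × Q (φ F) × ψ (φ F) ≡ F) →
    (∀ {F} → IsFactorization F → lengths F ≡ zs′ → Q F →
      IsFactorization (ψ F) × lengths (ψ F) ≡ zs × P (ψ F) × φ (ψ F) ≡ F) →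
    count P? zs ≡ count Q? zs′
  count-bijection P? Q? zs zs′ φ ψ into onto = cong +_ (length-bijection φ ψ
    (Unique.filter⁺ P? (factorizationsℤ-! zs)) (Unique.filter⁺ Q? (factorizationsℤ-! zs′))
    (λ F∈ → let F∈′ , p = ∈.∈-filter⁻ P? F∈ ; f , eq = ∈-factorizationsℤ⁻ F∈′
                f′ , eq′ , q , inv = into f eq p
            in ∈.∈-filter⁺ Q? (∈-factorizationsℤ⁺ f′ eq′) q , inv)
    (λ F∈ → let F∈′ , q = ∈.∈-filter⁻ Q? F∈ ; f , eq = ∈-factorizationsℤ⁻ F∈′
                f′ , eq′ , p , inv = onto f eq q
            in ∈.∈-filter⁺ P? (∈-factorizationsℤ⁺ f′ eq′) p , inv))

  count-none : {P : Pred Factorization 0ℓ} (P? : Decidable P) → ∀ zs →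
    (∀ {F} → IsFactorization F → lengths F ≡ zs → ¬ P F) → count P? zs ≡ 0ℤ
  count-none P? zs none = cong (λ F → + length F) (List.filter-none P?
    (All.tabulate (λ F∈ → let f , eq = ∈-factorizationsℤ⁻ F∈ in none f eq)))

  moved : ∀ {F F′} → Moved F F′ → IsFactorization F → IsFactorization F′
  moved μ ((σ , F↑) , di≡) =
    (↭-trans (↭-sym (Moved-↭ μ)) σ , Moved-dualDyck μ F↑) , trans (sym (Moved-di μ F↑)) di≡

  cleanCount : ℕ → ℕ → List ℤ → ℤ
  cleanCount c i = count (clean? i c)

  clean₀ : ∀ F → Clean 0 0 F
  clean₀ []          = tt
  clean₀ (_ ∷ [])    = tt
  clean₀ (_ ∷ B ∷ F) = zero , clean₀ (B ∷ F)

  private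
    flipAt : ∀ pre {x y post F} → All DualDyck F → lengths F ≡ pre ++ x ∷ y ∷ post →
      let F′ = at (length pre) flip F in
      Moved F F′ × lengths F′ ≡ pre ++ y ∷ x ∷ post × at (length pre) flip F′ ≡ F
    flipAt []        {F = A ∷ B ∷ F} (A↑ ∷ B↑ ∷ F↑) refl =
      let φ = Flip-flip A B A↑ B↑ in
      here (Flip-exchange φ) ,
      cong₂ (λ m n → + m ∷ + n ∷ lengths F) (Flip-length φ) (Flip-length (Flip-mirror φ)) ,
      cong (λ (A′ , B′) → A′ ∷ B′ ∷ F) (Flip-unique (Flip-sym φ))
    flipAt (z ∷ pre) {F = A ∷ F} (A↑ ∷ F↑) eq =
      let μ , eq′ , inv = flipAt pre {F = F} F↑ (List.∷-injectiveʳ eq) in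
      there μ , cong₂ _∷_ (List.∷-injectiveˡ eq) eq′ , cong (A ∷_) inv

  count-symmetric : Symmetric (cleanCount 0 0)
  count-symmetric pre x y post = count-bijection (clean? 0 0) (clean? 0 0) _ _ φ φ step step
    where
    φ = at (length pre) flip
    step : ∀ {x y F} → IsFactorization F → lengths F ≡ pre ++ x ∷ y ∷ post → Clean 0 0 F →
           IsFactorization (φ F) × lengths (φ F) ≡ pre ++ y ∷ x ∷ post × Clean 0 0 (φ F) × φ (φ F) ≡ F
    step {F = F} f eq _ = let μ , eq′ , inv = flipAt pre (proj₂ (proj₁ f)) eq in
      moved μ f , eq′ , clean₀ (φ F) , inv

  count-negative : VanishesOnNegative (cleanCount 0 0)
  count-negative pre n post = count-none (clean? 0 0) _ λ {F} _ eq _ → lengths≢ pre F eq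
    where
    lengths≢ : ∀ pre F → lengths F ≢ pre ++ -[1+ n ] ∷ post
    lengths≢ []        (_ ∷ F) ()
    lengths≢ (_ ∷ pre) (_ ∷ F) eq = lengths≢ pre F (List.∷-injectiveʳ eq)
    lengths≢ []        []      ()
    lengths≢ (_ ∷ _)   []      ()

  flaw? : ∀ i c → Decidable (λ F → Clean i c F × ¬ Clean (suc i) c F)
  flaw? i c F = clean? i c F ×-dec ¬? (clean? (suc i) c F)

  lengths-tailFlip : ∀ {c i F} pre {x y post} → All DualDyck F → FirstFlaw c i F → length pre ≡ i →
    lengths F ≡ pre ++ x ∷ y ∷ post →
    lengths (at i (tailFlip c) F) ≡ pre ++ ℤ.suc y ∷ ℤ.pred x ∷ post
  lengths-tailFlip {c} [] (A↑ ∷ B↑ ∷ _) (here {A} {B} {F} p ¬p _) refl refl =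
    cong₂ (λ u v → u ∷ v ∷ lengths F) (cong +_ length-A⁺) (cong (λ n → ℤ.pred (+ n)) length-B⁺)
    where open TailFlip c A B A↑ B↑ p ¬p
  lengths-tailFlip (z ∷ pre) (_ ∷ F↑) (there _ ff) len eq =
    cong₂ _∷_ (List.∷-injectiveˡ eq) (lengths-tailFlip pre F↑ ff (ℕ.suc-injective len) (List.∷-injectiveʳ eq))

  flaw-dotSymmetric : ∀ i c → DotSymmetric i (count (flaw? i c))
  flaw-dotSymmetric i c pre x y post len = count-bijection (flaw? i c) (flaw? i c) _ _ φ φ step
    λ {F} f eq q → let f′ , eq′ , rest = step f eq q in
      f′ , trans eq′ (cong₂ (λ u v → pre ++ u ∷ v ∷ post) (ℤ.suc-pred x) (ℤ.pred-suc y)) , rest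
    where
    φ = at i (tailFlip c)
    step : ∀ {x y F} → IsFactorization F → lengths F ≡ pre ++ x ∷ y ∷ post →
           Clean i c F × ¬ Clean (suc i) c F →
           IsFactorization (φ F) × lengths (φ F) ≡ pre ++ ℤ.suc y ∷ ℤ.pred x ∷ post ×
           (Clean i c (φ F) × ¬ Clean (suc i) c (φ F)) × φ (φ F) ≡ F
    step {F = F} f@((_ , F↑) , _) eq (p , ¬p) =
      let ff = Clean⇒FirstFlaw i c F p ¬p in
      moved (FirstFlaw-moved F↑ ff) f , lengths-tailFlip pre F↑ ff len eq ,
      FirstFlaw⇒Clean (FirstFlaw-at F↑ ff) , FirstFlaw-involutive F↑ ff

  count-flaw : ∀ i c zs → count (flaw? i c) zs ≡ cleanCount c i zs ℤ.- cleanCount c (suc i) zs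
  count-flaw i c zs = begin
    + n                 ≡⟨ lemma (+ m) (+ n) ⟩
    + (m + n) ℤ.- + m   ≡⟨ cong (λ k → + k ℤ.- + m) (length-filter-split (clean? i c) (clean? (suc i) c)
                             (Clean-suc⁻ i c) (factorizationsℤ zs)) ⟨
    cleanCount c i zs ℤ.- cleanCount c (suc i) zs ∎
    where
    open ≡-Reasoning
    m = length (filter (clean? (suc i) c) (factorizationsℤ zs))
    n = length (filter (flaw? i c) (factorizationsℤ zs))
    lemma : ∀ m n → n ≡ m ℤ.+ n ℤ.- m
    lemma = solve-∀

  -- The sign-reversing involution is split up by the place of the first flaw: testing one more pair
  -- of rows discards the factorizations with their first flaw there, and the determinant of their
  -- count vanishes by itself.
  det-clean-row : ∀ c m l i → i ≤ m → det (ramp 0 (suc m)) (cleanCount c 0) l ≡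
                                       det (ramp 0 (suc m)) (cleanCount c i) l
  det-clean-row c m l zero    _   = refl
  det-clean-row c m l (suc i) i<m =
    trans (det-clean-row c m l i (ℕ.<⇒≤ i<m)) (ℤ.i-j≡0⇒i≡j _ _ (begin
      det δ (cleanCount c i) l ℤ.- det δ (cleanCount c (suc i)) l
        ≡⟨ det-sub (cleanCount c i) (cleanCount c (suc i)) δ l ⟨
      det δ (λ zs → cleanCount c i zs ℤ.- cleanCount c (suc i) zs) l
        ≡⟨ det-cong (count-flaw i c) δ l ⟨
      det δ (count (flaw? i c)) l
        ≡⟨ det-dotSymmetric i 0 (suc m) (count (flaw? i c)) l (s≤s i<m) (flaw-dotSymmetric i c) ⟩
      0ℤ
        ∎))
    where
    open ≡-Reasoning
    δ = ramp 0 (suc m)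

  clean-next : ∀ i c zs → length zs ≤ suc i → cleanCount c i zs ≡ cleanCount (suc c) 0 zs
  clean-next i c zs le = count-bijection (clean? i c) (clean? 0 (suc c)) zs zs id id
    (λ {F} f eq p → f , eq , Clean-next i c F (short F eq) p , refl)
    (λ {F} f eq p → f , eq , Clean-next⁻ i c F (short F eq) p , refl)
    where
    short : ∀ F → lengths F ≡ zs → length F ≤ suc i
    short F eq = subst (_≤ suc i) (trans (cong length (sym eq)) (List.length-map _ F)) le

  det-clean : ∀ c m l → det (ramp 0 m) (cleanCount 0 0) l ≡ det (ramp 0 m) (cleanCount c 0) l
  det-clean zero    m       l = refl
  det-clean (suc c) zero    l = trans (det-clean c zero l)
    (det-length [] l λ zs len → clean-next 0 c zs (subst (_≤ 1) (sym len) z≤n))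
  det-clean (suc c) (suc m) l = trans (det-clean c (suc m) l)
    (trans (det-clean-row c m l m ℕ.≤-refl)
      (det-length (ramp 0 (suc m)) l λ zs len →
        clean-next m c zs (ℕ.≤-reflexive (trans len (length-ramp 0 (suc m))))))

  -- No row is longer than |S|, so these are the Dyck tableaux.
  tableauCount : List ℤ → ℤ
  tableauCount = cleanCount (length S) 0

  rows-≤ : ∀ {F} → IsFactorization F → All (λ w → length w ≤ length S) F
  rows-≤ {F} ((σ , _) , _) = subst (λ n → All (λ w → length w ≤ n) F) (↭.↭-length σ) (length-concat F)

  -- The row lengths of a tableau increase weakly from bottom to top, so `tableauCount` vanishes on
  -- lists with a descent and `det-hat` leaves only the diagonal term.
  det-count : ∀ l → IncreasingFrom 0 l →
              det (ramp 0 (length l)) (cleanCount 0 0) (hat 0 l) ≡ tableauCount (map +_ l)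
  det-count l l↑ = trans (det-clean (length S) (length l) (hat 0 l))
    (det-hat tableauCount (λ zs ¬↑ → count-none (clean? 0 (length S)) zs
      λ {F} f eq p → ¬↑ (subst (Linked ℤ._≤_) eq (lengths-linked (Clean⇒Linked (rows-≤ f) p)))) 0 0 l l↑)

  DS*-count : ∀ α → + DS* S d α ≡ cleanCount 0 0 (map +_ α)
  DS*-count α = cong +_ (length-bijection id id
    (select-! ℤ._≟_ (factorizationOf? S d α) (fillings S α))
    (Unique.filter⁺ (clean? 0 0) (factorizationsℤ-! (map +_ α)))
    (λ {F} F∈ → let f , di≡ , w≡ = Equivalence.to (∈-factorizations S d α F) F∈ in
      ∈.∈-filter⁺ (clean? 0 0) (∈-factorizationsℤ⁺ (f , di≡)
        (trans (List.map-∘ {g = +_} {f = length} F) (cong (λ a → map +_ a) w≡))) (clean₀ F) , refl)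
    (λ {F} F∈ → let (f , di≡) , eq = ∈-factorizationsℤ⁻ (proj₁ (∈.∈-filter⁻ (clean? 0 0) F∈)) in
      Equivalence.from (∈-factorizations S d α F) (f , di≡ ,
        List.map-injective ℤ.+-injective (trans (sym (List.map-∘ {g = +_} {f = length} F)) eq)) , refl))

  DS*-expansion : ∀ β → + DS* S d (reverse β) ≡ total (shapes β) (λ l → tableauCount (map +_ l))
  DS*-expansion β = begin
    + DS* S d (reverse β)
      ≡⟨ DS*-count (reverse β) ⟩
    cleanCount 0 0 (map +_ (reverse β))
      -- The tableaux behind `shapes β` have content `reverse β`; symmetry absorbs the reversal.
      ≡⟨ symmetric-↭ (cleanCount 0 0) count-symmetric (↭.map⁺ +_ (↭.↭-reverse β)) [] ⟩
    cleanCount 0 0 (map +_ β)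
      ≡⟨ det-expansion (cleanCount 0 0) count-symmetric count-negative β ⟩
    total (shapes β) (det (ramp 0 (length β)) (cleanCount 0 0) ∘ hat 0)
      ≡⟨ total-cong (All.zipWith (λ {l} (len , l↑) →
           trans (cong (λ n → det (ramp 0 n) (cleanCount 0 0) (hat 0 l)) (sym len)) (det-count l l↑))
           (shapes-length β , shapes-increasing β)) ⟩
    total (shapes β) (λ l → tableauCount (map +_ l))
      ∎
    where open ≡-Reasoning

_≟_ : (u w : List ℕ) → Dec (u ≡ w)
_≟_ = List.≡-dec ℕ._≟_

-- Tableaux from bottom to top, with empty rows

pad : ℕ → Tableau A → Tableau A
pad k T = replicate (k ∸ length T) [] ++ reverse T

dropEmpty : Tableau A → Tableau A
dropEmpty []            = []
dropEmpty ([] ∷ G)      = dropEmpty G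
dropEmpty ((x ∷ w) ∷ G) = (x ∷ w) ∷ G

unpad : Tableau A → Tableau A
unpad G = reverse (dropEmpty G)

NonEmpty : List A → Set
NonEmpty w = 0 < length w

dropEmpty-nonEmpty : {G : Tableau A} → All NonEmpty G → dropEmpty G ≡ G
dropEmpty-nonEmpty []                       = refl
dropEmpty-nonEmpty {G = (_ ∷ _) ∷ _} (_ ∷ _) = refl

dropEmpty-replicate : ∀ n (G : Tableau A) → dropEmpty (replicate n [] ++ G) ≡ dropEmpty G
dropEmpty-replicate zero    G = refl
dropEmpty-replicate (suc n) G = dropEmpty-replicate n G

dropEmpty-length : (G : Tableau A) → length (dropEmpty G) ≤ length G
dropEmpty-length []            = z≤n
dropEmpty-length ([] ∷ G)      = ℕ.m≤n⇒m≤1+n (dropEmpty-length G)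
dropEmpty-length ((_ ∷ _) ∷ G) = ℕ.≤-refl

replicate-dropEmpty : (G : Tableau A) →
                      replicate (length G ∸ length (dropEmpty G)) [] ++ dropEmpty G ≡ G
replicate-dropEmpty []            = refl
replicate-dropEmpty ([] ∷ G)      = trans
  (cong (λ n → replicate n [] ++ dropEmpty G) (ℕ.+-∸-assoc 1 (dropEmpty-length G)))
  (cong ([] ∷_) (replicate-dropEmpty G))
replicate-dropEmpty ((x ∷ w) ∷ G) =
  cong (λ n → replicate n [] ++ (x ∷ w) ∷ G) (ℕ.n∸n≡0 (length G))

all-reverse : ∀ {P : A → Set} {xs} → All P xs → All P (reverse xs)
all-reverse {xs = xs} = ↭.All-resp-↭ (↭-sym (↭.↭-reverse xs))

unpad-pad : ∀ k {T : Tableau A} → All NonEmpty T → unpad (pad k T) ≡ T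
unpad-pad k {T} T≠[] = begin
  reverse (dropEmpty (replicate (k ∸ length T) [] ++ reverse T))
    ≡⟨ cong reverse (dropEmpty-replicate (k ∸ length T) (reverse T)) ⟩
  reverse (dropEmpty (reverse T))
    ≡⟨ cong reverse (dropEmpty-nonEmpty (all-reverse T≠[])) ⟩
  reverse (reverse T)
    ≡⟨ List.reverse-involutive T ⟩
  T
    ∎
  where open ≡-Reasoning

pad-unpad : ∀ {k} (G : Tableau A) → length G ≡ k → pad k (unpad G) ≡ G
pad-unpad G refl = trans
  (cong₂ (λ n G′ → replicate (length G ∸ n) [] ++ G′)
    (List.length-reverse (dropEmpty G)) (List.reverse-involutive (dropEmpty G)))
  (replicate-dropEmpty G)

-- A shape with more than `k` parts gives a list longer than `k`. It equals no list of length `k`,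
-- so such shapes contribute nothing.
padShape : ℕ → List ℕ → List ℕ
padShape k sh = replicate (k ∸ length sh) 0 ++ reverse sh

shape-pad : ∀ k (T : Tableau A) → shape (pad k T) ≡ padShape k (shape T)
shape-pad k T = begin
  map length (replicate (k ∸ length T) [] ++ reverse T)
    ≡⟨ List.map-++ length (replicate (k ∸ length T) []) (reverse T) ⟩
  map length (replicate (k ∸ length T) []) ++ map length (reverse T)
    ≡⟨ cong₂ _++_ (List.map-replicate length (k ∸ length T) []) (List.reverse-map length T) ⟩
  replicate (k ∸ length T) 0 ++ reverse (shape T)
    ≡⟨ cong (λ n → replicate (k ∸ n) 0 ++ reverse (shape T)) (List.length-map length T) ⟨
  padShape k (shape T)
    ∎
  where open ≡-Reasoning

padShape-injective : ∀ k {sh sh′} → All (0 <_) sh → All (0 <_) sh′ →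
                     padShape k sh ≡ padShape k sh′ → sh ≡ sh′
padShape-injective k {sh} {sh′} pos pos′ eq =
  List.reverse-injective (trans (sym (strip (k ∸ length sh) (all-reverse pos)))
    (trans (cong dropZeros eq) (strip (k ∸ length sh′) (all-reverse pos′))))
  where
  dropZeros : List ℕ → List ℕ
  dropZeros []          = []
  dropZeros (zero ∷ l)  = dropZeros l
  dropZeros (suc n ∷ l) = suc n ∷ l
  strip : ∀ n {l} → All (0 <_) l → dropZeros (replicate n 0 ++ l) ≡ l
  strip (suc n) ps                   = strip n ps
  strip zero    []                   = refl
  strip zero    {suc _ ∷ _} (_ ∷ _) = refl

concat-pad : ∀ k (T : Tableau A) → concat (pad k T) ≡ concat (reverse T)
concat-pad k T = empties (k ∸ length T)
  where
  empties : ∀ n → concat (replicate n [] ++ reverse T) ≡ concat (reverse T)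
  empties zero    = refl
  empties (suc n) = empties n

concat-reverse : (T : Tableau A) → concat (reverse T) ↭ concat T
concat-reverse []      = ↭-refl
concat-reverse (w ∷ T) = ↭-trans (↭-reflexive (begin
  concat (reverse (w ∷ T))             ≡⟨ cong concat (List.unfold-reverse w T) ⟩
  concat (reverse T ++ [ w ])          ≡⟨ List.concat-++ (reverse T) [ w ] ⟨
  concat (reverse T) ++ (w ++ [])      ≡⟨ cong (concat (reverse T) ++_) (List.++-identityʳ w) ⟩
  concat (reverse T) ++ w              ∎))
  (↭-trans (↭.++-comm (concat (reverse T)) w) (↭.++⁺ˡ w (concat-reverse T)))
  where open ≡-Reasoning

module _ {Q : A → A → Set} where

  linked-∷ʳ : ∀ u {x y} → Linked Q (u ∷ʳ y) → Q y x → Linked Q ((u ∷ʳ y) ∷ʳ x)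
  linked-∷ʳ []          _       q = q ∷ [-]
  linked-∷ʳ (_ ∷ [])    (p ∷ _) q = p ∷ q ∷ [-]
  linked-∷ʳ (_ ∷ _ ∷ u) (p ∷ l) q = p ∷ linked-∷ʳ (_ ∷ u) l q

  linked-reverse : ∀ {xs} → Linked (λ x y → Q y x) xs → Linked Q (reverse xs)
  linked-reverse []      = []
  linked-reverse [-]     = [-]
  linked-reverse (_∷_ {x} {y} {xs} q l) =
    subst (Linked Q) (sym (trans (List.unfold-reverse x (y ∷ xs)) (cong (_∷ʳ x) (List.unfold-reverse y xs))))
      (linked-∷ʳ (reverse xs) (subst (Linked Q) (List.unfold-reverse y xs) (linked-reverse l)) q)

module _ {R : A → A → Set} where

  Below-zip : ∀ {u v} → Below R u v → All (uncurry (λ x y → R y x)) (zip v u)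
  Below-zip {v = []}    []       = []
  Below-zip {v = _ ∷ _} []       = []
  Below-zip             (r ∷ rs) = r ∷ Below-zip rs

  zip-Below : ∀ {u v} → length u ≤ length v → All (uncurry (λ x y → R y x)) (zip v u) → Below R u v
  zip-Below {[]}    {v}     _        _        = []
  zip-Below {x ∷ u} {y ∷ v} (s≤s le) (r ∷ rs) = r ∷ zip-Below le rs

  linked-replicate : ∀ n {G} → Linked (Below R) G → Linked (Below R) (replicate n [] ++ G)
  linked-replicate zero    l = l
  linked-replicate (suc n) l = [] ∷′ linked-replicate n l
    where
    _∷′_ : ∀ {G} (_ : Below R [] []) → Linked (Below R) G → Linked (Below R) ([] ∷ G)
    _∷′_ {[]}    _ _ = [-]
    _∷′_ {_ ∷ _} _ l = [] ∷ l

  linked-pad : ∀ k {T} → IsPartition (shape T) → Columns (λ x y → R y x) T → Linked (Below R) (pad k T)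
  linked-pad k {T} (_ , sh↓) cols = linked-replicate (k ∸ length T) (linked-reverse (combine sh↓ cols))
    where
    combine : ∀ {T} → Linked _≥_ (shape T) → Columns (λ x y → R y x) T → Linked (λ v u → Below R u v) T
    combine _         []      = []
    combine _         [-]     = [-]
    combine (le ∷ sh) (c ∷ l) = zip-Below le c ∷ combine sh l

  dropEmpty-linked : ∀ {G} → Linked (Below R) G → Linked (Below R) (dropEmpty G) × All NonEmpty (dropEmpty G)
  dropEmpty-linked {[]}          _ = [] , []
  dropEmpty-linked {[] ∷ []}     _ = [] , []
  dropEmpty-linked {[] ∷ _ ∷ _}  (_ ∷ l) = dropEmpty-linked l
  dropEmpty-linked {(_ ∷ _) ∷ _} l = l , above (s≤s z≤n) l
    where
    above : ∀ {w G} → NonEmpty w → Linked (Below R) (w ∷ G) → All NonEmpty (w ∷ G)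
    above w≠[] [-]     = w≠[] ∷ []
    above w≠[] (b ∷ l) = w≠[] ∷ above (ℕ.<-≤-trans w≠[] (Below-length b)) l

  unpad-shape : ∀ {G} → Linked (Below R) G → IsPartition (shape (unpad G)) × Columns (λ x y → R y x) (unpad G)
  unpad-shape {G} l = (All.map⁺ (all-reverse (proj₂ (dropEmpty-linked l))) ,
    Linked.map⁺ (Linked.map Below-length rev)) , Linked.map Below-zip rev
    where
    rev : Linked (λ v u → Below R u v) (unpad G)
    rev = linked-reverse (proj₁ (dropEmpty-linked l))

all-pad : ∀ {P : List A → Set} k {T} → P [] → All P T → All P (pad k T)
all-pad k {T} p ps = All.++⁺ (All.replicate⁺ (k ∸ length T) p) (all-reverse ps)

all-unpad : ∀ {P : List A → Set} {G} → All P G → All P (unpad G)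
all-unpad ps = all-reverse (all-dropEmpty ps)
  where
  all-dropEmpty : ∀ {P : List A → Set} {G} → All P G → All P (dropEmpty G)
  all-dropEmpty []                       = []
  all-dropEmpty {G = [] ∷ _}      (_ ∷ ps) = all-dropEmpty ps
  all-dropEmpty {G = (_ ∷ _) ∷ _} ps       = ps

module _ (S : Multiset) (d : ℕ) where
  open Count S d

  dyckTableaux-! : Unique (dyckTableaux S d)
  dyckTableaux-! = select-! ℤ._≟_ (dyckTableauOf? S d) (concatMap (fillings S) (compositions (length S)))

  tableauCount-dyckTableaux : ∀ l →
    tableauCount (map +_ l) ≡
    + length (filter (λ P → padShape (length l) (shape P) ≟ l) (dyckTableaux S d))
  tableauCount-dyckTableaux l = cong +_ (length-bijection unpad (pad k)
    (Unique.filter⁺ (clean? 0 (length S)) (factorizationsℤ-! (map +_ l)))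
    (Unique.filter⁺ shape? dyckTableaux-!)
    (λ {F} F∈ → let F∈′ , clean = ∈.∈-filter⁻ (clean? 0 (length S)) F∈
                    f , eq = ∈-factorizationsℤ⁻ {map +_ l} F∈′
                    linked = Clean⇒Linked (rows-≤ f) clean
                    shape≡ = List.map-injective ℤ.+-injective (trans (sym (List.map-∘ {g = +_} {f = length} F)) eq)
                    inv = pad-unpad F (trans (sym (List.length-map length F)) (cong length shape≡))
                in ∈.∈-filter⁺ shape? (Equivalence.from (∈-dyckTableaux S d (unpad F)) (tableau F f linked inv))
                     (trans (sym (shape-pad k (unpad F))) (trans (cong shape inv) shape≡)) , inv)
    (λ {P} P∈ → let P∈′ , eq = ∈.∈-filter⁻ shape? {xs = dyckTableaux S d} P∈
                    ((part , P↑ , cols) , σ , di≡) = Equivalence.to (∈-dyckTableaux S d P) P∈′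
                in ∈.∈-filter⁺ (clean? 0 (length S))
                     (∈-factorizationsℤ⁺
                       ((subst (_↭ S) (sym (concat-pad k P)) (↭-trans (concat-reverse P) σ) , all-pad k [] P↑) ,
                        trans (cong di (concat-pad k P)) di≡)
                       (trans (List.map-∘ {g = +_} {f = length} (pad k P))
                         (cong (λ a → map +_ a) (trans (shape-pad k P) eq))))
                     (Linked⇒Clean (length S) (linked-pad k part cols)) ,
                   unpad-pad k (All.map⁻ (proj₁ part))))
    where
    k = length l
    shape? : Decidable (λ (P : Tableau ℤ) → padShape k (shape P) ≡ l)
    shape? P = padShape k (shape P) ≟ l
    tableau : ∀ F → IsFactorization F → Linked (Below AtMostOneAbove) F → pad k (unpad F) ≡ F →
              DyckTableauOf S d (unpad F)
    tableau F ((σ , F↑) , di≡) linked inv =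
      (proj₁ (unpad-shape linked) , all-unpad F↑ , proj₂ (unpad-shape linked)) ,
      ↭-trans (↭-sym (concat-reverse (unpad F))) (subst (_↭ S) (sym RR≡) σ) ,
      trans (cong di RR≡) di≡
      where
      RR≡ : concat (reverse (unpad F)) ≡ concat F
      RR≡ = trans (sym (concat-pad k (unpad F))) (cong concat inv)

-- Semistandard tableaux, letter by letter

occ : ℕ → List ℕ → ℕ
occ i w = length (filter (i ℕ.≟_) w)

restrict : ℕ → List ℕ → List ℕ
restrict k = filter (ℕ._<? k)

grow : ℕ → List ℕ → Tableau ℕ → Tableau ℕ
grow k = zipWith (λ n w → w ++ replicate (n ∸ length w) k)

-- Runs parallel to `shapes`, so that the lists of shapes agree including multiplicities. The
-- prepended empty row makes room for the new part of the strip.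
tableaux : List ℕ → List (Tableau ℕ)
tableaux []      = [ [] ]
tableaux (b ∷ β) =
  concatMap (λ G → map (λ l → grow (length β) l ([] ∷ G)) (strips 0 (shape G) b)) (tableaux β)

Sorted : List ℕ → Set
Sorted = Linked _≤_

-- Peels off the largest letter `length β`, whose multiplicity stands at the head; so in the usual
-- order the content is the reversed list.
Content : List ℕ → List ℕ → Set
Content []      w = w ≡ []
Content (b ∷ β) w =
  All (_≤ length β) w × occ (length β) w ≡ b × Content β (restrict (length β) w)

-- One row for each letter: as columns increase strictly, there can be no more nonempty rows than
-- letters.
IsPadded : List ℕ → Tableau ℕ → Set
IsPadded β G =
  length G ≡ length β × All Sorted G × Linked (Below ℕ._>_) G × Content β (concat G)

Content-< : ∀ β {w} → Content β w → All (_< length β) w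
Content-< []      refl    = []
Content-< (b ∷ β) (≤k , _) = All.map s≤s ≤k

Content-↭ : ∀ β {u w} → u ↭ w → Content β u → Content β w
Content-↭ []      σ refl         = ↭.↭-empty-inv (↭-sym σ)
Content-↭ (b ∷ β) σ (≤k , eq , c) =
  ↭.All-resp-↭ σ ≤k , trans (↭.↭-length (↭.filter-↭ _ (↭-sym σ))) eq ,
  Content-↭ β (↭.filter-↭ _ σ) c

restrict-accept : ∀ {k x} → x < k → ∀ w → restrict k (x ∷ w) ≡ x ∷ restrict k w
restrict-accept {k} x<k w = List.filter-accept (ℕ._<? k) x<k

restrict-reject : ∀ {k x} → ¬ (x < k) → ∀ w → restrict k (x ∷ w) ≡ restrict k w
restrict-reject {k} x≮k w = List.filter-reject (ℕ._<? k) x≮k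

occ-∷ : ∀ i x w → occ i (x ∷ w) ≡ occ i [ x ] + occ i w
occ-∷ i x w = trans (cong length (List.filter-++ (i ℕ.≟_) [ x ] w))
                      (List.length-++ (filter (i ℕ.≟_) [ x ]))

occ-reject : ∀ {i x} → i ≢ x → ∀ w → occ i (x ∷ w) ≡ occ i w
occ-reject {i} i≢x w = cong length (List.filter-reject (i ℕ.≟_) i≢x)

occ-restrict : ∀ {i k} → i < k → ∀ w → occ i (restrict k w) ≡ occ i w
occ-restrict         i<k []      = refl
occ-restrict {i} {k} i<k (x ∷ w) with x ℕ.<? k
... | yes x<k rewrite restrict-accept x<k w | occ-∷ i x (restrict k w) | occ-∷ i x w =
  cong (_+_ (occ i [ x ])) (occ-restrict i<k w)
... | no x≮k rewrite restrict-reject x≮k w =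
  trans (occ-restrict i<k w) (sym (occ-reject (λ { refl → x≮k i<k }) w))

length-occ : ∀ {k w} → All (_≤ k) w → length w ≡ occ k w + length (restrict k w)
length-occ                  []         = refl
length-occ {k} {x ∷ w} (le ∷ les) with ℕ.m≤n⇒m<n∨m≡n le
... | inj₁ x<k rewrite restrict-accept x<k w | occ-reject {k} (ℕ.<⇒≢ x<k ∘ sym) w =
  trans (cong suc (length-occ les)) (sym (ℕ.+-suc _ _))
... | inj₂ refl rewrite restrict-reject (ℕ.<-irrefl {x} refl) w =
  trans (cong suc (length-occ les))
          (cong (_+ length (restrict k w)) (sym (cong length (List.filter-accept (k ℕ.≟_) refl))))

occs : ℕ → List ℕ → List ℕ
occs k w = map (λ i → occ i w) (upTo k)

occs-suc : ∀ k w → occs (suc k) w ≡ occs k (restrict k w) ∷ʳ occ k w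
occs-suc k w = begin
  map (λ i → occ i w) (upTo (suc k))
    ≡⟨ cong (map (λ i → occ i w)) (List.upTo-∷ʳ k) ⟨
  map (λ i → occ i w) (upTo k ∷ʳ k)
    ≡⟨ List.map-++ (λ i → occ i w) (upTo k) [ k ] ⟩
  occs k w ∷ʳ occ k w
    ≡⟨ cong (_∷ʳ occ k w) (List.map-cong-local
         (All.tabulate (λ i∈ → sym (occ-restrict (∈.∈-upTo⁻ i∈) w)))) ⟩
  occs k (restrict k w) ∷ʳ occ k w
    ∎
  where open ≡-Reasoning

Content⇒occs : ∀ β {w} → Content β w → occs (length β) w ≡ reverse β
Content⇒occs []      _                 = refl
Content⇒occs (b ∷ β) {w} (_ , eq , c) = trans (occs-suc (length β) w)
  (trans (cong₂ _∷ʳ_ (Content⇒occs β c) eq) (sym (List.unfold-reverse b β)))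

occs⇒Content : ∀ β {w} → All (_< length β) w → occs (length β) w ≡ reverse β → Content β w
occs⇒Content []      {[]}    _  _   = refl
occs⇒Content []      {_ ∷ _} (() ∷ _)
occs⇒Content (b ∷ β) {w}     <k eq =
  ≤k , proj₂ inj , occs⇒Content β (All.all-filter (ℕ._<? length β) w) (proj₁ inj)
  where
  ≤k = All.map ℕ.≤-pred <k
  inj = List.∷ʳ-injective (occs (length β) (restrict (length β) w)) (reverse β)
                            (trans (sym (occs-suc (length β) w))
                                       (trans eq (List.unfold-reverse b β)))

-- In a sorted row the largest letter `k` fills the end.
restrict-row : ∀ {k w} → Sorted w → All (_≤ k) w →
               restrict k w ++ replicate (length w ∸ length (restrict k w)) k ≡ w
restrict-row {k} {[]}    _  _          = refl
restrict-row {k} {x ∷ w} w↑ (le ∷ les) with x ℕ.<? k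
... | yes x<k rewrite restrict-accept x<k w = cong (x ∷_) (restrict-row (Linked.tail w↑) les)
... | no x≮k rewrite restrict-reject x≮k w = trans
                      (cong (λ u → u ++ replicate (suc (length w) ∸ length u) k)
                            (List.filter-none (ℕ._<? k) large))
                      (cong₂ _∷_ (sym x≡k) (constant all≡k))
  where
  x≡k : x ≡ k
  x≡k = ℕ.≤-antisym le (ℕ.≮⇒≥ x≮k)
  all≡k : All (_≡ k) w
  all≡k = All.zipWith (λ (x≤y , y≤k) → ℕ.≤-antisym y≤k (ℕ.≤-trans (ℕ.≮⇒≥ x≮k) x≤y))
                      (AllPairs.head (Linked.Linked⇒AllPairs ℕ.≤-trans w↑) , les)
  large : All (λ y → ¬ (y < k)) w
  large = All.map (λ { refl → ℕ.<-irrefl refl }) all≡k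
  constant : ∀ {w} → All (_≡ k) w → replicate (length w) k ≡ w
  constant []             = refl
  constant (refl ∷ eqs) = cong (k ∷_) (constant eqs)

-- The columns increase strictly, so above an entry ≤ k there are only entries < k.
Below-restrict-length : ∀ {k u v} → All (_≤ k) u → Below ℕ._>_ u v → length u ≤ length (restrict k v)
Below-restrict-length                 _          []                = z≤n
Below-restrict-length {v = y ∷ v} (le ∷ les) (y<x ∷ b)
  rewrite restrict-accept (ℕ.<-≤-trans y<x le) v = s≤s (Below-restrict-length les b)

Below-restrict : ∀ {k u v} → Sorted u → All (_≤ k) u → Below ℕ._>_ u v →
                 Below ℕ._>_ (restrict k u) (restrict k v)
Below-restrict _ _ [] = []
Below-restrict {k} {x ∷ u} {y ∷ v} u↑ (le ∷ les) (y<x ∷ b)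
  rewrite restrict-accept (ℕ.<-≤-trans y<x le) v with x ℕ.<? k
... | yes x<k rewrite restrict-accept x<k u = y<x ∷ Below-restrict (Linked.tail u↑) les b
... | no x≮k rewrite restrict-reject x≮k u = subst (λ w → Below ℕ._>_ w _) (sym (List.filter-none (ℕ._<? k)
  (All.map (λ x≤z z<k → x≮k (ℕ.≤-<-trans x≤z z<k)) (AllPairs.head (Linked.Linked⇒AllPairs ℕ.≤-trans u↑))))) []

-- The strip condition puts every new `k` of the lower row under an old entry of the upper row,
-- which is smaller.
Below-grow : ∀ {k u v} a b → All (_< k) v → length u + a ≤ length v → Below ℕ._>_ u v →
             Below ℕ._>_ (u ++ replicate a k) (v ++ replicate b k)
Below-grow {u = []}    zero    b _          _        _         = []
Below-grow {u = []} {[]} (suc a) b _        ()       _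
Below-grow {u = []} {_ ∷ _} (suc a) b (y<k ∷ <k) (s≤s le) _    = y<k ∷ Below-grow {u = []} a b <k le []
Below-grow {u = _ ∷ _} a       b (_ ∷ <k)   (s≤s le) (r ∷ rs)  = r ∷ Below-grow a b <k le rs

sorted-grow : ∀ {k w} a → Sorted w → All (_< k) w → Sorted (w ++ replicate a k)
sorted-grow {k} {[]}        a _         _          = constant a
  where
  constant : ∀ a → Sorted (replicate a k)
  constant zero          = []
  constant (suc zero)    = [-]
  constant (suc (suc a)) = ℕ.≤-refl ∷ constant (suc a)
sorted-grow {k} {x ∷ []}    zero    _   _          = [-]
sorted-grow {k} {x ∷ []}    (suc a) _   (x<k ∷ _)  = ℕ.<⇒≤ x<k ∷ sorted-grow {w = []} (suc a) [] []
sorted-grow {k} {x ∷ y ∷ w} a  (le ∷ w↑) (_ ∷ <k)  = le ∷ sorted-grow a w↑ <k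

-- Columns increase strictly from top to bottom, so each row above forces the entries up by at least
-- one.
row-entries : ∀ {w} {G : Tableau ℕ} → Linked (Below ℕ._>_) (w ∷ G) → All (length G ≤_) w
row-entries {w} {[]}    _       = All.universal (λ _ → z≤n) w
row-entries {w} {v ∷ G} (b ∷ l) = above b (row-entries l)
  where
  above : ∀ {n u v} → Below ℕ._>_ u v → All (n ≤_) v → All (suc n ≤_) u
  above []       _          = []
  above (r ∷ rs) (le ∷ les) = ℕ.≤-<-trans le r ∷ above rs les

interlacing-sum : ∀ {lo μ t l} → Interlacing lo μ t l → sum l ≡ t + (lo + sum μ)
interlacing-sum {lo} {t = t} (last refl) =
  trans (ℕ.+-identityʳ (t + lo)) (cong (_+_ t) (sym (ℕ.+-identityʳ lo)))
interlacing-sum {lo} (cons {m = m} {μ} p q refl _ int) =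
  trans (cong (_+_ (p + lo)) (interlacing-sum int)) (rearrange p lo q (m + sum μ))
  where
  rearrange : ∀ p lo q s → (p + lo) + (q + s) ≡ (p + q) + (lo + s)
  rearrange = ℕ-Solver.solve-∀

-- All properties of the enlarged tableau come from one induction. `head` exposes its lowest row,
-- which the next step compares with the row underneath.
record Grown (k : ℕ) (w : List ℕ) (G : Tableau ℕ) (l : List ℕ) (G′ : Tableau ℕ) : Set where
  field
    head      : ∃ λ a → ∃ λ G″ → G′ ≡ (w ++ replicate a k) ∷ G″
    shape-≡   : shape G′ ≡ l
    restricts : map (restrict k) G′ ≡ w ∷ G
    sorted    : All Sorted G′
    linked    : Linked (Below ℕ._>_) G′
    bounded   : All (All (_≤ k)) G′

restrict-grow : ∀ {k w} a → All (_< k) w → restrict k (w ++ replicate a k) ≡ w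
restrict-grow {k} {w} a <k = begin
  restrict k (w ++ replicate a k)             ≡⟨ List.filter-++ (ℕ._<? k) w (replicate a k) ⟩
  restrict k w ++ restrict k (replicate a k)  ≡⟨ cong₂ _++_ (List.filter-all (ℕ._<? k) <k)
                                                   (List.filter-none (ℕ._<? k)
                                                     (All.replicate⁺ a (ℕ.<-irrefl refl))) ⟩
  w ++ []                                     ≡⟨ List.++-identityʳ w ⟩
  w                                           ∎
  where open ≡-Reasoning

length-grow : ∀ {k} {w : List ℕ} p → length (w ++ replicate (p + length w ∸ length w) k) ≡ p + length w
length-grow {k} {w} p = begin
  length (w ++ replicate (p + length w ∸ length w) k)  ≡⟨ List.length-++ w ⟩
  length w + length (replicate (p + length w ∸ length w) k)
    ≡⟨ cong (_+_ (length w)) (trans (List.length-replicate (p + length w ∸ length w)) (ℕ.m+n∸n≡m p (length w))) ⟩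
  length w + p                                         ≡⟨ ℕ.+-comm (length w) p ⟩
  p + length w                                         ∎
  where open ≡-Reasoning

bounded-grow : ∀ {k w} a → All (_< k) w → All (_≤ k) (w ++ replicate a k)
bounded-grow a <k = All.++⁺ (All.map ℕ.<⇒≤ <k) (All.replicate⁺ a ℕ.≤-refl)

grown : ∀ {k w t l} G → All (All (_< k)) (w ∷ G) → All Sorted (w ∷ G) → Linked (Below ℕ._>_) (w ∷ G) →
        Interlacing (length w) (shape G) t l → Grown k w G l (grow k l (w ∷ G))
grown {k} {w} {t} [] (<k ∷ _) (w↑ ∷ _) _ (last refl) = record
  { head      = _ , _ , refl
  ; shape-≡   = cong [_] (length-grow {k} {w} t)
  ; restricts = cong [_] (restrict-grow _ <k)
  ; sorted    = sorted-grow _ w↑ <k ∷ []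
  ; linked    = [-]
  ; bounded   = bounded-grow _ <k ∷ [] }
grown {k} {w} (v ∷ G) (<k ∷ <ks@(v<k ∷ _)) (w↑ ∷ ↑s) (b ∷ bs) (cons {l = l} p q _ le int) = record
  { head      = _ , _ , refl
  ; shape-≡   = cong₂ _∷_ (length-grow {k} {w} p) (Grown.shape-≡ rest)
  ; restricts = cong₂ _∷_ (restrict-grow _ <k) (Grown.restricts rest)
  ; sorted    = sorted-grow _ w↑ <k ∷ Grown.sorted rest
  ; linked    = link (Grown.head rest) (Grown.linked rest)
  ; bounded   = bounded-grow _ <k ∷ Grown.bounded rest }
  where
  rest : Grown k v G l (grow k l (v ∷ G))
  rest = grown G <ks ↑s bs int
  a = p + length w ∸ length w
  link : ∀ {G′} → (∃ λ c → ∃ λ G″ → G′ ≡ (v ++ replicate c k) ∷ G″) → Linked (Below ℕ._>_) G′ →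
         Linked (Below ℕ._>_) ((w ++ replicate a k) ∷ G′)
  link (c , _ , refl) linked = Below-grow a c v<k
    (ℕ.≤-trans (ℕ.≤-reflexive (trans (cong (_+_ (length w)) (ℕ.m+n∸n≡m p (length w)))
                                     (ℕ.+-comm (length w) p))) le) b ∷ linked

-- The converse of `grown`: the cells of the largest letter form a horizontal strip, and growing
-- along it restores what `restrict` has removed.
restricted : ∀ k w′ G′ → All Sorted (w′ ∷ G′) → All (All (_≤ k)) (w′ ∷ G′) → Linked (Below ℕ._>_) (w′ ∷ G′) →
  (∃ λ t → Interlacing (length (restrict k w′)) (shape (map (restrict k) G′)) t (shape (w′ ∷ G′))) ×
  grow k (shape (w′ ∷ G′)) (map (restrict k) (w′ ∷ G′)) ≡ w′ ∷ G′ ×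
  Linked (Below ℕ._>_) (map (restrict k) (w′ ∷ G′))
restricted k w′ [] (w↑ ∷ _) (≤k ∷ _) _ =
  (_ , last (ℕ.m∸n+n≡m (List.length-filter (ℕ._<? k) w′))) , cong [_] (restrict-row w↑ ≤k) , [-]
restricted k w′ (v′ ∷ G′) (w↑ ∷ ↑s) (≤k ∷ ≤ks) (b ∷ bs) =
  let (q , int) , eq , bs′ = restricted k v′ G′ ↑s ≤ks bs in
  (p + q , subst (λ n → Interlacing lo (shape (map (restrict k) (v′ ∷ G′))) (p + q) (n ∷ shape (v′ ∷ G′))) p+lo≡
         (cons p q refl (ℕ.≤-trans (ℕ.≤-reflexive p+lo≡) (Below-restrict-length ≤k b)) int)) ,
  cong₂ _∷_ (restrict-row w↑ ≤k) eq , Below-restrict w↑ ≤k b ∷ bs′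
  where
  lo = length (restrict k w′)
  p = length w′ ∸ lo
  p+lo≡ : p + lo ≡ length w′
  p+lo≡ = ℕ.m∸n+n≡m (List.length-filter (ℕ._<? k) w′)

restrict-concat : ∀ k G → restrict k (concat G) ≡ concat (map (restrict k) G)
restrict-concat k []      = refl
restrict-concat k (w ∷ G) = trans (List.filter-++ (ℕ._<? k) w (concat G))
                                    (cong (restrict k w ++_) (restrict-concat k G))

growth : ∀ β {G t l} → IsPadded β G → Interlacing 0 (shape G) t l →
         Grown (length β) [] G l (grow (length β) l ([] ∷ G))
growth β {G} (_ , ↑s , linked , content) int =
  grown G ([] ∷ All.concat⁻ (Content-< β content)) ([] ∷ ↑s) (linked-replicate 1 linked) int

padded-grow : ∀ b β {G l} → IsPadded β G → Interlacing 0 (shape G) b l →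
              IsPadded (b ∷ β) (grow (length β) l ([] ∷ G))
padded-grow b β {G} {l} padded@(len , _ , _ , content) int =
  trans (sym (List.length-map length G′)) (trans (cong length shape-≡)
    (trans (interlacing-length int) (cong suc (trans (List.length-map length G) len)))) ,
  sorted , linked , All.concat⁺ bounded , occ≡ , subst (Content β) (sym restrict≡) content
  where
  open Grown (growth β padded int)
  k = length β
  G′ = grow k l ([] ∷ G)
  restrict≡ : restrict k (concat G′) ≡ concat G
  restrict≡ = trans (restrict-concat k G′) (cong concat restricts)
  -- The multiplicity of `k` is found by comparing sizes: `restrict` removes just the letters `k`,
  -- and the strip has size `b`.
  occ≡ : occ k (concat G′) ≡ b
  occ≡ = ℕ.+-cancelʳ-≡ (length (concat G)) _ _ (begin
    occ k (concat G′) + length (concat G)                ≡⟨ cong (λ w → occ k (concat G′) + length w) restrict≡ ⟨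
    occ k (concat G′) + length (restrict k (concat G′))  ≡⟨ length-occ (All.concat⁺ bounded) ⟨
    length (concat G′)                                   ≡⟨ sum-shape G′ ⟨
    sum (shape G′)                                       ≡⟨ cong sum shape-≡ ⟩
    sum l                                                ≡⟨ interlacing-sum int ⟩
    b + sum (shape G)                                    ≡⟨ cong (_+_ b) (sum-shape G) ⟩
    b + length (concat G)                                ∎)
    where open ≡-Reasoning

tableaux-padded : ∀ β → All (IsPadded β) (tableaux β)
tableaux-padded []      = (refl , [] , [] , refl) ∷ []
tableaux-padded (b ∷ β) = all-concatMap _ (All.map (λ {G} padded →
  All.map⁺ (All.map (padded-grow b β padded) (strips-interlacing 0 (shape G) b))) (tableaux-padded β))

shape-tableaux : ∀ β → map shape (tableaux β) ≡ shapes β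
shape-tableaux []      = refl
shape-tableaux (b ∷ β) = begin
  map shape (concatMap extensions (tableaux β))
    ≡⟨ List.map-concatMap shape extensions (tableaux β) ⟩
  concatMap (map shape ∘ extensions) (tableaux β)
    ≡⟨ cong concat (List.map-cong-local (All.map (λ {G} padded → trans (sym (List.map-∘ (strips 0 (shape G) b)))
         (List.map-id-local (All.map (Grown.shape-≡ ∘ growth β padded) (strips-interlacing 0 (shape G) b))))
         (tableaux-padded β))) ⟩
  concatMap (λ G → strips 0 (shape G) b) (tableaux β)
    ≡⟨ List.concatMap-map (λ μ → strips 0 μ b) shape (tableaux β) ⟨
  concatMap (λ μ → strips 0 μ b) (map shape (tableaux β))
    ≡⟨ cong (concatMap (λ μ → strips 0 μ b)) (shape-tableaux β) ⟩
  shapes (b ∷ β)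
    ∎
  where
  open ≡-Reasoning
  extensions : Tableau ℕ → List (Tableau ℕ)
  extensions G = map (λ l → grow (length β) l ([] ∷ G)) (strips 0 (shape G) b)

-- The blocks for different p are disjoint because the statistic `r` recovers p from an element.
unique-steps : ∀ (r : A → ℕ) c k t (φ : ℕ → ℕ → List A) → (∀ p q → Unique (φ p q)) →
               (∀ p q → All (λ y → r y ≡ p + c) (φ p q)) → Unique (steps k t φ)
unique-steps r c zero    t       φ φ! rφ = []
unique-steps r c (suc k) zero    φ φ! rφ = φ! 0 0
unique-steps r c (suc k) (suc t) φ φ! rφ = Unique.++⁺ (φ! 0 (suc t))
  (unique-steps r (suc c) k t _ (λ p → φ! (suc p))
    (λ p q → All.map (λ eq → trans eq (sym (ℕ.+-suc p c))) (rφ (suc p) q)))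
  λ (y∈₁ , y∈₂) → ℕ.<-irrefl (sym (All.lookup (rφ 0 (suc t)) y∈₁)) (All.lookup later y∈₂)
  where
  later : All (λ y → suc c ≤ r y) (steps k t (λ p → φ (suc p)))
  later = all-steps k t _ (λ p q _ _ →
    All.map (λ eq → subst (suc c ≤_) (sym eq) (s≤s (ℕ.m≤n+m c p))) (rφ (suc p) q))

strips-! : ∀ lo μ t → Unique (strips lo μ t)
strips-! lo []      t = [] ∷ []
strips-! lo (m ∷ μ) t = unique-steps first lo (suc m ∸ lo) t _
  (λ p q → Unique.map⁺ List.∷-injectiveʳ (strips-! m μ q))
  (λ p q → All.map⁺ (All.universal (λ _ → refl) (strips m μ q)))
  where
  first : List ℕ → ℕ
  first []      = 0
  first (x ∷ _) = x

unique-concatMap : ∀ (f : A → List B) (r : B → A) {xs} → Unique xs →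
                   All (λ x → Unique (f x) × All (λ y → r y ≡ x) (f x)) xs → Unique (concatMap f xs)
unique-concatMap f r []         []                   = []
unique-concatMap f r {x ∷ xs} (x∉ ∷ xs!) ((fx! , rx) ∷ ps) = Unique.++⁺ fx! (unique-concatMap f r xs! ps)
  λ (y∈₁ , y∈₂) → disjoint (All.lookup rx y∈₁) (∈.∈-concatMap⁻ f y∈₂) x∉ ps
  where
  disjoint : ∀ {y xs} → r y ≡ x → Any (λ x′ → y ∈ f x′) xs → All (x ≢_) xs →
             All (λ x → Unique (f x) × All (λ y → r y ≡ x) (f x)) xs → ⊥
  disjoint eq (here y∈)  (x≢ ∷ _) ((_ , rx′) ∷ _) = x≢ (trans (sym eq) (All.lookup rx′ y∈))
  disjoint eq (there any) (_ ∷ x∉) (_ ∷ ps)        = disjoint eq any x∉ ps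

tableaux-! : ∀ β → Unique (tableaux β)
tableaux-! []      = [] ∷ []
tableaux-! (b ∷ β) = unique-concatMap _ (λ G′ → drop 1 (map (restrict (length β)) G′)) (tableaux-! β)
  (All.map (λ {G} padded →
    Unique.map⁻ {f = shape} (subst Unique (sym (trans (sym (List.map-∘ (strips 0 (shape G) b)))
      (List.map-id-local (All.map (Grown.shape-≡ ∘ growth β padded) (strips-interlacing 0 (shape G) b)))))
      (strips-! 0 (shape G) b)) ,
    All.map⁺ (All.map (λ int → cong (drop 1) (Grown.restricts (growth β padded int)))
      (strips-interlacing 0 (shape G) b)))
    (tableaux-padded β))

∈-steps : ∀ {y : A} k t φ p q → p < k → p + q ≡ t → y ∈ φ p q → y ∈ steps k t φ
∈-steps (suc k) zero    φ zero    q _         refl y∈ = y∈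
∈-steps (suc k) (suc t) φ zero    q _         refl y∈ = ∈.∈-++⁺ˡ y∈
∈-steps (suc k) (suc t) φ (suc p) q (s≤s p<k) eq     y∈ =
  ∈.∈-++⁺ʳ (φ 0 (suc t)) (∈-steps k t _ p q p<k (ℕ.suc-injective eq) y∈)

∈-strips : ∀ {lo μ t l} → Interlacing lo μ t l → l ∈ strips lo μ t
∈-strips (last refl)                             = here refl
∈-strips {lo} (cons {m = m} {μ} {t} p q eq le int) = ∈-steps (suc m ∸ lo) t _ p q
  (ℕ.m+n≤o⇒m≤o∸n (suc p) (s≤s le)) eq (∈.∈-map⁺ (p + lo ∷_) (∈-strips int))

∈-tableaux : ∀ β {G} → IsPadded β G → G ∈ tableaux β
∈-tableaux []      {[]}     _ = here refl
∈-tableaux (b ∷ β) {w ∷ G} (len , (w↑ ∷ G↑) , linked , (≤k , occ≡ , content)) =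
  ∈.∈-concatMap⁺ _ (lose (∈-tableaux β R-padded)
    (subst (_∈ map (λ l → grow k l ([] ∷ R)) (strips 0 (shape R) b)) grow≡
      (∈.∈-map⁺ _ (∈-strips int))))
  where
  k = length β
  R = map (restrict k) G
  -- There are `k` rows above the bottom row, so `row-entries` makes all of its entries at least
  -- `k`.
  bottom≡[] : restrict k w ≡ []
  bottom≡[] = List.filter-none (ℕ._<? k) (All.map (λ le lt → ℕ.<-irrefl refl
    (ℕ.<-≤-trans lt (subst (_≤ _) (ℕ.suc-injective len) le))) (row-entries linked))
  all-restricted = restricted k w G (w↑ ∷ G↑) (All.concat⁻ ≤k) linked
  t = proj₁ (proj₁ all-restricted)
  int₀ : Interlacing 0 (shape R) t (shape (w ∷ G))
  int₀ = subst (λ u → Interlacing (length u) (shape R) t (shape (w ∷ G))) bottom≡[] (proj₂ (proj₁ all-restricted))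
  concat≡ : restrict k (concat (w ∷ G)) ≡ concat R
  concat≡ = trans (restrict-concat k (w ∷ G)) (cong (_++ concat R) bottom≡[])
  t≡b : t ≡ b
  t≡b = ℕ.+-cancelʳ-≡ (length (concat R)) _ _ (begin
    t + length (concat R)                  ≡⟨ cong (_+_ t) (sum-shape R) ⟨
    t + sum (shape R)                      ≡⟨ interlacing-sum int₀ ⟨
    sum (shape (w ∷ G))                    ≡⟨ sum-shape (w ∷ G) ⟩
    length (concat (w ∷ G))                ≡⟨ length-occ ≤k ⟩
    occ k (concat (w ∷ G)) + length (restrict k (concat (w ∷ G)))
                                           ≡⟨ cong₂ (λ n u → n + length u) occ≡ concat≡ ⟩
    b + length (concat R)                  ∎)
    where open ≡-Reasoning
  int : Interlacing 0 (shape R) b (shape (w ∷ G))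
  int = subst (λ t → Interlacing 0 (shape R) t (shape (w ∷ G))) t≡b int₀
  grow≡ : grow k (shape (w ∷ G)) ([] ∷ R) ≡ w ∷ G
  grow≡ = trans (cong (λ u → grow k (shape (w ∷ G)) (u ∷ R)) (sym bottom≡[])) (proj₁ (proj₂ all-restricted))
  R-padded : IsPadded β R
  R-padded = trans (List.length-map (restrict k) G) (ℕ.suc-injective len) ,
    All.map⁺ (All.map (Linked.filter⁺ (ℕ._<? k) ℕ.≤-trans) G↑) ,
    Linked.tail (proj₂ (proj₂ all-restricted)) ,
    subst (Content β) concat≡ content

semistandard-count : ∀ β {sh} → All (0 <_) sh →
  length (semistandard sh (reverse β)) ≡ length (filter (λ G → padShape (length β) sh ≟ shape G) (tableaux β))
semistandard-count β {sh} pos = length-bijection (pad k) unpad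
  (select-! ℕ._≟_ (semistandardOf? sh (reverse β)) (fillings (upTo (length (reverse β))) sh))
  (Unique.filter⁺ shape? (tableaux-! β))
  (λ {T} T∈ → let T-ss = Equivalence.to (∈-semistandard sh (reverse β) T) T∈ in
    ∈.∈-filter⁺ shape? (∈-tableaux β (padded T T-ss))
      (sym (trans (shape-pad k T) (cong (padShape k) (proj₁ (proj₂ T-ss))))) ,
    unpad-pad k (All.map⁻ (proj₁ (proj₁ (proj₁ T-ss)))))
  (λ {G} G∈ → let G∈′ , eq = ∈.∈-filter⁻ shape? {xs = tableaux β} G∈
                  G-padded = All.lookup (tableaux-padded β) G∈′
                  inv = pad-unpad G (proj₁ G-padded) in
    Equivalence.from (∈-semistandard sh (reverse β) (unpad G)) (unpadded G G-padded eq inv) , inv)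
  where
  k = length β
  shape? : Decidable (λ (G : Tableau ℕ) → padShape k sh ≡ shape G)
  shape? G = padShape k sh ≟ shape G
  length-rev = List.length-reverse β

  padded : ∀ T → SemistandardOf sh (reverse β) T → IsPadded β (pad k T)
  padded T ((part , ↑s , cols) , _ , (<n , occs≡)) =
    length-pad , all-pad k [] ↑s , linked-pad k part cols ,
    Content-↭ β (↭-trans (↭-sym (concat-reverse T)) (↭-reflexive (sym (concat-pad k T))))
      (occs⇒Content β <k (subst (λ n → occs n (concat T) ≡ reverse β) length-rev occs≡))
    where
    <k : All (_< k) (concat T)
    <k = subst (λ n → All (_< n) (concat T)) length-rev <n
    rows-≤k : ∀ {G} → Linked (Below ℕ._>_) G → All NonEmpty G → All (All (_< k)) G → length G ≤ k
    rows-≤k {[]}          _ _       _               = z≤n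
    rows-≤k {(x ∷ w) ∷ G} l (_ ∷ _) ((x<k ∷ _) ∷ _) with row-entries l
    ... | le ∷ _ = ℕ.≤-<-trans le x<k
    -- The bottom row is nonempty; its entries are at least the number of rows above it, yet less
    -- than `k`.
    T≤k : length T ≤ k
    T≤k = subst (_≤ k) (List.length-reverse T) (rows-≤k
            (subst (Linked (Below ℕ._>_)) pad-0 (linked-pad 0 part cols))
            (all-reverse (All.map⁻ (proj₁ part))) (all-reverse (All.concat⁻ {xss = T} <k)))
      where
      pad-0 : pad 0 T ≡ reverse T
      pad-0 = cong (λ n → replicate n [] ++ reverse T) (ℕ.0∸n≡0 (length T))
    length-pad : length (pad k T) ≡ k
    length-pad = begin
      length (pad k T)                                  ≡⟨ List.length-++ (replicate (k ∸ length T) []) ⟩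
      length (replicate (k ∸ length T) []) + length (reverse T)
        ≡⟨ cong₂ _+_ (List.length-replicate (k ∸ length T)) (List.length-reverse T) ⟩
      k ∸ length T + length T                           ≡⟨ ℕ.m∸n+n≡m T≤k ⟩
      k                                                 ∎
      where open ≡-Reasoning

  unpadded : ∀ G → IsPadded β G → padShape k sh ≡ shape G → pad k (unpad G) ≡ G →
             SemistandardOf sh (reverse β) (unpad G)
  unpadded G (len , ↑s , linked , content) eq inv =
    (proj₁ (unpad-shape linked) , all-unpad ↑s , proj₂ (unpad-shape linked)) ,
    padShape-injective k (proj₁ (proj₁ (unpad-shape linked))) pos
      (trans (sym (shape-pad k (unpad G))) (trans (cong shape inv) (sym eq))) ,
    subst (λ n → All (_< n) (concat (unpad G))) (sym length-rev) (Content-< β content′) ,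
    subst (λ n → occs n (concat (unpad G)) ≡ reverse β) (sym length-rev) (Content⇒occs β content′)
    where
    content′ : Content β (concat (unpad G))
    content′ = Content-↭ β (↭-trans (↭-reflexive (trans (cong concat (sym inv)) (concat-pad k (unpad G))))
                                    (concat-reverse (unpad G))) content

-- Summation over all shapes

length-filter-map : ∀ {P : B → Set} (P? : Decidable P) (f : A → B) xs →
                    length (filter P? (map f xs)) ≡ length (filter (P? ∘ f) xs)
length-filter-map P? f []       = refl
length-filter-map P? f (x ∷ xs) with P? (f x)
... | yes _ = cong suc (length-filter-map P? f xs)
... | no _  = length-filter-map P? f xs

-- Exchanges the sum over shapes with the sum over Dyck tableaux, after which each tableau is
-- weighted by the multiplicity of its own shape, a Kostka number.
double-count : ∀ {Q : A → B → Set} (Q? : ∀ x y → Dec (Q x y)) xs ys →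
  total ys (λ y → + length (filter (λ x → Q? x y) xs)) ≡ + sum (map (λ x → length (filter (Q? x) ys)) xs)
double-count Q? xs []       = cong +_ (zeros xs)
  where
  zeros : ∀ (xs : List A) → 0 ≡ sum (map (λ _ → 0) xs)
  zeros []       = refl
  zeros (_ ∷ xs) = zeros xs
double-count Q? xs (y ∷ ys) = trans (cong (ℤ._+_ (+ length (filter (λ x → Q? x y) xs))) (double-count Q? xs ys))
                                      (cong +_ (column xs))
  where
  rows : List _ → ℕ
  rows xs = sum (map (λ x → length (filter (Q? x) ys)) xs)
  exchange : ∀ a b c → a + (b + c) ≡ b + (a + c)
  exchange = ℕ-Solver.solve-∀
  column : ∀ xs → length (filter (λ x → Q? x y) xs) + rows xs ≡
                  sum (map (λ x → length (filter (Q? x) (y ∷ ys))) xs)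
  column []       = refl
  column (x ∷ xs) with Q? x y
    | trans (exchange (length (filter (λ x → Q? x y) xs)) (length (filter (Q? x) ys)) (rows xs))
            (cong (_+_ (length (filter (Q? x) ys))) (column xs))
  ... | yes _ | eq = cong suc eq
  ... | no _  | eq = eq

corollary3p19 : (S : Multiset) (d : ℕ) →
    DS* S d ≈ ∑ (dyckTableaux S d) (λ P → schur (shape P))
corollary3p19 S d α = ℤ.+-injective (begin
  + DS* S d α
    ≡⟨ cong (λ α → + DS* S d α) (List.reverse-involutive α) ⟨
  + DS* S d (reverse β)
    ≡⟨ Count.DS*-expansion S d β ⟩
  total (shapes β) (λ l → Count.tableauCount S d (map +_ l))
    ≡⟨ total-cong (All.map (λ {l} len → trans (tableauCount-dyckTableaux S d l)
         (cong (λ k → + length (filter (λ P → padShape k (shape P) ≟ l) Ps)) len))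
         (shapes-length β)) ⟩
  total (shapes β) (λ l → + length (filter (λ P → padShape k (shape P) ≟ l) Ps))
    ≡⟨ double-count (λ P l → padShape k (shape P) ≟ l) Ps (shapes β) ⟩
  + sum (map (λ P → length (filter (padShape k (shape P) ≟_) (shapes β))) Ps)
    ≡⟨ cong (λ ns → + sum ns) (List.map-cong-local (All.tabulate λ {P} P∈ → kostka P
         (proj₁ (proj₁ (Equivalence.to (∈-dyckTableaux S d P) P∈))))) ⟩
  + sum (map (λ P → schur (shape P) α) Ps)
    ∎)
  where
  open ≡-Reasoning
  β = reverse α
  k = length β
  Ps = dyckTableaux S d
  kostka : ∀ P → IsPartition (shape P) →
           length (filter (padShape k (shape P) ≟_) (shapes β)) ≡ schur (shape P) α
  kostka P (pos , _) = begin
    length (filter (padShape k (shape P) ≟_) (shapes β))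
      ≡⟨ cong (λ ls → length (filter (padShape k (shape P) ≟_) ls)) (shape-tableaux β) ⟨
    length (filter (padShape k (shape P) ≟_) (map shape (tableaux β)))
      ≡⟨ length-filter-map (padShape k (shape P) ≟_) shape (tableaux β) ⟩
    length (filter (λ G → padShape k (shape P) ≟ shape G) (tableaux β))
      ≡⟨ semistandard-count β pos ⟨
    length (semistandard (shape P) (reverse β))
      ≡⟨ cong (schur (shape P)) (List.reverse-involutive α) ⟩
    schur (shape P) α
      ∎
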